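{- For every positive integer $k$, as $n \to \infty$, $$d_{K_{1,2k}}(n)=\Theta_k\!\left(\frac{1}{n^k}\right) \quad\text{and}\quad d_{M_{2k}}(n)=\Theta_k\!\left(\frac{1}{n^k}\right),$$ where the constants implicit in $\Theta_k$ depend only on $k$.
   Context: For a graph $H$ and an integer $n$, a family $\mathcal{F}$ of graphs on the vertex set $[n]=\{1,\dots,n\}$ is called an $H$-code if no two distinct members $G_1=([n],E_1)$, $G_2=([n],E_2)$ of $\mathcal{F}$ have symmetric difference $([n],E_1\oplus E_2)$ isomorphic to $H$ (isolated vertices ignored, i.e. the edge set $E_1\oplus E_2$ forms a copy of $H$ in the complete graph on $[n]$). Let $D_H(n)$ be the maximum cardinality of an $H$-code on $[n]$ and $d_H(n)=D_H(n)/2^{\binom{n}{2}}$. $K_{1,t}$ denotes the star with $t$ edges and $M_t$ denotes the matching with $t$ edges. -}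

module Defs where

open import Data.Nat using (ℕ; zero; suc; _+_; _*_; _^_; _≤_; _≡ᵇ_)
open import Data.Nat.Combinatorics using (_C_)
open import Data.Bool using (Bool; true; false; _∧_; _xor_)
open import Data.Fin using (Fin; zero; suc; toℕ)
open import Data.Product using (Σ; ∃; _×_; _,_)
open import Data.List using (List; length)
open import Data.List.Relation.Unary.AllPairs using (AllPairs)
open import Relation.Nullary using (¬_)
open import Relation.Binary.PropositionalEquality using (_≡_; refl; _≢_)
open import Function.Definitions using (Injective)

record Graph (V : Set) : Set where
  field
    adj    : V → V → Bool
    sym    : ∀ u v → adj u v ≡ adj v u
    irrefl : ∀ v → adj v v ≡ false
open Graph public

GraphOn : ℕ → Set
GraphOn n = Graph (Fin n)

Distinct : ∀ {n} → GraphOn n → GraphOn n → Set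
Distinct {n} G₁ G₂ = Σ (Fin n) λ u → Σ (Fin n) λ v → adj G₁ u v ≢ adj G₂ u v

symDiff : ∀ {n} → GraphOn n → GraphOn n → Fin n → Fin n → Bool
symDiff G₁ G₂ u v = adj G₁ u v xor adj G₂ u v

-- The edge set E (on [n]) forms a copy of H (isolated vertices ignored;
-- H here is assumed to have no isolated vertices): there is an injective
-- vertex map φ : V(H) → [n] whose image of E(H) is exactly E.
IsCopyOf : ∀ {V : Set} {n} → Graph V → (Fin n → Fin n → Bool) → Set
IsCopyOf {V} {n} H E =
  Σ (V → Fin n) λ φ → Injective _≡_ _≡_ φ ×
    (∀ u v → (E u v ≡ true → Σ V λ a → Σ V λ b → adj H a b ≡ true × φ a ≡ u × φ b ≡ v)
           × (Σ V (λ a → Σ V λ b → adj H a b ≡ true × φ a ≡ u × φ b ≡ v) → E u v ≡ true))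

IsCode : ∀ {V : Set} {n} → Graph V → List (GraphOn n) → Set
IsCode H F = AllPairs (λ G₁ G₂ → Distinct G₁ G₂ × ¬ IsCopyOf H (symDiff G₁ G₂)) F

starAdj : ∀ t → Fin (suc t) → Fin (suc t) → Bool
starAdj t zero zero = false
starAdj t zero (suc _) = true
starAdj t (suc _) zero = true
starAdj t (suc _) (suc _) = false

Star : (t : ℕ) → Graph (Fin (suc t))
Star t = record { adj = starAdj t ; sym = s ; irrefl = i }
  where
  s : ∀ u v → starAdj t u v ≡ starAdj t v u
  s zero zero = refl
  s zero (suc _) = refl
  s (suc _) zero = refl
  s (suc _) (suc _) = refl
  i : ∀ v → starAdj t v v ≡ false
  i zero = refl
  i (suc _) = refl

≡ᵇ-sym : ∀ m n → (m ≡ᵇ n) ≡ (n ≡ᵇ m)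
≡ᵇ-sym zero zero = refl
≡ᵇ-sym zero (suc n) = refl
≡ᵇ-sym (suc m) zero = refl
≡ᵇ-sym (suc m) (suc n) = ≡ᵇ-sym m n

matchAdj : ∀ t → Fin t × Bool → Fin t × Bool → Bool
matchAdj t (i , b) (j , c) = (toℕ i ≡ᵇ toℕ j) ∧ (b xor c)

Matching : (t : ℕ) → Graph (Fin t × Bool)
Matching t = record { adj = matchAdj t ; sym = s ; irrefl = ir }
  where
  xs : ∀ b c → (b xor c) ≡ (c xor b)
  xs false false = refl
  xs false true = refl
  xs true false = refl
  xs true true = refl
  s : ∀ u v → matchAdj t u v ≡ matchAdj t v u
  s (i , b) (j , c) rewrite ≡ᵇ-sym (toℕ i) (toℕ j) | xs b c = refl
  xx : ∀ b → (b xor b) ≡ false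
  xx false = refl
  xx true = refl
  ∧f : ∀ a → (a ∧ false) ≡ false
  ∧f false = refl
  ∧f true = refl
  ir : ∀ v → matchAdj t v v ≡ false
  ir (i , b) rewrite xx b = ∧f (toℕ i ≡ᵇ toℕ i)

-- d_H(n) = D_H(n) / 2^(n choose 2) = Θ(1/n^k), i.e. there are constants
-- A, B (depending only on H, k) and a threshold N such that for n ≥ N:
--   * some H-code F on [n] has 2^(n C 2) ≤ A · |F| · n^k   (lower bound on D_H)
--   * every H-code F on [n] has |F| · n^k ≤ B · 2^(n C 2)  (upper bound on D_H)
ThetaInvPow : ∀ {V : Set} → Graph V → ℕ → Set
ThetaInvPow H k =
  Σ ℕ λ A → Σ ℕ λ B → Σ ℕ λ N → ∀ n → N ≤ n →
    (Σ (List (GraphOn n)) λ F → IsCode H F × 2 ^ (n C 2) ≤ A * length F * n ^ k)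
    × (∀ (F : List (GraphOn n)) → IsCode H F → length F * n ^ k ≤ B * 2 ^ (n C 2))

{-# OPTIONS --safe #-}
module Submission where

-- Upper bound.  Fix ℓ s disjoint or concurrent edges in ℓ groups of s.  Toggling one edge per
-- group embeds [s]^ℓ among the graphs on [n], and two words at Hamming distance k give graphs
-- that differ by a star or a matching with 2k edges.  By averaging it suffices that a set
-- A ⊆ [s]^ℓ without two words at distance exactly k has O(s^(ℓ-k)) elements.  Call a difference
-- set D robust at x if A contains words differing from x exactly on D in a flexible way.  Walking
-- along robust differences realises any union of them as a difference, so no union has size k;
-- for ℓ large a greedy choice then yields a k-set K containing no nonempty robust set, and each
-- fibre over the coordinates outside K has bounded size.
--
-- Lower bound.  Let p be a prime between n + k and 128 n.  Two graphs G, G′ with equally many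
-- edges modulo 2k + 1 and equal products ∏ (j + u) modulo p for 0 ≤ j < k, where u runs over the
-- smaller ends (matchings) or both ends (stars) of the edges, do not differ by 2k edges of the
-- forbidden shape: G∖G′ and G′∖G would each have k edges, and the two monic polynomials of
-- degree k in j attached to them would agree at k points, hence have a common root.  The pigeonhole
-- principle gives a class of at least 2^(n C 2) / ((2k + 1) p^k) graphs.
--
-- Primes.  If no prime lay in (t² , 16 t²] with t = 2^g, the product of the primes up to 16 t² would
-- be at most 4^(t²), and (4t)!^(2g+4) times it, a common multiple of 1 , … , 16 t², would be
-- smaller than the central binomial coefficient dividing it.

-- Only the orders of magnitude of `s ^ k` and `p ^ k` matter. The averaging compares all `s ^ ℓ`
-- words with `O(s ^ (ℓ - k))` admissible ones; the gain `s ^ k` does not depend on ℓ, so ℓ may be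
-- any constant large enough for the greedy choice. The obstacle on the way is that consecutive
-- steps of a walk can cancel in a shared coordinate. Hence a robust step must be able to avoid any
-- prescribed word throughout D, in particular the start of the walk, and differences then add up to
-- unions. In the lower bound any prime of order n serves, so a crude gap of ratio 16 suffices.
-- Products are multiplicative, so the edges common to G and G′ cancel as long as no factor vanishes
-- modulo p; this is why p must exceed every j + u. The modulus 2k + 1 exceeds any imbalance between
-- two halves with at most 2k edges together. The centre of a star is not known in advance, so both
-- ends of an edge enter; the centre gives every edge of the star the same factor, equally often in
-- both halves, and cancels too.

open import Defs hiding (sym)

-- A prime between t² and 16 t², for t a power of two.

module PrimeGap where

  open import Data.Nat
  open import Data.Nat.Properties
  open import Data.Nat.Divisibility
  open import Data.Nat.Primality
  open import Data.Nat.Primality.Factorisation using (factorise)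
  open import Data.Nat.Tactic.RingSolver using (solve-∀)
  open import Data.List using ([]; _∷_; length)
  open import Data.Nat.ListAction using (product)
  open import Data.List.Relation.Unary.All using (All; []; _∷_)
  open import Data.Product using (∃; _×_; _,_)
  open import Data.Sum using (_⊎_; inj₁; inj₂)
  open import Relation.Nullary using (yes; no; contradiction)
  open import Relation.Binary.PropositionalEquality

  binom : ℕ → ℕ → ℕ
  binom zero    b       = 1
  binom (suc a) zero    = 1
  binom (suc a) (suc b) = binom a (suc b) + binom (suc a) b

  binom-! : ∀ a b → binom a b * (a ! * b !) ≡ (a + b) !
  binom-! zero b = trans (*-identityˡ _) (*-identityˡ _)
  binom-! (suc a) zero = begin
    1 * (suc a ! * 1) ≡⟨ trans (*-identityˡ _) (*-identityʳ _) ⟩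
    suc a !           ≡⟨ cong _! (sym (+-identityʳ (suc a))) ⟩
    (suc a + 0) !     ∎
    where open ≡-Reasoning
  binom-! (suc a) (suc b) = begin
    (binom a (suc b) + binom (suc a) b) * ((suc a * a !) * (suc b * b !))
      ≡⟨ regroup (binom a (suc b)) (binom (suc a) b) a (a !) b (b !) ⟩
    suc a * (binom a (suc b) * (a ! * suc b !)) + suc b * (binom (suc a) b * (suc a ! * b !))
      ≡⟨ cong₂ (λ u v → suc a * u + suc b * v) (binom-! a (suc b)) (binom-! (suc a) b) ⟩
    suc a * (a + suc b) ! + suc b * (suc a + b) !
      ≡⟨ cong (λ u → suc a * u ! + suc b * (suc a + b) !) (+-suc a b) ⟩
    suc a * (suc a + b) ! + suc b * (suc a + b) !
      ≡⟨ sym (*-distribʳ-+ ((suc a + b) !) (suc a) (suc b)) ⟩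
    (suc a + suc b) * (suc a + b) !
      ≡⟨ cong (λ u → (suc a + suc b) * u !) (sym (+-suc a b)) ⟩
    (suc a + suc b) ! ∎
    where
    open ≡-Reasoning
    regroup : ∀ x y a f b g → (x + y) * ((suc a * f) * (suc b * g)) ≡
              suc a * (x * (f * (suc b * g))) + suc b * (y * ((suc a * f) * g))
    regroup = solve-∀

  binom-sucˡ : ∀ a b → suc a * binom (suc a) b ≡ suc (a + b) * binom a b
  binom-sucˡ a b = *-cancelʳ-≡ _ _ (a ! * b !) {{m*n≢0 (a !) (b !) {{a !≢0}} {{b !≢0}}}} (begin
    suc a * binom (suc a) b * (a ! * b !)     ≡⟨ regroup (suc a) (binom (suc a) b) (a !) (b !) ⟩
    binom (suc a) b * (suc a ! * b !)         ≡⟨ binom-! (suc a) b ⟩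
    suc (a + b) * (a + b) !                   ≡⟨ cong (suc (a + b) *_) (sym (binom-! a b)) ⟩
    suc (a + b) * (binom a b * (a ! * b !))   ≡⟨ sym (*-assoc (suc (a + b)) (binom a b) _) ⟩
    suc (a + b) * binom a b * (a ! * b !)     ∎)
    where
    open ≡-Reasoning
    regroup : ∀ a x f g → a * x * (f * g) ≡ x * (a * f * g)
    regroup = solve-∀

  binom-sucʳ : ∀ a b → suc b * binom a (suc b) ≡ suc (a + b) * binom a b
  binom-sucʳ a b = *-cancelʳ-≡ _ _ (a ! * b !) {{m*n≢0 (a !) (b !) {{a !≢0}} {{b !≢0}}}} (begin
    suc b * binom a (suc b) * (a ! * b !)     ≡⟨ regroup (suc b) (binom a (suc b)) (a !) (b !) ⟩
    binom a (suc b) * (a ! * suc b !)         ≡⟨ binom-! a (suc b) ⟩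
    (a + suc b) !                             ≡⟨ cong _! (+-suc a b) ⟩
    suc (a + b) * (a + b) !                   ≡⟨ cong (suc (a + b) *_) (sym (binom-! a b)) ⟩
    suc (a + b) * (binom a b * (a ! * b !))   ≡⟨ sym (*-assoc (suc (a + b)) (binom a b) _) ⟩
    suc (a + b) * binom a b * (a ! * b !)     ∎)
    where
    open ≡-Reasoning
    regroup : ∀ b x f g → b * x * (f * g) ≡ x * (f * (b * g))
    regroup = solve-∀

  binom-monoʳ : ∀ a b → binom a b ≤ binom a (suc b)
  binom-monoʳ zero    b       = ≤-refl
  binom-monoʳ (suc a) zero    = m≤n+m 1 _
  binom-monoʳ (suc a) (suc b) = m≤n+m (binom (suc a) (suc b)) (binom a (2 + b))

  binom-monoˡ : ∀ a b → binom a b ≤ binom (suc a) b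
  binom-monoˡ zero    zero    = ≤-refl
  binom-monoˡ zero    (suc b) = m≤m+n 1 _
  binom-monoˡ (suc a) zero    = ≤-refl
  binom-monoˡ (suc a) (suc b) = m≤m+n _ _

  2^n≤binom : ∀ n → 2 ^ n ≤ binom n n
  2^n≤binom zero    = ≤-refl
  2^n≤binom (suc n) = begin
    2 * 2 ^ n                             ≡⟨ cong (2 ^ n +_) (+-identityʳ _) ⟩
    2 ^ n + 2 ^ n                         ≤⟨ +-mono-≤ ih ih ⟩
    binom n n + binom n n                 ≤⟨ +-mono-≤ (binom-monoʳ n n) (binom-monoˡ n n) ⟩
    binom n (suc n) + binom (suc n) n     ∎
    where
    open ≤-Reasoning
    ih = 2^n≤binom n

  binom≤2^ : ∀ a b → binom a b ≤ 2 ^ (a + b)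
  binom≤2^ zero    b       = m^n>0 2 b
  binom≤2^ (suc a) zero    = m^n>0 2 (suc a + 0)
  binom≤2^ (suc a) (suc b) = begin
    binom a (suc b) + binom (suc a) b     ≤⟨ +-mono-≤ (binom≤2^ a (suc b)) (binom≤2^ (suc a) b) ⟩
    2 ^ (a + suc b) + 2 ^ (suc a + b)     ≡⟨ cong (λ e → 2 ^ (a + suc b) + 2 ^ e) (sym (+-suc a b)) ⟩
    2 ^ (a + suc b) + 2 ^ (a + suc b)     ≡⟨ cong (2 ^ (a + suc b) +_) (sym (+-identityʳ _)) ⟩
    2 ^ (suc a + suc b)                   ∎
    where open ≤-Reasoning

  binom>0 : ∀ a b → NonZero (binom a b)
  binom>0 zero    b       = _
  binom>0 (suc a) zero    = _
  binom>0 (suc a) (suc b) = >-nonZero (<-≤-trans (>-nonZero⁻¹ _ {{binom>0 (suc a) b}}) (m≤n+m _ _))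

  -- The reciprocals of the entries of the Leibniz harmonic triangle.
  leibniz : ℕ → ℕ → ℕ
  leibniz a b = suc (a + b) * binom a b

  -- Uses 1 / leibniz (suc a) b = 1 / leibniz a b − 1 / leibniz a (suc b).
  leibniz∣ : ∀ {M X} → (∀ i → i < M → suc i ∣ X) → ∀ a b → a + b < M → leibniz a b ∣ X
  leibniz∣ {M} {X} common zero b b<M = subst (_∣ X) (sym (*-identityʳ (suc b))) (common b b<M)
  leibniz∣ {M} {X} common (suc a) b a+b<M
    with leibniz∣ common a b (<-trans (n<1+n _) a+b<M)
       | leibniz∣ common a (suc b) (subst (_< M) (sym (+-suc a b)) a+b<M)
  ... | divides c₁ X≡c₁D | divides c₂ X≡c₂E = divides (c₁ ∸ c₂) (sym (*-cancelʳ-≡ _ _ (suc a) (begin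
      (c₁ ∸ c₂) * (n * B′) * suc a      ≡⟨ regroup₁ (c₁ ∸ c₂) n B′ (suc a) ⟩
      (c₁ ∸ c₂) * n * (suc a * B′)      ≡⟨ cong ((c₁ ∸ c₂) * n *_) (binom-sucˡ a b) ⟩
      (c₁ ∸ c₂) * n * D                 ≡⟨ cong (_* D) (*-distribʳ-∸ n c₁ c₂) ⟩
      (c₁ * n ∸ c₂ * n) * D             ≡⟨ cong (λ u → (c₁ * n ∸ u) * D) c₂n≡ ⟩
      (c₁ * n ∸ c₁ * suc b) * D         ≡⟨ cong (_* D) (sym (*-distribˡ-∸ c₁ n (suc b))) ⟩
      c₁ * (n ∸ suc b) * D              ≡⟨ cong (λ u → c₁ * u * D) n∸b≡ ⟩
      c₁ * suc a * D                    ≡⟨ regroup₂ c₁ (suc a) D ⟩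
      c₁ * D * suc a                    ≡⟨ cong (_* suc a) (sym X≡c₁D) ⟩
      X * suc a                         ∎)))
    where
    open ≡-Reasoning
    n  = suc (suc (a + b))
    B′ = binom (suc a) b
    D  = leibniz a b
    instance
      D≢0 : NonZero D
      D≢0 = m*n≢0 (suc (a + b)) (binom a b) {{_}} {{binom>0 a b}}
    regroup₁ : ∀ x y z w → x * (y * z) * w ≡ x * y * (w * z)
    regroup₁ = solve-∀
    regroup₂ : ∀ x y z → x * y * z ≡ x * z * y
    regroup₂ = solve-∀
    regroup₃ : ∀ x y b z → x * y * (b * z) ≡ b * (x * (y * z))
    regroup₃ = solve-∀
    n∸b≡ : n ∸ suc b ≡ suc a
    n∸b≡ = trans (cong (_∸ suc b) (cong suc (sym (+-suc a b)))) (m+n∸n≡m (suc a) (suc b))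
    c₂n≡ : c₂ * n ≡ c₁ * suc b
    c₂n≡ = *-cancelʳ-≡ _ _ D (begin
      c₂ * n * D                                        ≡⟨ cong (c₂ * n *_) (sym (binom-sucʳ a b)) ⟩
      c₂ * n * (suc b * binom a (suc b))                ≡⟨ regroup₃ c₂ n (suc b) (binom a (suc b)) ⟩
      suc b * (c₂ * (n * binom a (suc b)))
        ≡⟨ cong (λ u → suc b * (c₂ * (suc u * binom a (suc b)))) (sym (+-suc a b)) ⟩
      suc b * (c₂ * leibniz a (suc b))                  ≡⟨ cong (suc b *_) (sym X≡c₂E) ⟩
      suc b * X                                         ≡⟨ cong (suc b *_) X≡c₁D ⟩
      suc b * (c₁ * D)                                  ≡⟨ regroup₄ (suc b) c₁ D ⟩
      c₁ * suc b * D                                    ∎)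
      where
      regroup₄ : ∀ x y z → x * (y * z) ≡ y * x * z
      regroup₄ = solve-∀

  primorial : ℕ → ℕ
  primorial zero = 1
  primorial (suc n) with prime? (suc n)
  ... | yes _ = suc n * primorial n
  ... | no  _ = primorial n

  primorial≢0 : ∀ n → NonZero (primorial n)
  primorial≢0 zero = _
  primorial≢0 (suc n) with prime? (suc n)
  ... | yes _ = m*n≢0 (suc n) (primorial n) {{_}} {{primorial≢0 n}}
  ... | no  _ = primorial≢0 n

  prime∣primorial : ∀ {p} n → Prime p → p ≤ n → p ∣ primorial n
  prime∣primorial {zero} zero pp _ = contradiction pp ¬prime[0]
  prime∣primorial {p} (suc n) pp p≤1+n with prime? (suc n) | m≤n⇒m<n∨m≡n p≤1+n
  ... | yes _ | inj₁ p<1+n = ∣n⇒∣m*n (suc n) (prime∣primorial n pp (≤-pred p<1+n))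
  ... | yes _ | inj₂ refl  = m∣m*n (primorial n)
  ... | no _  | inj₁ p<1+n = prime∣primorial n pp (≤-pred p<1+n)
  ... | no ¬p | inj₂ refl  = contradiction pp ¬p

  prime∣prime⇒≡ : ∀ {p q} → Prime p → Prime q → p ∣ q → p ≡ q
  prime∣prime⇒≡ {p} {q} pp pq p∣q with prime⇒irreducible pq p∣q
  ... | inj₁ refl = contradiction pp ¬prime[1]
  ... | inj₂ p≡q  = p≡q

  -- Dividing Y by the largest prime of the interval leaves a cofactor that the smaller primes still
  -- divide, by Euclid's lemma.
  primorial-∣ : ∀ a d {Y} → (∀ {p} → Prime p → a < p → p ≤ a + d → p ∣ Y) →
                primorial (a + d) ∣ Y * primorial a
  primorial-∣ a zero {Y} _ rewrite +-identityʳ a = ∣n⇒∣m*n Y ∣-refl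
  primorial-∣ a (suc d) {Y} all∣Y rewrite +-suc a d with prime? (suc (a + d))
  ... | no _ = primorial-∣ a d (λ pp a<p p≤ → all∣Y pp a<p (m≤n⇒m≤1+n p≤))
  ... | yes pq with all∣Y pq (s≤s (m≤m+n a d)) ≤-refl
  ...   | divides Z refl = subst (suc (a + d) * primorial (a + d) ∣_) (regroup (suc (a + d)) Z (primorial a))
            (*-monoʳ-∣ (suc (a + d)) (primorial-∣ a d {Z} rest))
    where
    regroup : ∀ q z t → q * (z * t) ≡ z * q * t
    regroup = solve-∀
    rest : ∀ {p} → Prime p → a < p → p ≤ a + d → p ∣ Z
    rest pp a<p p≤ with euclidsLemma Z (suc (a + d)) pp (all∣Y pp a<p (m≤n⇒m≤1+n p≤))
    ... | inj₁ p∣Z = p∣Z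
    ... | inj₂ p∣q = contradiction (prime∣prime⇒≡ pp pq p∣q) (<⇒≢ (s≤s p≤))

  prime∣!⇒≤ : ∀ {p} n → Prime p → p ∣ n ! → p ≤ n
  prime∣!⇒≤ zero pp p∣1 = contradiction (subst Prime (∣1⇒≡1 p∣1) pp) ¬prime[1]
  prime∣!⇒≤ (suc n) pp p∣ with euclidsLemma (suc n) (n !) pp p∣
  ... | inj₁ p∣1+n = ∣⇒≤ p∣1+n
  ... | inj₂ p∣n!  = m≤n⇒m≤1+n (prime∣!⇒≤ n pp p∣n!)

  ≤⇒∣! : ∀ {m} n → 1 ≤ m → m ≤ n → m ∣ n !
  ≤⇒∣! zero 1≤m m≤0 = contradiction (≤-trans 1≤m m≤0) λ ()
  ≤⇒∣! (suc n) 1≤m m≤1+n with m≤n⇒m<n∨m≡n m≤1+n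
  ... | inj₁ m<1+n = ∣n⇒∣m*n (suc n) (≤⇒∣! n 1≤m (≤-pred m<1+n))
  ... | inj₂ refl  = m∣m*n (n !)

  -- A prime in (n , 2n] divides (2n)! but not n! · n!, hence it divides the central binomial
  -- coefficient.
  primorial-double : ∀ n → primorial (n + n) ≤ binom n n * primorial n
  primorial-double n = ∣⇒≤ {{m*n≢0 _ _ {{binom>0 n n}} {{primorial≢0 n}}}} (primorial-∣ n n p∣binom)
    where
    p∣binom : ∀ {p} → Prime p → n < p → p ≤ n + n → p ∣ binom n n
    p∣binom {p} pp n<p p≤2n
      with euclidsLemma (binom n n) (n ! * n !) pp
             (subst (p ∣_) (sym (binom-! n n)) (≤⇒∣! (n + n) (≤-trans (s≤s z≤n) n<p) p≤2n))
    ... | inj₁ p∣b = p∣b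
    ... | inj₂ p∣n!n! with euclidsLemma (n !) (n !) pp p∣n!n!
    ...   | inj₁ p∣n! = contradiction (prime∣!⇒≤ n pp p∣n!) (<⇒≱ n<p)
    ...   | inj₂ p∣n! = contradiction (prime∣!⇒≤ n pp p∣n!) (<⇒≱ n<p)

  -- Chebyshev's bound 4^N for N = 2^i. Doubling reaches only powers of two, which is enough since
  -- t² is one.
  primorial[2^i]≤ : ∀ i → primorial (2 ^ i) ≤ 2 ^ (2 ^ suc i)
  primorial[2^i]≤ zero = s≤s z≤n
  primorial[2^i]≤ (suc i) = begin
    primorial (2 ^ suc i)             ≡⟨ cong primorial (2*m≡m+m (2 ^ i)) ⟩
    primorial (2 ^ i + 2 ^ i)         ≤⟨ primorial-double (2 ^ i) ⟩
    binom (2 ^ i) (2 ^ i) * primorial (2 ^ i)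
      ≤⟨ *-mono-≤ (binom≤2^ (2 ^ i) (2 ^ i)) (primorial[2^i]≤ i) ⟩
    2 ^ (2 ^ i + 2 ^ i) * 2 ^ (2 ^ suc i) ≡⟨ cong (λ u → 2 ^ u * 2 ^ (2 ^ suc i)) (sym (2*m≡m+m (2 ^ i))) ⟩
    2 ^ (2 ^ suc i) * 2 ^ (2 ^ suc i) ≡⟨ sym (^-distribˡ-+-* 2 (2 ^ suc i) (2 ^ suc i)) ⟩
    2 ^ (2 ^ suc i + 2 ^ suc i)       ≡⟨ cong (2 ^_) (sym (2*m≡m+m (2 ^ suc i))) ⟩
    2 ^ (2 ^ suc (suc i))             ∎
    where
    open ≤-Reasoning
    2*m≡m+m : ∀ m → 2 * m ≡ m + m
    2*m≡m+m m = cong (m +_) (+-identityʳ m)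

  -- A number below (S + 1)² has at most one prime factor above S, counted with multiplicity.
  split-product : ∀ S ps → All Prime ps → product ps < suc S * suc S →
    product ps ∣ (S !) ^ length ps ⊎
    (∃ λ q → ∃ λ r → Prime q × S < q × product ps ≡ q * r × r ∣ (S !) ^ length ps)
  split-product S [] [] _ = inj₁ ∣-refl
  split-product S (p ∷ ps) (pp ∷ pps) p*ps<
    with split-product S ps pps (≤-<-trans (m≤n*m (product ps) p {{prime⇒nonZero pp}}) p*ps<) | p ≤? S
  ... | inj₁ ps∣ | yes p≤S = inj₁ (*-pres-∣ (≤⇒∣! S (>-nonZero⁻¹ p {{prime⇒nonZero pp}}) p≤S) ps∣)
  ... | inj₁ ps∣ | no p≰S  = inj₂ (p , product ps , pp , ≰⇒> p≰S , refl , ∣n⇒∣m*n (S !) ps∣)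
  ... | inj₂ (q , r , pq , S<q , ps≡qr , r∣) | yes p≤S =
        inj₂ (q , p * r , pq , S<q , trans (cong (p *_) ps≡qr) (regroup p q r) ,
              *-pres-∣ (≤⇒∣! S (>-nonZero⁻¹ p {{prime⇒nonZero pp}}) p≤S) r∣)
    where
    regroup : ∀ p q r → p * (q * r) ≡ q * (p * r)
    regroup = solve-∀
  ... | inj₂ (q , r , pq , S<q , ps≡qr , r∣) | no p≰S =
        contradiction (<-≤-trans p*ps< (*-mono-≤ (≰⇒> p≰S) (≤-trans S<q q≤ps))) (n≮n _)
    where
    q≤ps : q ≤ product ps
    q≤ps = ∣⇒≤ {{productOfPrimes≢0 pps}} (divides r (trans ps≡qr (*-comm q r)))

  2^length≤product : ∀ {ps} → All Prime ps → 2 ^ length ps ≤ product ps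
  2^length≤product [] = ≤-refl
  2^length≤product {p ∷ ps} (pp ∷ pps) =
    *-mono-≤ (nonTrivial⇒n>1 p {{prime⇒nonTrivial pp}}) (2^length≤product pps)

  -- A number up to S² ≤ 2^e has at most e prime factors. Each one up to S is absorbed by a factor
  -- S!, and the only possible one above S by the primorial.
  common-multiple : ∀ S e → S * S ≤ 2 ^ e → ∀ i → i < S * S → suc i ∣ (S !) ^ e * primorial (S * S)
  common-multiple S e S²≤2^e i i<S² with factorise (suc i)
  ... | record { factors = ps ; isFactorisation = eq ; factorsPrime = pps } =
    subst (_∣ X) (sym eq) (helper (split-product S ps pps (≤-<-trans ps≤S² (*-mono-< (n<1+n S) (n<1+n S)))))
    where
    X = (S !) ^ e * primorial (S * S)
    ps≤S² : product ps ≤ S * S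
    ps≤S² = subst (_≤ S * S) eq i<S²
    length≤e : length ps ≤ e
    length≤e with length ps ≤? e
    ... | yes l≤e = l≤e
    ... | no  l≰e = contradiction
          (≤-trans (2^length≤product pps) (≤-trans ps≤S² S²≤2^e))
          (<⇒≱ (^-monoʳ-< 2 (s≤s (s≤s z≤n)) (≰⇒> l≰e)))
    pow∣ : (S !) ^ length ps ∣ (S !) ^ e
    pow∣ = divides ((S !) ^ (e ∸ length ps)) (trans (cong ((S !) ^_) (sym (m∸n+n≡m length≤e)))
             (^-distribˡ-+-* (S !) (e ∸ length ps) (length ps)))
    helper : _ → product ps ∣ X
    helper (inj₁ ps∣) = ∣m⇒∣m*n _ (∣-trans ps∣ pow∣)
    helper (inj₂ (q , r , pq , S<q , ps≡qr , r∣)) =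
      subst (_∣ X) (trans (*-comm r q) (sym ps≡qr))
        (*-pres-∣ (∣-trans r∣ pow∣) (prime∣primorial (S * S) pq (≤-trans q≤ps ps≤S²)))
      where
      q≤ps : q ≤ product ps
      q≤ps = ∣⇒≤ {{productOfPrimes≢0 pps}} (divides r (trans ps≡qr (*-comm q r)))

  -- This is how the absence of primes enters the estimate: the primorial at the upper end of the
  -- gap may be replaced by the one at the lower end.
  prime-or-primorial : ∀ a d → (∃ λ p → Prime p × a < p × p ≤ a + d) ⊎ primorial (a + d) ≡ primorial a
  prime-or-primorial a zero = inj₂ (cong primorial (+-identityʳ a))
  prime-or-primorial a (suc d) rewrite +-suc a d with prime? (suc (a + d))
  ... | yes pp = inj₁ (suc (a + d) , pp , s≤s (m≤m+n a d) , ≤-refl)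
  ... | no  _ with prime-or-primorial a d
  ...   | inj₁ (p , pp , a<p , p≤) = inj₁ (p , pp , a<p , m≤n⇒m≤1+n p≤)
  ...   | inj₂ eq = inj₂ eq

  n!≤n^n : ∀ n → n ! ≤ n ^ n
  n!≤n^n n = go n ≤-refl
    where
    go : ∀ m → m ≤ n → m ! ≤ n ^ m
    go zero    _   = ≤-refl
    go (suc m) m<n = *-mono-≤ m<n (go m (<⇒≤ m<n))

  -- Shifted by 10 to start the induction, at 576 < 1024. It makes the factorial part of the common
  -- multiple cost less than 2^(2t²).
  4[g+2]²<2^g : ∀ g → 4 * ((12 + g) * (12 + g)) < 2 ^ (10 + g)
  4[g+2]²<2^g zero    = m≤m+n 577 447
  4[g+2]²<2^g (suc g) = begin-strict
    4 * ((13 + g) * (13 + g))         ≤⟨ m≤m+n _ _ ⟩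
    4 * ((13 + g) * (13 + g)) + 4 * (119 + 22 * g + g * g) ≡⟨ regroup g ⟩
    2 * (4 * ((12 + g) * (12 + g)))   <⟨ *-monoʳ-< 2 (4[g+2]²<2^g g) ⟩
    2 * 2 ^ (10 + g)                  ∎
    where
    open ≤-Reasoning
    regroup : ∀ g → 4 * ((13 + g) * (13 + g)) + 4 * (119 + 22 * g + g * g) ≡ 2 * (4 * ((12 + g) * (12 + g)))
    regroup = solve-∀

  -- Were there no such prime, the common multiple X of 1 , … , (4t)² would be smaller than
  -- the central binomial coefficient which divides it.
  prime-in-gap : ∀ g → 10 ≤ g → ∃ λ p → Prime p × 2 ^ g * 2 ^ g < p × p ≤ 16 * (2 ^ g * 2 ^ g)
  prime-in-gap g 10≤g with prime-or-primorial (2 ^ g * 2 ^ g) (15 * (2 ^ g * 2 ^ g))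
  ... | inj₁ (p , pp , lo , hi) = p , pp , lo , hi
  ... | inj₂ primorial≡ = contradiction (begin-strict
      2 ^ (4 * (t * t))                       ≤⟨ 2^n≤binom (4 * (t * t)) ⟩
      binom (4 * (t * t)) (4 * (t * t))       ≤⟨ m≤n*m _ (suc (4 * (t * t) + 4 * (t * t))) ⟩
      leibniz (4 * (t * t)) (4 * (t * t))     ≤⟨ ∣⇒≤ {{X≢0}} (leibniz∣ (common-multiple S e S²≤2^e) (4 * (t * t)) (4 * (t * t)) inRange) ⟩
      (S !) ^ e * primorial (S * S)           ≡⟨ cong (λ u → (S !) ^ e * primorial u) S²≡ ⟩
      (S !) ^ e * primorial (16 * (t * t))    ≡⟨ cong ((S !) ^ e *_) primorial≡ ⟩
      (S !) ^ e * primorial (t * t)           ≤⟨ *-mono-≤ S!^e≤ primorial≤ ⟩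
      2 ^ (h * S * e) * 2 ^ (2 * (t * t))     ≡⟨ sym (^-distribˡ-+-* 2 (h * S * e) (2 * (t * t))) ⟩
      2 ^ (h * S * e + 2 * (t * t))           <⟨ ^-monoʳ-< 2 (s≤s (s≤s z≤n)) exponent< ⟩
      2 ^ (4 * (t * t))                       ∎) (n≮n _)
    where
    open ≤-Reasoning
    t = 2 ^ g
    h = 2 + g
    -- S = 4t, so that S² = 16 t² is the upper end of the gap and row 8 t² of the Leibniz triangle
    -- lies below it.
    S = 2 ^ h
    e = h + h
    instance
      t≢0 : NonZero t
      t≢0 = m^n≢0 2 g
    X≢0 : NonZero ((S !) ^ e * primorial (S * S))
    X≢0 = m*n≢0 _ _ {{m^n≢0 (S !) e {{S !≢0}}}} {{primorial≢0 (S * S)}}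
    S≡ : S ≡ 4 * t
    S≡ = sym (*-assoc 2 2 t)
    S²≡ : S * S ≡ 16 * (t * t)
    S²≡ = trans (cong₂ _*_ S≡ S≡) (regroup t)
      where
      regroup : ∀ t → 4 * t * (4 * t) ≡ 16 * (t * t)
      regroup = solve-∀
    S²≤2^e : S * S ≤ 2 ^ e
    S²≤2^e = ≤-reflexive (sym (^-distribˡ-+-* 2 h h))
    inRange : 4 * (t * t) + 4 * (t * t) < S * S
    inRange = begin-strict
      4 * (t * t) + 4 * (t * t)   ≡⟨ sym (*-distribʳ-+ (t * t) 4 4) ⟩
      8 * (t * t)                 <⟨ *-monoˡ-< (t * t) {{m*n≢0 t t}} (m≤m+n 9 7) ⟩
      16 * (t * t)                ≡⟨ sym S²≡ ⟩
      S * S                       ∎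
    S!^e≤ : (S !) ^ e ≤ 2 ^ (h * S * e)
    S!^e≤ = begin
      (S !) ^ e                   ≤⟨ ^-monoˡ-≤ e (n!≤n^n S) ⟩
      (S ^ S) ^ e                 ≡⟨ cong (_^ e) (^-*-assoc 2 h S) ⟩
      (2 ^ (h * S)) ^ e           ≡⟨ ^-*-assoc 2 (h * S) e ⟩
      2 ^ (h * S * e)             ∎
    primorial≤ : primorial (t * t) ≤ 2 ^ (2 * (t * t))
    primorial≤ = subst (λ u → primorial u ≤ 2 ^ (2 * u)) (^-distribˡ-+-* 2 g g) (primorial[2^i]≤ (g + g))
    4h²<t : 4 * (h * h) < t
    4h²<t = subst (λ u → 4 * ((2 + u) * (2 + u)) < 2 ^ u) (m+[n∸m]≡n 10≤g) (4[g+2]²<2^g (g ∸ 10))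
    exponent< : h * S * e + 2 * (t * t) < 4 * (t * t)
    exponent< = begin-strict
      h * S * e + 2 * (t * t)               ≡⟨ cong (λ u → h * u * e + 2 * (t * t)) S≡ ⟩
      h * (4 * t) * (h + h) + 2 * (t * t)   ≡⟨ regroup h t ⟩
      2 * t * (4 * (h * h)) + 2 * (t * t)   <⟨ +-monoˡ-< (2 * (t * t)) (*-monoʳ-< (2 * t) {{m*n≢0 2 t}} 4h²<t) ⟩
      2 * t * t + 2 * (t * t)               ≡⟨ regroup′ t ⟩
      4 * (t * t)                           ∎
      where
      regroup : ∀ h t → h * (4 * t) * (h + h) + 2 * (t * t) ≡ 2 * t * (4 * (h * h)) + 2 * (t * t)
      regroup = solve-∀
      regroup′ : ∀ t → 2 * t * t + 2 * (t * t) ≡ 4 * (t * t)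
      regroup′ = solve-∀

-- Powers of products.

module Powers where

  open import Data.Nat
  open import Data.Nat.Tactic.RingSolver using (solve-∀)
  open import Relation.Binary.PropositionalEquality

  [m*n]^k≡m^k*n^k : ∀ m n k → (m * n) ^ k ≡ m ^ k * n ^ k
  [m*n]^k≡m^k*n^k m n zero    = refl
  [m*n]^k≡m^k*n^k m n (suc k) = trans (cong (m * n *_) ([m*n]^k≡m^k*n^k m n k)) (regroup m n (m ^ k) (n ^ k))
    where
    regroup : ∀ m n x y → m * n * (x * y) ≡ m * x * (n * y)
    regroup = solve-∀

-- Union bounds and pigeonhole counting for lists.

module ListCounting where

  open import Data.Nat
  open import Data.Nat.Properties
  open import Data.List using (List; []; _∷_; _++_; length; filter)
  open import Data.List.Properties using (length-++)
  open import Data.List.Membership.Propositional using (_∈_)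
  open import Data.List.Membership.Propositional.Properties using (∈-∃++; ∈-++⁻; ∈-++⁺ˡ; ∈-++⁺ʳ; ∈-filter⁻)
  open import Data.List.Relation.Unary.All as All using ([]; _∷_)
  open import Data.List.Relation.Unary.Any using (Any; here; there)
  open import Data.List.Relation.Unary.AllPairs using ([]; _∷_)
  open import Data.List.Relation.Unary.Unique.Propositional using (Unique)
  open import Data.List.Relation.Binary.Sublist.Propositional.Properties using (filter-⊆; filter⁺; length-mono-≤)
  open import Data.Product using (_,_)
  open import Data.Sum using (inj₁; inj₂)
  open import Relation.Nullary using (yes; no; ¬?; contradiction)
  open import Relation.Unary using (Decidable)
  open import Relation.Binary.PropositionalEquality

  length-filter+filter-¬ : ∀ {A : Set} {P : A → Set} (P? : Decidable P) xs →
    length xs ≡ length (filter P? xs) + length (filter (λ x → ¬? (P? x)) xs)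
  length-filter+filter-¬ P? [] = refl
  length-filter+filter-¬ P? (x ∷ xs) with P? x
  ... | yes _ = cong suc (length-filter+filter-¬ P? xs)
  ... | no  _ = trans (cong suc (length-filter+filter-¬ P? xs)) (sym (+-suc _ _))

  -- The elements related to the first v are removed before the other values are treated, so the
  -- classes may overlap.
  length-cover : ∀ {A B : Set} {R : B → A → Set} (R? : ∀ v → Decidable (R v)) b vs xs →
    (∀ {x} → x ∈ xs → Any (λ v → R v x) vs) →
    (∀ {v} → v ∈ vs → length (filter (R? v) xs) ≤ b) →
    length xs ≤ length vs * b
  length-cover R? b []       []       _      _     = z≤n
  length-cover R? b []       (x ∷ xs) covers _     with () ← covers (here refl)
  length-cover R? b (v ∷ vs) xs       covers small = begin
    length xs                                ≡⟨ length-filter+filter-¬ (R? v) xs ⟩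
    length (filter (R? v) xs) + length rest  ≤⟨ +-mono-≤ (small (here refl)) (length-cover R? b vs rest covers′ small′) ⟩
    b + length vs * b                        ∎
    where
    open ≤-Reasoning
    rest = filter (λ x → ¬? (R? v x)) xs
    covers′ : ∀ {x} → x ∈ rest → Any (λ w → _) vs
    covers′ x∈rest with ∈-filter⁻ (λ x → ¬? (R? v x)) x∈rest
    ... | x∈xs , ¬Rvx with covers x∈xs
    ...   | here Rvx = contradiction Rvx ¬Rvx
    ...   | there any = any
    small′ : ∀ {w} → w ∈ vs → length (filter (R? w) rest) ≤ b
    small′ {w} w∈vs = ≤-trans
      (length-mono-≤ (filter⁺ (R? w) (R? w) (λ { refl r → r }) (filter-⊆ (λ x → ¬? (R? v x)) xs)))
      (small (there w∈vs))

  unique-⊆⇒length≤ : ∀ {A : Set} {xs ys : List A} → Unique xs → (∀ {x} → x ∈ xs → x ∈ ys) → length xs ≤ length ys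
  unique-⊆⇒length≤ [] _ = z≤n
  unique-⊆⇒length≤ {xs = x ∷ xs} (x∉xs ∷ uniq) xs⊆ys with ∈-∃++ (xs⊆ys (here refl))
  ... | as , bs , refl = begin
      suc (length xs)               ≤⟨ s≤s (unique-⊆⇒length≤ uniq xs⊆as++bs) ⟩
      suc (length (as ++ bs))       ≡⟨ cong suc (length-++ as) ⟩
      suc (length as + length bs)   ≡⟨ sym (+-suc (length as) (length bs)) ⟩
      length as + suc (length bs)   ≡⟨ sym (length-++ as) ⟩
      length (as ++ x ∷ bs)         ∎
    where
    open ≤-Reasoning
    xs⊆as++bs : ∀ {y} → y ∈ xs → y ∈ as ++ bs
    xs⊆as++bs y∈xs with ∈-++⁻ as (xs⊆ys (there y∈xs))
    ... | inj₁ y∈as           = ∈-++⁺ˡ y∈as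
    ... | inj₂ (there y∈bs)   = ∈-++⁺ʳ as y∈bs
    ... | inj₂ (here refl)    = contradiction refl (All.lookup x∉xs y∈xs)

-- Enumerating the elements and the subsets of a finite set.

module SubsetLists where

  open import Data.Nat
  open import Data.Nat.Properties using (+-identityʳ)
  open import Data.Fin using (Fin; zero; suc)
  open import Data.Fin.Properties using (suc-injective)
  open import Data.Fin.Subset
  open import Data.Fin.Subset.Properties
  open import Data.Bool using (true; false)
  open import Data.List using (List; []; _∷_; _++_; length; map)
  open import Data.List.Properties using (length-++; length-map)
  open import Data.List.Membership.Propositional using () renaming (_∈_ to _∈ₗ_)
  open import Data.List.Membership.Propositional.Properties using (∈-++⁻; ∈-++⁺ˡ; ∈-++⁺ʳ; ∈-map⁺; ∈-map⁻)
  open import Data.List.Relation.Unary.All as All using ([])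
  import Data.List.Relation.Unary.All.Properties as All
  open import Data.List.Relation.Unary.Any using (here; there)
  open import Data.List.Relation.Unary.AllPairs using ([]; _∷_)
  open import Data.List.Relation.Unary.Unique.Propositional using (Unique)
  open import Data.List.Relation.Unary.Unique.Propositional.Properties using (map⁺)
  open import Data.Vec using ([]; _∷_; here; there)
  open import Data.Product using (_,_)
  open import Data.Sum using (inj₁; inj₂)
  open import Relation.Nullary using (contradiction)
  open import Relation.Binary.PropositionalEquality

  elements : ∀ {n} → Subset n → List (Fin n)
  elements []          = []
  elements (true ∷ p)  = zero ∷ map suc (elements p)
  elements (false ∷ p) = map suc (elements p)

  length-elements : ∀ {n} (p : Subset n) → length (elements p) ≡ ∣ p ∣
  length-elements []          = refl
  length-elements (true ∷ p)  = cong suc (trans (length-map suc (elements p)) (length-elements p))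
  length-elements (false ∷ p) = trans (length-map suc (elements p)) (length-elements p)

  ∈-elements⁺ : ∀ {n} {p : Subset n} {i} → i ∈ p → i ∈ₗ elements p
  ∈-elements⁺ {p = true ∷ p}  here        = here refl
  ∈-elements⁺ {p = true ∷ p}  (there i∈p) = there (∈-map⁺ suc (∈-elements⁺ i∈p))
  ∈-elements⁺ {p = false ∷ p} (there i∈p) = ∈-map⁺ suc (∈-elements⁺ i∈p)

  ∈-elements⁻ : ∀ {n} (p : Subset n) {i} → i ∈ₗ elements p → i ∈ p
  ∈-elements⁻ (true ∷ p) (here refl) = here
  ∈-elements⁻ (true ∷ p) (there i∈) with ∈-map⁻ suc i∈
  ... | _ , j∈ , refl = there (∈-elements⁻ p j∈)
  ∈-elements⁻ (false ∷ p) i∈ with ∈-map⁻ suc i∈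
  ... | _ , j∈ , refl = there (∈-elements⁻ p j∈)

  elements-unique : ∀ {n} (p : Subset n) → Unique (elements p)
  elements-unique []          = []
  elements-unique (true ∷ p)  = All.map⁺ (All.tabulate λ _ ()) ∷ map⁺ suc-injective (elements-unique p)
  elements-unique (false ∷ p) = map⁺ suc-injective (elements-unique p)

  subsets : ∀ {n} → Subset n → List (Subset n)
  subsets []          = [] ∷ []
  subsets (true ∷ p)  = map (true ∷_) (subsets p) ++ map (false ∷_) (subsets p)
  subsets (false ∷ p) = map (false ∷_) (subsets p)

  length-subsets : ∀ {n} (p : Subset n) → length (subsets p) ≡ 2 ^ ∣ p ∣
  length-subsets []          = refl
  length-subsets (true ∷ p)  = trans (length-++ (map (true ∷_) (subsets p)))
    (cong₂ _+_ (trans (length-map _ (subsets p)) (length-subsets p))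
               (trans (length-map _ (subsets p)) (trans (length-subsets p) (sym (+-identityʳ _)))))
  length-subsets (false ∷ p) = trans (length-map _ (subsets p)) (length-subsets p)

  ∈-subsets⁺ : ∀ {n} {p q : Subset n} → q ⊆ p → q ∈ₗ subsets p
  ∈-subsets⁺ {p = []}        {[]}        _   = here refl
  ∈-subsets⁺ {p = true ∷ p}  {true ∷ q}  q⊆p = ∈-++⁺ˡ (∈-map⁺ _ (∈-subsets⁺ (drop-∷-⊆ q⊆p)))
  ∈-subsets⁺ {p = true ∷ p}  {false ∷ q} q⊆p = ∈-++⁺ʳ _ (∈-map⁺ _ (∈-subsets⁺ (drop-∷-⊆ q⊆p)))
  ∈-subsets⁺ {p = false ∷ p} {true ∷ q}  q⊆p with () ← q⊆p here
  ∈-subsets⁺ {p = false ∷ p} {false ∷ q} q⊆p = ∈-map⁺ _ (∈-subsets⁺ (drop-∷-⊆ q⊆p))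

  ∈-subsets⁻ : ∀ {n} (p : Subset n) {q} → q ∈ₗ subsets p → q ⊆ p
  ∈-subsets⁻ [] (here refl) ()
  ∈-subsets⁻ (true ∷ p) q∈ with ∈-++⁻ (map (true ∷_) (subsets p)) q∈
  ... | inj₁ q∈₁ with ∈-map⁻ _ q∈₁
  ...   | _ , r∈ , refl = s⊆s (∈-subsets⁻ p r∈)
  ∈-subsets⁻ (true ∷ p) q∈ | inj₂ q∈₂ with ∈-map⁻ _ q∈₂
  ...   | _ , r∈ , refl = out⊆ (∈-subsets⁻ p r∈)
  ∈-subsets⁻ (false ∷ p) q∈ with ∈-map⁻ _ q∈
  ... | _ , r∈ , refl = s⊆s (∈-subsets⁻ p r∈)

  ∣p∪⁅x⁆∣ : ∀ {n} (p : Subset n) x → x ∉ p → ∣ p ∪ ⁅ x ⁆ ∣ ≡ suc ∣ p ∣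
  ∣p∪⁅x⁆∣ (true ∷ p)  zero    x∉p = contradiction here x∉p
  ∣p∪⁅x⁆∣ (false ∷ p) zero    x∉p = cong (λ q → suc ∣ q ∣) (∪-identityʳ p)
  ∣p∪⁅x⁆∣ (true ∷ p)  (suc x) x∉p = cong suc (∣p∪⁅x⁆∣ p x (drop-not-there x∉p))
  ∣p∪⁅x⁆∣ (false ∷ p) (suc x) x∉p = ∣p∪⁅x⁆∣ p x (drop-not-there x∉p)

-- Set families: an independent k-set or a union of size k.

module ForbiddenUnion where

  open import Data.Nat
  open import Data.Nat.Properties
  open import Data.Fin using (Fin)
  open import Data.Fin.Subset
  open import Data.Fin.Subset.Properties
  open import Data.Empty using (⊥-elim)
  open import Data.Bool.Properties using () renaming (_≟_ to _≟ᵇ_)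
  open import Data.Vec.Properties using (≡-dec)
  open import Data.List using (List; []; _∷_; length; map; filter; take; foldr)
  open import Data.List.Properties using (length-map; length-take)
  open import Data.List.Membership.Propositional using (find; lose) renaming (_∈_ to _∈ₗ_)
  open import Data.List.Membership.Propositional.Properties using (∈-filter⁻)
  open import Data.List.Relation.Unary.All as All using (All; []; _∷_; all?)
  open import Data.List.Relation.Unary.All.Properties using (¬All⇒Any¬; map⁺; ¬Any⇒All¬)
  open import Data.List.Relation.Unary.Any using (Any; here; there; any?)
  open import Data.List.Relation.Unary.AllPairs using ([]; _∷_)
  open import Data.List.Relation.Unary.Unique.Propositional using (Unique)
  open import Data.List.Relation.Unary.Unique.Propositional.Properties using (filter⁺; take⁺)
  open import Data.List.Relation.Binary.Sublist.Propositional using (lookup)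
  open import Data.List.Relation.Binary.Sublist.Setoid.Properties using (take-⊆)
  open import Data.Product using (∃; _×_; _,_; proj₁; proj₂)
  open import Data.Sum using (_⊎_; inj₁; inj₂; [_,_]′)
  open import Relation.Nullary using (¬_; Dec; yes; no; contradiction; ¬?; _×-dec_)
  open import Relation.Nullary.Decidable using (decidable-stable)
  open import Relation.Binary.PropositionalEquality
  open ListCounting
  open SubsetLists

  module _ {n : ℕ} (T : List (Subset n)) where

    _∈T? : ∀ D → Dec (D ∈ₗ T)
    D ∈T? = any? (≡-dec _≟ᵇ_ D) T

    Independent : Subset n → Set
    Independent K = All (λ D → ¬ (Nonempty D × D ⊆ K)) T

    independent? : ∀ K → Dec (Independent K)
    independent? K = all? (λ D → ¬? (nonempty? D ×-dec (D ⊆? K))) T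

    dependent : ∀ {K} → ¬ Independent K → ∃ λ D → D ∈ₗ T × Nonempty D × D ⊆ K
    dependent {K} ¬ind with find (¬All⇒Any¬ (λ D → ¬? (nonempty? D ×-dec (D ⊆? K))) T ¬ind)
    ... | D , D∈T , ¬¬p with decidable-stable (nonempty? D ×-dec (D ⊆? K)) ¬¬p
    ...   | ne , D⊆K = D , D∈T , ne , D⊆K

    -- The bound on the number of members becomes the number of parts into which a code is split
    -- later.
    UnionOfSize : ℕ → Set
    UnionOfSize k = ∃ λ Ds → All (_∈ₗ T) Ds × length Ds ≤ k × ∣ ⋃ Ds ∣ ≡ k

    adjoin : Subset n → List (Fin n) → Subset n
    adjoin I = foldr (λ y W → W ∪ ⁅ y ⁆) I

    adjoin-⊇ : ∀ I ys → I ⊆ adjoin I ys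
    adjoin-⊇ I []       i∈ = i∈
    adjoin-⊇ I (y ∷ ys) i∈ = p⊆p∪q ⁅ y ⁆ (adjoin-⊇ I ys i∈)

    adjoin-∈⁻ : ∀ I ys {i} → i ∈ adjoin I ys → i ∈ I ⊎ i ∈ₗ ys
    adjoin-∈⁻ I []       i∈ = inj₁ i∈
    adjoin-∈⁻ I (y ∷ ys) i∈ with x∈p∪q⁻ (adjoin I ys) ⁅ y ⁆ i∈
    ... | inj₂ i∈y = inj₂ (here (x∈⁅y⁆⇒x≡y y i∈y))
    ... | inj₁ i∈W with adjoin-∈⁻ I ys i∈W
    ...   | inj₁ i∈I  = inj₁ i∈I
    ...   | inj₂ i∈ys = inj₂ (there i∈ys)

    ∣adjoin∣ : ∀ I ys → Unique ys → All (_∉ I) ys → ∣ adjoin I ys ∣ ≡ length ys + ∣ I ∣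
    ∣adjoin∣ I []       _             _             = refl
    ∣adjoin∣ I (y ∷ ys) (y∉ys ∷ uniq) (y∉I ∷ ys∉I) =
      trans (∣p∪⁅x⁆∣ (adjoin I ys) y y∉W) (cong suc (∣adjoin∣ I ys uniq ys∉I))
      where
      y∉W : y ∉ adjoin I ys
      y∉W y∈W with adjoin-∈⁻ I ys y∈W
      ... | inj₁ y∈I  = y∉I y∈I
      ... | inj₂ y∈ys = All.lookup y∉ys y∈ys refl

    -- The list must be nonempty: the union of no sets would lose I.
    ⋃-adjoin : ∀ I y ys → ⋃ (map (λ z → I ∪ ⁅ z ⁆) (y ∷ ys)) ≡ adjoin I (y ∷ ys)
    ⋃-adjoin I y ys = ⊆-antisym (⊆₁ (y ∷ ys)) (⊆₂ y ys)
      where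
      ⊆₁ : ∀ zs → ⋃ (map (λ z → I ∪ ⁅ z ⁆) zs) ⊆ adjoin I zs
      ⊆₁ [] i∈ = contradiction i∈ ∉⊥
      ⊆₁ (z ∷ zs) i∈ with x∈p∪q⁻ (I ∪ ⁅ z ⁆) _ i∈
      ... | inj₂ i∈⋃ = p⊆p∪q ⁅ z ⁆ (⊆₁ zs i∈⋃)
      ... | inj₁ i∈Iz with x∈p∪q⁻ I ⁅ z ⁆ i∈Iz
      ...   | inj₁ i∈I = adjoin-⊇ I (z ∷ zs) i∈I
      ...   | inj₂ i∈z = q⊆p∪q (adjoin I zs) ⁅ z ⁆ i∈z
      ⊆₂ : ∀ z zs → adjoin I (z ∷ zs) ⊆ ⋃ (map (λ z → I ∪ ⁅ z ⁆) (z ∷ zs))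
      ⊆₂ z [] i∈ = p⊆p∪q ⊥ i∈
      ⊆₂ z (w ∷ zs) i∈ with x∈p∪q⁻ (adjoin I (w ∷ zs)) ⁅ z ⁆ i∈
      ... | inj₁ i∈W = q⊆p∪q (I ∪ ⁅ z ⁆) _ (⊆₂ w zs i∈W)
      ... | inj₂ i∈z = p⊆p∪q {p = I ∪ ⁅ z ⁆} _ (q⊆p∪q I ⁅ z ⁆ i∈z)

    -- The sets I ∪ {y} overlap only in I, so each adds one element, and `k ∸ ∣ I ∣` of them have a
    -- union of size exactly k. This number is positive, so the union does contain I.
    common-stem⇒union : ∀ {k I ys} → ∣ I ∣ < k → k ≤ length ys → Unique ys → All (_∉ I) ys →
                        All (λ y → I ∪ ⁅ y ⁆ ∈ₗ T) ys → UnionOfSize k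
    common-stem⇒union {k} {I} {ys} I<k k≤ys uniq ys∉I ys∈T =
      map (λ y → I ∪ ⁅ y ⁆) zs ,
      map⁺ (All.tabulate λ z∈ → All.lookup ys∈T (lookup (take-⊆ (setoid _) j ys) z∈)) ,
      ≤-trans (≤-reflexive (trans (length-map _ zs) length-zs)) (m∸n≤m k ∣ I ∣) ,
      (begin
        ∣ ⋃ (map (λ y → I ∪ ⁅ y ⁆) zs) ∣ ≡⟨ cong ∣_∣ (⋃≡ zs (subst (0 <_) (sym length-zs) (m<n⇒0<n∸m I<k))) ⟩
        ∣ adjoin I zs ∣                  ≡⟨ ∣adjoin∣ I zs (take⁺ j uniq) (All.tabulate λ z∈ → All.lookup ys∉I (lookup (take-⊆ (setoid _) j ys) z∈)) ⟩
        length zs + ∣ I ∣                ≡⟨ cong (_+ ∣ I ∣) length-zs ⟩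
        k ∸ ∣ I ∣ + ∣ I ∣                ≡⟨ m∸n+n≡m (<⇒≤ I<k) ⟩
        k                                ∎)
      where
      open ≡-Reasoning
      j  = k ∸ ∣ I ∣
      zs = take j ys
      length-zs : length zs ≡ k ∸ ∣ I ∣
      length-zs = trans (length-take j ys) (m≤n⇒m⊓n≡m (≤-trans (m∸n≤m k ∣ I ∣) k≤ys))
      ⋃≡ : ∀ ws → 0 < length ws → ⋃ (map (λ y → I ∪ ⁅ y ⁆) ws) ≡ adjoin I ws
      ⋃≡ (w ∷ ws) _ = ⋃-adjoin I w ws

    -- If D missed y it would lie inside I, against the independence of I.
    new-element : ∀ {I y D} → Independent I → D ∈ₗ T → Nonempty D → D ⊆ I ∪ ⁅ y ⁆ → y ∈ D
    new-element {I} {y} {D} ind D∈T ne D⊆Iy with y ∈? D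
    ... | yes y∈D = y∈D
    ... | no  y∉D = ⊥-elim (All.lookup ind D∈T (ne , D⊆I))
      where
      D⊆I : D ⊆ I
      D⊆I i∈D with x∈p∪q⁻ I ⁅ y ⁆ (D⊆Iy i∈D)
      ... | inj₁ i∈I = i∈I
      ... | inj₂ i∈y = contradiction (subst (_∈ D) (x∈⁅y⁆⇒x≡y y i∈y) i∈D) y∉D

    -- Build an independent set greedily.  When it cannot be enlarged, every outside y forms a
    -- member S ∪ {y} of T with some S ⊆ I, and a popular S has enough extensions y.
    independent-or-union : ∀ k → k + 2 ^ k * k < n →
                           (∃ λ K → ∣ K ∣ ≡ k × Independent K) ⊎ UnionOfSize k
    independent-or-union k large = grow k ⊥ (trans (cong (k +_) (∣⊥∣≡0 n)) (+-identityʳ k))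
      (All.tabulate λ { _ ((i , i∈D) , D⊆⊥) → ∉⊥ (D⊆⊥ i∈D) })
      where
      grow : ∀ m I → m + ∣ I ∣ ≡ k → Independent I → (∃ λ K → ∣ K ∣ ≡ k × Independent K) ⊎ UnionOfSize k
      grow zero    I size ind = inj₁ (I , size , ind)
      grow (suc m) I size ind with any? (λ y → independent? (I ∪ ⁅ y ⁆)) (elements (∁ I))
      ... | yes some with find some
      ...   | y , y∈ , ind′ = grow m (I ∪ ⁅ y ⁆)
              (trans (cong (m +_) (∣p∪⁅x⁆∣ I y (x∈∁p⇒x∉p (∈-elements⁻ (∁ I) y∈)))) (trans (+-suc m ∣ I ∣) size)) ind′
      grow (suc m) I size ind | no none
        with any? (λ S → k ≤? length (filter (λ y → (S ∪ ⁅ y ⁆) ∈T?) (elements (∁ I)))) (subsets I)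
      ... | yes popular with find popular
      ...   | S , S∈ , k≤ = inj₂ (common-stem⇒union (≤-<-trans (p⊆q⇒∣p∣≤∣q∣ S⊆I) I<k) k≤ (filter⁺ (λ y → (S ∪ ⁅ y ⁆) ∈T?) (elements-unique (∁ I)))
                (All.tabulate λ y∈ y∈S → x∈∁p⇒x∉p (∈-elements⁻ (∁ I) (proj₁ (∈-filter⁻ (λ y → (S ∪ ⁅ y ⁆) ∈T?) y∈))) (S⊆I y∈S))
                (All.tabulate λ y∈ → proj₂ (∈-filter⁻ (λ y → (S ∪ ⁅ y ⁆) ∈T?) {xs = elements (∁ I)} y∈)))
        where
        S⊆I : S ⊆ I
        S⊆I = ∈-subsets⁻ I S∈
        I<k : ∣ I ∣ < k
        I<k = subst (∣ I ∣ <_) size (s≤s (m≤n+m ∣ I ∣ m))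
      -- At most k elements lie in I, and each of the at most 2^k stems S accounts for at most k
      -- elements outside, too few to exhaust the ground set.
      grow (suc m) I size ind | no none | no unpopular = contradiction (begin-strict
          n                             ≤⟨ m≤n+m∸n n ∣ I ∣ ⟩
          ∣ I ∣ + (n ∸ ∣ I ∣)           ≡⟨ cong (∣ I ∣ +_) (sym (trans (length-elements (∁ I)) (∣∁p∣≡n∸∣p∣ I))) ⟩
          ∣ I ∣ + length (elements (∁ I)) ≤⟨ +-mono-≤ I≤k (length-cover (λ S y → (S ∪ ⁅ y ⁆) ∈T?) k (subsets I) (elements (∁ I)) covers small) ⟩
          k + length (subsets I) * k    ≤⟨ +-monoʳ-≤ k (*-monoˡ-≤ k (≤-trans (≤-reflexive (length-subsets I)) (^-monoʳ-≤ 2 I≤k))) ⟩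
          k + 2 ^ k * k                 <⟨ large ⟩
          n                             ∎) (n≮n n)
        where
        open ≤-Reasoning
        I≤k : ∣ I ∣ ≤ k
        I≤k = subst (∣ I ∣ ≤_) size (m≤n+m ∣ I ∣ (suc m))
        small : ∀ {S} → S ∈ₗ subsets I → length (filter (λ y → (S ∪ ⁅ y ⁆) ∈T?) (elements (∁ I))) ≤ k
        small S∈ = <⇒≤ (≰⇒> (All.lookup (¬Any⇒All¬ _ unpopular) S∈))
        covers : ∀ {y} → y ∈ₗ elements (∁ I) → Any (λ S → S ∪ ⁅ y ⁆ ∈ₗ T) (subsets I)
        covers {y} y∈ with dependent (All.lookup (¬Any⇒All¬ _ none) y∈)
        -- The stem belonging to y is the trace `D ∩ I`: as y ∈ D, the set D is this trace together
        -- with y.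
        ... | D , D∈T , ne , D⊆Iy = lose (∈-subsets⁺ {p = I} (p∩q⊆q D I)) (subst (_∈ₗ T) D≡ D∈T)
          where
          y∈D : y ∈ D
          y∈D = new-element ind D∈T ne D⊆Iy
          D≡ : D ≡ (D ∩ I) ∪ ⁅ y ⁆
          D≡ = ⊆-antisym
            (λ i∈D → x∈p∪q⁺ ([ (λ i∈I → inj₁ (x∈p∩q⁺ (i∈D , i∈I))) , inj₂ ]′ (x∈p∪q⁻ I ⁅ y ⁆ (D⊆Iy i∈D))))
            (λ i∈ → [ (λ i∈DI → p∩q⊆p D I i∈DI) , (λ i∈y → subst (_∈ D) (sym (x∈⁅y⁆⇒x≡y y i∈y)) y∈D) ]′ (x∈p∪q⁻ (D ∩ I) ⁅ y ⁆ i∈))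

-- Sets of words without two at Hamming distance k.

module ForbiddenDistance where

  open import Data.Nat hiding (_≟_)
  open import Data.Nat.Properties hiding (_≟_)
  open import Data.Bool using (not)
  open import Data.Bool.Properties using () renaming (_≟_ to _≟ᵇ_)
  open import Data.Empty using (⊥-elim)
  open import Data.Fin using (Fin; _≟_)
  open import Data.Fin.Properties using () renaming (any? to anyFin?)
  open import Data.Fin.Subset
  open import Data.Fin.Subset.Properties
  open import Data.Vec using (Vec; lookup; zipWith)
  open import Data.Vec.Properties using (≡-dec; lookup-zipWith; []=⇒lookup; lookup⇒[]=)
  open import Data.Vec.Relation.Binary.Pointwise.Extensional using (ext; Pointwise-≡⇒≡)
  open import Data.List using (List; []; _∷_; length; filter; cartesianProduct; allFin)
  open import Data.List.Properties using (length-tabulate; filter-none; filter-notAll)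
  open import Data.List.Membership.Propositional using (find; lose) renaming (_∈_ to _∈ₗ_; _∉_ to _∉ₗ_)
  open import Data.List.Membership.Propositional.Properties using (∈-filter⁻; ∈-filter⁺; ∈-allFin; ∈-cartesianProduct⁺)
  open import Data.List.Relation.Unary.All as All using (All; []; _∷_; all?)
  open import Data.List.Relation.Unary.All.Properties using (¬All⇒Any¬; ¬Any⇒All¬)
  open import Data.List.Relation.Unary.Any as Any using (Any; here; there; any?)
  open import Data.List.Relation.Unary.AllPairs using ([]; _∷_)
  open import Data.List.Relation.Unary.Unique.Propositional using (Unique)
  open import Data.List.Relation.Unary.Unique.Propositional.Properties using (filter⁺)
  open import Data.Product using (∃; _×_; _,_; proj₁; proj₂)
  open import Data.Sum using (inj₁; inj₂; [_,_]′)
  open import Relation.Nullary using (¬_; Dec; does; yes; no; contradiction; ¬?; _×-dec_; _→-dec_)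
  open import Relation.Nullary.Decidable using (decidable-stable; dec-true; dec-false)
  open import Relation.Binary.PropositionalEquality
  open ListCounting
  open SubsetLists
  open ForbiddenUnion

  Word : ℕ → ℕ → Set
  Word s ℓ = Vec (Fin s) ℓ

  diff : ∀ {s ℓ} → Word s ℓ → Word s ℓ → Subset ℓ
  diff = zipWith (λ a b → not (does (a ≟ b)))

  module _ {s ℓ : ℕ} where

    ∈-diff⁺ : ∀ (x y : Word s ℓ) {i} → lookup x i ≢ lookup y i → i ∈ diff x y
    ∈-diff⁺ x y {i} x≢y = lookup⇒[]= i (diff x y)
      (trans (lookup-zipWith _ i x y) (cong not (dec-false (lookup x i ≟ lookup y i) x≢y)))

    ∈-diff⁻ : ∀ (x y : Word s ℓ) {i} → i ∈ diff x y → lookup x i ≢ lookup y i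
    ∈-diff⁻ x y {i} i∈ x≡y
      with () ← trans (sym ([]=⇒lookup i∈)) (trans (lookup-zipWith _ i x y) (cong not (dec-true (lookup x i ≟ lookup y i) x≡y)))

    ∉-diff⁻ : ∀ (x y : Word s ℓ) {i} → i ∉ diff x y → lookup x i ≡ lookup y i
    ∉-diff⁻ x y {i} i∉ = decidable-stable (lookup x i ≟ lookup y i) (λ x≢y → i∉ (∈-diff⁺ x y x≢y))

    Empty-diff⇒≡ : ∀ (x y : Word s ℓ) → Empty (diff x y) → x ≡ y
    Empty-diff⇒≡ x y empty = Pointwise-≡⇒≡ (ext λ i → ∉-diff⁻ x y (λ i∈ → empty (i , i∈)))

    diff-refl : ∀ (x : Word s ℓ) → diff x x ≡ ⊥
    diff-refl x = Empty-unique λ { (i , i∈) → ∈-diff⁻ x x i∈ refl }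

    diff-sym-⊆ : ∀ (x y : Word s ℓ) → diff x y ⊆ diff y x
    diff-sym-⊆ x y i∈ = ∈-diff⁺ y x (λ y≡x → ∈-diff⁻ x y i∈ (sym y≡x))

  -- One word, and for each difference set and each coordinate a fibre with one free coordinate
  -- fewer.
  fibreBound : ℕ → ℕ → ℕ
  fibreBound ℓ zero    = 1
  fibreBound ℓ (suc j) = suc (length (cartesianProduct (subsets (⊤ {ℓ})) (allFin ℓ)) * fibreBound ℓ j)

  module _ {s ℓ : ℕ} (L : List (Word s ℓ)) where

    -- If D is not dead at x, then for every z ∈ L there is y ∈ A with diff x y ≡ D that differs from z
    -- throughout D; for z the start of a walk, the step from x to y enlarges diff z x to diff z x ∪ D.
    DeadAt : List (Word s ℓ) → Subset ℓ → Word s ℓ → Set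
    DeadAt A D x = Any (λ z → All (λ y → diff x y ≡ D → ∃ λ i → i ∈ D × lookup y i ≡ lookup z i) A) L

    deadAt? : ∀ A D x → Dec (DeadAt A D x)
    deadAt? A D x = any? (λ z → all? (λ y → ≡-dec _≟ᵇ_ (diff x y) D →-dec
      anyFin? (λ i → (i ∈? D) ×-dec (lookup y i ≟ lookup z i))) A) L

    Dead : List (Word s ℓ) → Subset ℓ → Set
    Dead A D = ∀ {x} → x ∈ₗ A → DeadAt A D x

    -- A smaller A leaves fewer words to block, and the blocking word z is taken from the fixed list
    -- L, so it survives. This is why L and A are kept apart.
    deadAt-mono : ∀ {A A′ D x} → (∀ {y} → y ∈ₗ A′ → y ∈ₗ A) → DeadAt A D x → DeadAt A′ D x
    deadAt-mono A′⊆A = Any.map (λ all → All.tabulate (λ y∈A′ → All.lookup all (A′⊆A y∈A′)))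

    dead-mono : ∀ {A A′ D} → (∀ {y} → y ∈ₗ A′ → y ∈ₗ A) → Dead A D → Dead A′ D
    dead-mono A′⊆A dead x∈A′ = deadAt-mono A′⊆A (dead (A′⊆A x∈A′))

    -- Every word of the fibre other than x meets one of the blocking words of x in a
    -- coordinate i ∈ K; fixing that coordinate leaves a fibre over K - i.
    length-fibre : ∀ j K B → ∣ K ∣ ≤ j → Unique B →
      (∀ {x y} → x ∈ₗ B → y ∈ₗ B → diff x y ⊆ K) →
      (∀ D → Nonempty D → D ⊆ K → Dead B D) →
      length B ≤ fibreBound ℓ j
    length-fibre j K [] _ _ _ _ = z≤n
    length-fibre zero K (x ∷ []) _ _ _ _ = ≤-refl
    length-fibre zero K (x ∷ y ∷ B) K≤0 ((x≢y ∷ _) ∷ _) agree _ = contradiction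
      (Empty-diff⇒≡ x y λ { (i , i∈) → n≮n 0 (<-≤-trans (i∈⇒0<∣K∣ (agree (here refl) (there (here refl)) i∈)) K≤0) })
      x≢y
      where
      i∈⇒0<∣K∣ : ∀ {i} → i ∈ K → 0 < ∣ K ∣
      i∈⇒0<∣K∣ {i} i∈K = ≤-<-trans z≤n (x∈p⇒∣p-x∣<∣p∣ i∈K)
    length-fibre (suc j) K (x ∷ B) K≤j (x∉B ∷ uniq) agree dead =
      s≤s (length-cover Meets? (fibreBound ℓ j) (cartesianProduct (subsets ⊤) (allFin ℓ)) B covers small)
      where
      blocker : Subset ℓ → Word s ℓ
      blocker D with deadAt? (x ∷ B) D x
      ... | yes d = proj₁ (find d)
      -- A filler: blocking words are used only for sets D that are dead at x.
      ... | no  _ = x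

      blocks : ∀ D → DeadAt (x ∷ B) D x → ∀ {y} → y ∈ₗ B → diff x y ≡ D →
               ∃ λ i → i ∈ D × lookup y i ≡ lookup (blocker D) i
      blocks D d y∈B eq with deadAt? (x ∷ B) D x
      ... | yes d′ = All.lookup (proj₂ (proj₂ (find d′))) (there y∈B) eq
      ... | no ¬d  = contradiction d ¬d

      Meets : Subset ℓ × Fin ℓ → Word s ℓ → Set
      Meets (D , i) y = i ∈ K × lookup y i ≡ lookup (blocker D) i

      Meets? : ∀ Di y → Dec (Meets Di y)
      Meets? (D , i) y = (i ∈? K) ×-dec (lookup y i ≟ lookup (blocker D) i)

      covers : ∀ {y} → y ∈ₗ B → Any (λ Di → Meets Di y) (cartesianProduct (subsets ⊤) (allFin ℓ))
      covers {y} y∈B with nonempty? (diff x y)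
      ... | no empty = contradiction (Empty-diff⇒≡ x y empty) (All.lookup x∉B y∈B)
      ... | yes ne with blocks (diff x y) (dead (diff x y) ne (agree (here refl) (there y∈B)) (here refl)) y∈B refl
      ...   | i , i∈D , meets = lose (∈-cartesianProduct⁺ (∈-subsets⁺ {p = ⊤} ⊆⊤) (∈-allFin i))
                                     (agree (here refl) (there y∈B) i∈D , meets)

      small : ∀ {Di} → Di ∈ₗ cartesianProduct (subsets ⊤) (allFin ℓ) → length (filter (Meets? Di) B) ≤ fibreBound ℓ j
      small {D , i} _ = bound (i ∈? K)
        where
        B₁ = filter (Meets? (D , i)) B
        B₁⊆ : ∀ {y} → y ∈ₗ B₁ → y ∈ₗ x ∷ B
        B₁⊆ y∈ = there (proj₁ (∈-filter⁻ (Meets? (D , i)) y∈))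
        agree₁ : ∀ {y w} → y ∈ₗ B₁ → w ∈ₗ B₁ → diff y w ⊆ K - i
        agree₁ {y} {w} y∈ w∈ a∈ = x∈p∧x≢y⇒x∈p-y (agree (B₁⊆ y∈) (B₁⊆ w∈) a∈)
          λ { refl → ∈-diff⁻ y w a∈ (trans (proj₂ (proj₂ (∈-filter⁻ (Meets? (D , i)) {xs = B} y∈)))
                                     (sym (proj₂ (proj₂ (∈-filter⁻ (Meets? (D , i)) {xs = B} w∈))))) }
        bound : Dec (i ∈ K) → length B₁ ≤ fibreBound ℓ j
        bound (no i∉K)  = ≤-trans (≤-reflexive (cong length
          (filter-none (Meets? (D , i)) {xs = B} (All.tabulate λ _ m → i∉K (proj₁ m))))) z≤n
        bound (yes i∈K) = length-fibre j (K - i) B₁ (≤-pred (≤-trans (x∈p⇒∣p-x∣<∣p∣ i∈K) K≤j)) (filter⁺ (Meets? (D , i)) uniq)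
            agree₁ (λ E ne E⊆ → dead-mono B₁⊆ (dead E ne (⊆-trans E⊆ (p─q⊆p K ⁅ i ⁆))))

    -- Each coordinate of cs is fixed in turn at the price of a factor s; what remains when cs is
    -- used up is a fibre over K.
    length-fibres : ∀ K cs A → Unique A →
      (∀ {x y} → x ∈ₗ A → y ∈ₗ A → All (λ i → lookup x i ≡ lookup y i) cs → diff x y ⊆ K) →
      (∀ D → Nonempty D → D ⊆ K → Dead A D) →
      length A ≤ s ^ length cs * fibreBound ℓ ∣ K ∣
    length-fibres K [] A uniq agree dead =
      ≤-trans (length-fibre ∣ K ∣ K A ≤-refl uniq (λ x∈ y∈ → agree x∈ y∈ []) dead) (≤-reflexive (sym (*-identityˡ _)))
    length-fibres K (i ∷ cs) A uniq agree dead = begin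
      length A                                       ≤⟨ length-cover at? _ (allFin s) A (λ {x} _ → lose (∈-allFin (lookup x i)) refl) small ⟩
      length (allFin s) * (s ^ length cs * fibreBound ℓ ∣ K ∣) ≡⟨ cong (_* (s ^ length cs * fibreBound ℓ ∣ K ∣)) (length-tabulate {n = s} (λ a → a)) ⟩
      s * (s ^ length cs * fibreBound ℓ ∣ K ∣)       ≡⟨ sym (*-assoc s _ _) ⟩
      s ^ suc (length cs) * fibreBound ℓ ∣ K ∣       ∎
      where
      open ≤-Reasoning
      at? : ∀ v (y : Word s ℓ) → Dec (lookup y i ≡ v)
      at? v y = lookup y i ≟ v
      small : ∀ {v} → v ∈ₗ allFin s → length (filter (at? v) A) ≤ s ^ length cs * fibreBound ℓ ∣ K ∣
      small {v} _ = length-fibres K cs (filter (at? v) A) (filter⁺ (at? v) uniq)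
        (λ x∈ y∈ eqs → agree (sub x∈) (sub y∈) (trans (val x∈) (sym (val y∈)) ∷ eqs))
        (λ D ne D⊆ → dead-mono sub (dead D ne D⊆))
        where
        sub : ∀ {y} → y ∈ₗ filter (at? v) A → y ∈ₗ A
        sub y∈ = proj₁ (∈-filter⁻ (at? v) y∈)
        val : ∀ {y} → y ∈ₗ filter (at? v) A → lookup y i ≡ v
        val y∈ = proj₂ (∈-filter⁻ (at? v) {xs = A} y∈)

    length-dead : ∀ K A → Unique A → (∀ D → Nonempty D → D ⊆ K → Dead A D) →
                  length A ≤ s ^ (ℓ ∸ ∣ K ∣) * fibreBound ℓ ∣ K ∣
    length-dead K A uniq dead =
      subst (λ e → length A ≤ s ^ e * fibreBound ℓ ∣ K ∣)
        (trans (length-elements (∁ K)) (∣∁p∣≡n∸∣p∣ K))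
        (length-fibres K (elements (∁ K)) A uniq agree dead)
      where
      agree : ∀ {x y} → x ∈ₗ A → y ∈ₗ A → All (λ i → lookup x i ≡ lookup y i) (elements (∁ K)) → diff x y ⊆ K
      agree {x} {y} _ _ eqs {i} i∈ with i ∈? K
      ... | yes i∈K = i∈K
      ... | no  i∉K = contradiction (All.lookup eqs (∈-elements⁺ (x∉p⇒x∈∁p i∉K))) (∈-diff⁻ x y i∈)

    -- The words of A from which a walk inside A with prescribed differences can start.
    live : List (Subset ℓ) → List (Word s ℓ) → List (Word s ℓ)
    live []       A = A
    live (D ∷ Ds) A = filter (λ x → ¬? (deadAt? (live Ds A) D x)) (live Ds A)

    live⊆ : ∀ Ds A {x} → x ∈ₗ live Ds A → x ∈ₗ A
    live⊆ []       A x∈ = x∈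
    live⊆ (D ∷ Ds) A x∈ = live⊆ Ds A (proj₁ (∈-filter⁻ (λ x → ¬? (deadAt? (live Ds A) D x)) x∈))

    live-unique : ∀ Ds {A} → Unique A → Unique (live Ds A)
    live-unique []       uniq = uniq
    live-unique (D ∷ Ds) uniq = filter⁺ _ (live-unique Ds uniq)

    alive : ∀ {A D x z} → ¬ DeadAt A D x → z ∈ₗ L →
            ∃ λ y → y ∈ₗ A × diff x y ≡ D × (∀ {i} → i ∈ D → lookup y i ≢ lookup z i)
    alive {A} {D} {x} {z} ¬dead z∈L
      with find (¬All⇒Any¬ (λ y → ≡-dec _≟ᵇ_ (diff x y) D →-dec
                  anyFin? (λ i → (i ∈? D) ×-dec (lookup y i ≟ lookup z i))) A (All.lookup (¬Any⇒All¬ L ¬dead) z∈L))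
    ... | y , y∈A , ¬meets with ≡-dec _≟ᵇ_ (diff x y) D
    ...   | no  x-y≢D = contradiction (λ x-y≡D → contradiction x-y≡D x-y≢D) ¬meets
    ...   | yes x-y≡D = y , y∈A , x-y≡D , λ i∈D eq → ¬meets (λ _ → _ , i∈D , eq)

    -- Where the step changes x, the new letter differs from that of x₀, so the step never undoes an
    -- earlier difference.
    diff-step : ∀ (x₀ x y : Word s ℓ) → (∀ {i} → i ∈ diff x y → lookup y i ≢ lookup x₀ i) →
                diff x₀ y ≡ diff x₀ x ∪ diff x y
    diff-step x₀ x y avoids = ⊆-antisym to from
      where
      to : diff x₀ y ⊆ diff x₀ x ∪ diff x y
      to {i} i∈ with i ∈? diff x y
      ... | yes i∈xy = x∈p∪q⁺ (inj₂ i∈xy)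
      ... | no  i∉xy = x∈p∪q⁺ (inj₁ (∈-diff⁺ x₀ x λ eq → ∈-diff⁻ x₀ y i∈ (trans eq (∉-diff⁻ x y i∉xy))))
      from : diff x₀ x ∪ diff x y ⊆ diff x₀ y
      from {i} i∈ with i ∈? diff x y | x∈p∪q⁻ (diff x₀ x) (diff x y) i∈
      ... | yes i∈xy | _         = ∈-diff⁺ x₀ y (λ eq → avoids i∈xy (sym eq))
      ... | no  i∉xy | inj₂ i∈xy = contradiction i∈xy i∉xy
      ... | no  i∉xy | inj₁ i∈x₀x = ∈-diff⁺ x₀ y (λ eq → ∈-diff⁻ x₀ x i∈x₀x (trans eq (sym (∉-diff⁻ x y i∉xy))))

    -- A step along D from a word live for `D ∷ Ds` can be chosen inside `live Ds A`, where the walk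
    -- continues; each step avoids the same x₀, so the differences accumulate.
    walk : ∀ Ds A {x₀ x} → x₀ ∈ₗ L → x ∈ₗ live Ds A → ∃ λ y → y ∈ₗ A × diff x₀ y ≡ diff x₀ x ∪ ⋃ Ds
    walk [] A {x₀} {x} x₀∈ x∈ = x , x∈ , sym (∪-identityʳ (diff x₀ x))
    walk (D ∷ Ds) A {x₀} {x} x₀∈ x∈
      with alive (proj₂ (∈-filter⁻ (λ x → ¬? (deadAt? (live Ds A) D x)) {xs = live Ds A} x∈)) x₀∈
    ... | y , y∈ , refl , avoids with walk Ds A x₀∈ y∈
    ...   | z , z∈ , eq = z , z∈ , (begin
            diff x₀ z                         ≡⟨ eq ⟩
            diff x₀ y ∪ ⋃ Ds                  ≡⟨ cong (_∪ ⋃ Ds) (diff-step x₀ x y avoids) ⟩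
            (diff x₀ x ∪ diff x y) ∪ ⋃ Ds     ≡⟨ ∪-assoc (diff x₀ x) (diff x y) (⋃ Ds) ⟩
            diff x₀ x ∪ (diff x y ∪ ⋃ Ds)     ∎)
      where open ≡-Reasoning

    -- The words discarded at the stage of D form a set in which D is dead, so b bounds their
    -- number.
    length-live : ∀ Ds A b → Unique A →
      (∀ {D A′} → D ∈ₗ Ds → Unique A′ → (∀ {x} → x ∈ₗ A′ → x ∈ₗ A) → Dead A′ D → length A′ ≤ b) →
      length A ≤ length (live Ds A) + length Ds * b
    length-live [] A b _ _ = m≤m+n (length A) 0
    length-live (D ∷ Ds) A b uniq small = begin
      length A                                ≤⟨ length-live Ds A b uniq (λ D∈ → small (there D∈)) ⟩
      length G + length Ds * b                ≡⟨ cong (_+ length Ds * b) (trans (length-filter+filter-¬ (deadAt? G D) G) (+-comm (length dead) _)) ⟩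
      length (live (D ∷ Ds) A) + length dead + length Ds * b
        ≡⟨ +-assoc (length (live (D ∷ Ds) A)) (length dead) (length Ds * b) ⟩
      length (live (D ∷ Ds) A) + (length dead + length Ds * b)
        ≤⟨ +-monoʳ-≤ (length (live (D ∷ Ds) A)) (+-monoˡ-≤ (length Ds * b) dead≤b) ⟩
      length (live (D ∷ Ds) A) + (b + length Ds * b) ∎
      where
      open ≤-Reasoning
      G    = live Ds A
      dead = filter (deadAt? G D) G
      dead⊆G : ∀ {x} → x ∈ₗ dead → x ∈ₗ G
      dead⊆G x∈ = proj₁ (∈-filter⁻ (deadAt? G D) x∈)
      dead≤b : length dead ≤ b
      dead≤b = small (here refl) (filter⁺ (deadAt? G D) (live-unique Ds uniq)) (λ x∈ → live⊆ Ds A (dead⊆G x∈))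
        (λ x∈ → deadAt-mono dead⊆G (proj₂ (∈-filter⁻ (deadAt? G D) {xs = G} x∈)))

    -- T lists the sets not yet dead.  Either all nonempty subsets of some k-set are dead, or T has a
    -- union of size k; no walk realises it, so A splits into at most k parts, each with one more dead set.
    length-code : ∀ k → 1 ≤ k → k + 2 ^ k * k < ℓ → (∀ {x y} → x ∈ₗ L → y ∈ₗ L → ∣ diff x y ∣ ≢ k) →
      ∀ t T A → length T ≤ t → Unique A → (∀ {x} → x ∈ₗ A → x ∈ₗ L) →
      (∀ D → Nonempty D → D ∉ₗ T → Dead A D) →
      length A ≤ k ^ t * (s ^ (ℓ ∸ k) * fibreBound ℓ k)
    length-code k 1≤k large forbidden t T A T≤t uniq A⊆L dead with independent-or-union T k large
    ... | inj₁ (K , refl , ind) = ≤-trans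
          (length-dead K A uniq λ D ne D⊆K → dead D ne (λ D∈T → ⊥-elim (All.lookup ind D∈T (ne , D⊆K))))
          (m≤n*m _ (k ^ t) {{m^n≢0 k t {{>-nonZero 1≤k}}}})
    ... | inj₂ (Ds , Ds⊆T , Ds≤k , ∣⋃Ds∣≡k) = split t T≤t
      where
      -- A walk from a live x, measured from x itself, would end at a word of A differing from x
      -- exactly on `⋃ Ds`, hence at distance k.
      no-live : live Ds A ≡ []
      no-live with live Ds A in eq
      ... | []    = refl
      ... | x ∷ _ with walk Ds A (A⊆L (live⊆ Ds A x∈)) x∈
        where
        x∈ : x ∈ₗ live Ds A
        x∈ = subst (x ∈ₗ_) (sym eq) (here refl)
      ...   | y , y∈A , x-y≡ = contradiction
              (trans (cong ∣_∣ (trans x-y≡ (trans (cong (_∪ ⋃ Ds) (diff-refl x)) (∪-identityˡ (⋃ Ds))))) ∣⋃Ds∣≡k)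
              (forbidden (A⊆L (live⊆ Ds A (subst (x ∈ₗ_) (sym eq) (here refl)))) (A⊆L y∈A))
      split : ∀ t → length T ≤ t → length A ≤ k ^ t * (s ^ (ℓ ∸ k) * fibreBound ℓ k)
      split zero T≤0 = ≤-trans (length-live Ds A 0 uniq (λ D∈ → contradiction (All.lookup Ds⊆T D∈) (T≡[] T≤0)))
        (≤-trans (≤-reflexive (cong₂ _+_ (cong length no-live) (*-zeroʳ (length Ds)))) z≤n)
        where
        T≡[] : ∀ {T : List (Subset ℓ)} → length T ≤ 0 → ∀ {D} → D ∉ₗ T
        T≡[] {[]} _ ()
      split (suc t) T≤1+t = begin
        length A                              ≤⟨ length-live Ds A b uniq small ⟩
        length (live Ds A) + length Ds * b    ≡⟨ cong (λ l → length l + length Ds * b) no-live ⟩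
        length Ds * b                         ≤⟨ *-monoˡ-≤ b Ds≤k ⟩
        k * b                                 ≡⟨ sym (*-assoc k (k ^ t) _) ⟩
        k ^ suc t * (s ^ (ℓ ∸ k) * fibreBound ℓ k) ∎
        where
        open ≤-Reasoning
        b = k ^ t * (s ^ (ℓ ∸ k) * fibreBound ℓ k)
        small : ∀ {D A′} → D ∈ₗ Ds → Unique A′ → (∀ {x} → x ∈ₗ A′ → x ∈ₗ A) → Dead A′ D → length A′ ≤ b
        small {D} {A′} D∈Ds uniq′ A′⊆A deadD = length-code k 1≤k large forbidden t T′ A′
          (≤-pred (≤-trans (filter-notAll ≢D? T (Any.map (λ { refl ¬≡ → ¬≡ refl }) (All.lookup Ds⊆T D∈Ds))) T≤1+t))
          uniq′ (λ x∈ → A⊆L (A′⊆A x∈)) dead′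
          where
          ≢D? : ∀ E → Dec (¬ (E ≡ D))
          ≢D? E = ¬? (≡-dec _≟ᵇ_ E D)
          T′ = filter ≢D? T
          dead′ : ∀ E → Nonempty E → E ∉ₗ T′ → Dead A′ E
          dead′ E ne E∉T′ with ≡-dec _≟ᵇ_ E D
          ... | yes refl = deadD
          ... | no  E≢D  = dead-mono A′⊆A (dead E ne λ E∈T → E∉T′ (∈-filter⁺ ≢D? E∈T E≢D))

  -- The recursion starts when no set is known to be dead, with all subsets in T; every level costs
  -- a factor k.
  codeConstant : ℕ → ℕ → ℕ
  codeConstant ℓ k = k ^ length (subsets (⊤ {ℓ})) * fibreBound ℓ k

  length-forbidden : ∀ {s ℓ} k → 1 ≤ k → k + 2 ^ k * k < ℓ → (A : List (Word s ℓ)) → Unique A →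
    (∀ {x y} → x ∈ₗ A → y ∈ₗ A → ∣ diff x y ∣ ≢ k) →
    length A ≤ codeConstant ℓ k * s ^ (ℓ ∸ k)
  length-forbidden {s} {ℓ} k 1≤k large A uniq forbidden = ≤-trans
    (length-code A k 1≤k large forbidden (length (subsets (⊤ {ℓ}))) (subsets ⊤) A ≤-refl uniq (λ x∈ → x∈)
      (λ D _ D∉ → contradiction (∈-subsets⁺ {p = ⊤} ⊆⊤) D∉))
    (≤-reflexive (trans (cong (k ^ length (subsets (⊤ {ℓ})) *_) (*-comm (s ^ (ℓ ∸ k)) _)) (sym (*-assoc (k ^ length (subsets (⊤ {ℓ}))) _ _))))

-- Lists without repetitions and lists of vectors.

module ListUniqueness where

  open import Data.Nat
  open import Data.Fin using (zero; suc)
  open import Data.List using (List; []; _∷_; length; map; cartesianProductWith; lookup)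
  open import Data.List.Properties using (length-++; length-map)
  open import Data.List.Membership.Propositional using (_∈_)
  open import Data.List.Membership.Propositional.Properties using (∈-cartesianProductWith⁺; ∈-lookup)
  open import Data.List.Relation.Unary.All as All using ([]; _∷_)
  open import Data.List.Relation.Unary.Any using (here; there)
  open import Data.List.Relation.Unary.AllPairs using (AllPairs; []; _∷_)
  import Data.List.Relation.Unary.AllPairs.Properties as AllPairs
  open import Data.List.Relation.Unary.Unique.Propositional using (Unique)
  open import Data.List.Relation.Unary.Unique.Propositional.Properties using (cartesianProductWith⁺)
  open import Data.Vec using (Vec; []; _∷_)
  open import Data.Product using (_,_)
  open import Data.Sum using (_⊎_; inj₁; inj₂)
  open import Relation.Nullary using (contradiction)
  open import Relation.Binary.PropositionalEquality

  length-cartesianProductWith : ∀ {A B C : Set} (f : A → B → C) xs ys →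
    length (cartesianProductWith f xs ys) ≡ length xs * length ys
  length-cartesianProductWith f []       ys = refl
  length-cartesianProductWith f (x ∷ xs) ys =
    trans (length-++ (map (f x) ys)) (cong₂ _+_ (length-map (f x) ys) (length-cartesianProductWith f xs ys))

  allPairs-map-∈ : ∀ {A : Set} {R S : A → A → Set} {xs} →
    (∀ {x y} → x ∈ xs → y ∈ xs → R x y → S x y) → AllPairs R xs → AllPairs S xs
  allPairs-map-∈ R⇒S []        = []
  allPairs-map-∈ R⇒S (Rx ∷ Rs) =
    All.tabulate (λ y∈ → R⇒S (here refl) (there y∈) (All.lookup Rx y∈)) ∷
    allPairs-map-∈ (λ x∈ y∈ → R⇒S (there x∈) (there y∈)) Rs

  map⁺-∈ : ∀ {A B : Set} (f : A → B) {xs} → (∀ {x y} → x ∈ xs → y ∈ xs → f x ≡ f y → x ≡ y) →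
           Unique xs → Unique (map f xs)
  map⁺-∈ f inj uniq = AllPairs.map⁺ (allPairs-map-∈ (λ x∈ y∈ x≢y fx≡fy → x≢y (inj x∈ y∈ fx≡fy)) uniq)

  lookup-injective : ∀ {A : Set} {xs : List A} → Unique xs → ∀ {i j} → lookup xs i ≡ lookup xs j → i ≡ j
  lookup-injective (x∉ ∷ u) {zero}  {zero}  eq = refl
  lookup-injective (x∉ ∷ u) {zero}  {suc j} eq = contradiction eq (All.lookup x∉ (∈-lookup j))
  lookup-injective (x∉ ∷ u) {suc i} {zero}  eq = contradiction (sym eq) (All.lookup x∉ (∈-lookup i))
  lookup-injective (x∉ ∷ u) {suc i} {suc j} eq = cong suc (lookup-injective u eq)

  allPairs-lookup : ∀ {A : Set} {R : A → A → Set} {xs} → AllPairs R xs →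
                    ∀ {x y} → x ∈ xs → y ∈ xs → x ≡ y ⊎ R x y ⊎ R y x
  allPairs-lookup (_  ∷ _) (here refl) (here refl) = inj₁ refl
  allPairs-lookup (Rx ∷ _) (here refl) (there y∈)  = inj₂ (inj₁ (All.lookup Rx y∈))
  allPairs-lookup (Ry ∷ _) (there x∈)  (here refl) = inj₂ (inj₂ (All.lookup Ry x∈))
  allPairs-lookup (_  ∷ R) (there x∈)  (there y∈)  = allPairs-lookup R x∈ y∈

  vectors : ∀ {A : Set} → List A → ∀ n → List (Vec A n)
  vectors xs zero    = [] ∷ []
  vectors xs (suc n) = cartesianProductWith _∷_ xs (vectors xs n)

  length-vectors : ∀ {A : Set} (xs : List A) n → length (vectors xs n) ≡ length xs ^ n
  length-vectors xs zero    = refl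
  length-vectors xs (suc n) =
    trans (length-cartesianProductWith _∷_ xs (vectors xs n)) (cong (length xs *_) (length-vectors xs n))

  vectors-unique : ∀ {A : Set} {xs : List A} n → Unique xs → Unique (vectors xs n)
  vectors-unique zero    uniq = [] ∷ []
  vectors-unique (suc n) uniq = cartesianProductWith⁺ _∷_ (λ { refl → refl , refl }) uniq (vectors-unique n uniq)

  ∈-vectors : ∀ {A : Set} {xs : List A} → (∀ x → x ∈ xs) → ∀ {n} (v : Vec A n) → v ∈ vectors xs n
  ∈-vectors all∈ []      = here refl
  ∈-vectors all∈ (x ∷ v) = ∈-cartesianProductWith⁺ _∷_ (all∈ x) (∈-vectors all∈ v)

-- Graphs as finite data: enumeration, equality and toggling.

module GraphCodes where

  open import Data.Nat hiding (_≟_)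
  open import Data.Nat.Combinatorics using (_C_; nC1≡n; nCk+nC[k+1]≡[n+1]C[k+1])
  open import Data.Nat.Properties using (^-distribˡ-+-*)
  open import Data.Bool using (Bool; true; false; _xor_; _≟_)
  open import Data.Bool.Properties using (xor-assoc; xor-same; xor-identityʳ)
  open import Data.Fin using (Fin; zero; suc)
  open import Data.Fin.Properties using (any?)
  open import Data.Vec using (Vec; lookup; tabulate)
  open import Data.Vec.Properties using (lookup∘tabulate; ≡-dec)
  open import Data.Vec.Relation.Binary.Pointwise.Extensional using (ext; Pointwise-≡⇒≡)
  open import Data.List using (List; []; _∷_; length; cartesianProduct)
  open import Data.List.Membership.Propositional using (_∈_)
  open import Data.List.Membership.Propositional.Properties using (∈-cartesianProduct⁺)
  open import Data.List.Relation.Unary.All using ([]; _∷_)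
  open import Data.List.Relation.Unary.Any using (here; there)
  open import Data.List.Relation.Unary.AllPairs using ([]; _∷_)
  open import Data.List.Relation.Unary.Unique.Propositional using (Unique)
  open import Data.List.Relation.Unary.Unique.Propositional.Properties using (cartesianProduct⁺)
  open import Data.Product using (_×_; _,_)
  import Data.Product.Properties as Product
  open import Data.Unit using (⊤; tt)
  open import Relation.Nullary using (Dec; yes; no; ¬?; contradiction)
  open import Relation.Nullary.Decidable using (decidable-stable)
  open import Relation.Binary.PropositionalEquality
  open ListUniqueness

  -- The upper triangle of an adjacency matrix, row by row.
  Code : ℕ → Set
  Code zero    = ⊤
  Code (suc n) = Vec Bool n × Code n

  adjᶜ : ∀ {n} → Code n → Fin n → Fin n → Bool
  adjᶜ (row , c) zero    zero    = false
  adjᶜ (row , c) zero    (suc v) = lookup row v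
  adjᶜ (row , c) (suc u) zero    = lookup row u
  adjᶜ (row , c) (suc u) (suc v) = adjᶜ c u v

  adjᶜ-sym : ∀ {n} (c : Code n) u v → adjᶜ c u v ≡ adjᶜ c v u
  adjᶜ-sym (row , c) zero    zero    = refl
  adjᶜ-sym (row , c) zero    (suc v) = refl
  adjᶜ-sym (row , c) (suc u) zero    = refl
  adjᶜ-sym (row , c) (suc u) (suc v) = adjᶜ-sym c u v

  adjᶜ-irrefl : ∀ {n} (c : Code n) v → adjᶜ c v v ≡ false
  adjᶜ-irrefl (row , c) zero    = refl
  adjᶜ-irrefl (row , c) (suc v) = adjᶜ-irrefl c v

  decode : ∀ {n} → Code n → GraphOn n
  decode c = record { adj = adjᶜ c ; sym = adjᶜ-sym c ; irrefl = adjᶜ-irrefl c }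

  encode : ∀ {n} → (Fin n → Fin n → Bool) → Code n
  encode {zero}  f = tt
  encode {suc n} f = tabulate (λ v → f zero (suc v)) , encode (λ u v → f (suc u) (suc v))

  adjᶜ-encode : ∀ {n} (f : Fin n → Fin n → Bool) → (∀ u v → f u v ≡ f v u) → (∀ v → f v v ≡ false) →
                ∀ u v → adjᶜ (encode f) u v ≡ f u v
  adjᶜ-encode f s i zero    zero    = sym (i zero)
  adjᶜ-encode f s i zero    (suc v) = lookup∘tabulate (λ v → f zero (suc v)) v
  adjᶜ-encode f s i (suc u) zero    = trans (lookup∘tabulate (λ v → f zero (suc v)) u) (s zero (suc u))
  adjᶜ-encode f s i (suc u) (suc v) =
    adjᶜ-encode (λ u v → f (suc u) (suc v)) (λ u v → s (suc u) (suc v)) (λ v → i (suc v)) u v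

  adjᶜ-injective : ∀ {n} {c d : Code n} → (∀ u v → adjᶜ c u v ≡ adjᶜ d u v) → c ≡ d
  adjᶜ-injective {zero}  eq = refl
  adjᶜ-injective {suc n} eq =
    cong₂ _,_ (Pointwise-≡⇒≡ (ext λ v → eq zero (suc v))) (adjᶜ-injective λ u v → eq (suc u) (suc v))

  decode-distinct : ∀ {n} {c d : Code n} → c ≢ d → Distinct (decode c) (decode d)
  decode-distinct {c = c} {d} c≢d with any? (λ u → any? (λ v → ¬? (adjᶜ c u v ≟ adjᶜ d u v)))
  ... | yes distinct = distinct
  ... | no  same = contradiction
        (adjᶜ-injective λ u v → decidable-stable (adjᶜ c u v ≟ adjᶜ d u v) (λ ≢ → same (u , v , ≢))) c≢d

  -- Adjacency functions come with no decidable equality. Codes have one, so pairs can be sorted by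
  -- the graph they produce.
  _≟ᶜ_ : ∀ {n} (c d : Code n) → Dec (c ≡ d)
  _≟ᶜ_ {zero}  tt tt = yes refl
  _≟ᶜ_ {suc n} = Product.≡-dec (≡-dec _≟_) _≟ᶜ_

  bools : List Bool
  bools = true ∷ false ∷ []

  bools-complete : ∀ b → b ∈ bools
  bools-complete true  = here refl
  bools-complete false = there (here refl)

  codes : ∀ n → List (Code n)
  codes zero    = tt ∷ []
  codes (suc n) = cartesianProduct (vectors bools n) (codes n)

  length-codes : ∀ n → length (codes n) ≡ 2 ^ (n C 2)
  length-codes zero    = refl
  length-codes (suc n) = begin
    length (codes (suc n))                           ≡⟨ length-cartesianProductWith _,_ (vectors bools n) (codes n) ⟩
    length (vectors bools n) * length (codes n)      ≡⟨ cong₂ _*_ (length-vectors bools n) (length-codes n) ⟩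
    2 ^ n * 2 ^ (n C 2)                              ≡⟨ sym (^-distribˡ-+-* 2 n (n C 2)) ⟩
    2 ^ (n + n C 2)                                  ≡⟨ cong (λ m → 2 ^ (m + n C 2)) (sym (nC1≡n n)) ⟩
    2 ^ (n C 1 + n C 2)                              ≡⟨ cong (2 ^_) (nCk+nC[k+1]≡[n+1]C[k+1] n 1) ⟩
    2 ^ (suc n C 2)                                  ∎
    where open ≡-Reasoning

  codes-unique : ∀ n → Unique (codes n)
  codes-unique zero    = [] ∷ []
  codes-unique (suc n) = cartesianProduct⁺ (vectors-unique n (((λ ()) ∷ []) ∷ [] ∷ [])) (codes-unique n)

  ∈-codes : ∀ {n} (c : Code n) → c ∈ codes n
  ∈-codes {zero}  tt        = here refl
  ∈-codes {suc n} (row , c) = ∈-cartesianProduct⁺ (∈-vectors bools-complete row) (∈-codes c)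

  toggle : ∀ {n} → GraphOn n → Code n → Code n
  toggle h c = encode (λ u v → adjᶜ c u v xor adj h u v)

  adjᶜ-toggle : ∀ {n} (h : GraphOn n) (c : Code n) u v → adjᶜ (toggle h c) u v ≡ adjᶜ c u v xor adj h u v
  adjᶜ-toggle h c = adjᶜ-encode _ (λ u v → cong₂ _xor_ (adjᶜ-sym c u v) (Graph.sym h u v))
                                  (λ v → cong₂ _xor_ (adjᶜ-irrefl c v) (irrefl h v))

  toggle-involutive : ∀ {n} (h : GraphOn n) (c : Code n) → toggle h (toggle h c) ≡ c
  toggle-involutive h c = adjᶜ-injective λ u v → begin
    adjᶜ (toggle h (toggle h c)) u v            ≡⟨ adjᶜ-toggle h (toggle h c) u v ⟩
    adjᶜ (toggle h c) u v xor adj h u v        ≡⟨ cong (_xor adj h u v) (adjᶜ-toggle h c u v) ⟩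
    (adjᶜ c u v xor adj h u v) xor adj h u v  ≡⟨ xor-assoc (adjᶜ c u v) (adj h u v) (adj h u v) ⟩
    adjᶜ c u v xor (adj h u v xor adj h u v)  ≡⟨ cong (adjᶜ c u v xor_) (xor-same (adj h u v)) ⟩
    adjᶜ c u v xor false                        ≡⟨ xor-identityʳ (adjᶜ c u v) ⟩
    adjᶜ c u v                                  ∎
    where open ≡-Reasoning

-- Edge families all of whose t-subsets form a copy of H.

module Copies where

  open import Data.Nat hiding (_≟_)
  open import Data.Nat.Properties using (≡ᵇ⇒≡; ≡⇒≡ᵇ)
  open import Data.Bool using (Bool; true; false; _xor_; _∧_; _≟_)
  open import Data.Bool.Properties using (T-≡)
  open import Data.Fin as Fin using (Fin; zero; suc; toℕ)
  open import Data.Fin.Properties using (any?; toℕ-injective)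
  open import Data.List using (List; length; lookup)
  open import Data.List.Membership.Propositional using (_∈_)
  open import Data.List.Membership.Propositional.Properties using (∈-lookup)
  open import Data.List.Relation.Unary.Any using (index)
  open import Data.List.Relation.Unary.Any.Properties using (lookup-index)
  open import Data.List.Relation.Unary.Unique.Propositional using (Unique)
  open import Data.Product using (∃; _×_; _,_; proj₁; proj₂)
  open import Data.Sum using (_⊎_; inj₁; inj₂)
  open import Function.Bundles using (Equivalence)
  open import Relation.Nullary using (¬_; Dec; does; yes; no; contradiction; _×-dec_; _⊎-dec_)
  open import Relation.Nullary.Decidable using (dec-true; dec-false)
  open import Relation.Binary.PropositionalEquality
  open ListUniqueness

  record EdgeFamily (n m : ℕ) : Set where
    field
      src tgt : Fin m → Fin n
    Joins : Fin m → Fin n → Fin n → Set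
    Joins e u v = (src e ≡ u × tgt e ≡ v) ⊎ (src e ≡ v × tgt e ≡ u)
    field
      loopless : ∀ e → src e ≢ tgt e
      simple   : ∀ {e e′ u v} → Joins e u v → Joins e′ u v → e ≡ e′

  module _ {n m} (fam : EdgeFamily n m) where
    open EdgeFamily fam

    joins-sym : ∀ {e u v} → Joins e u v → Joins e v u
    joins-sym (inj₁ eqs) = inj₂ eqs
    joins-sym (inj₂ eqs) = inj₁ eqs

    joins? : ∀ e u v → Dec (Joins e u v)
    joins? e u v = ((src e Fin.≟ u) ×-dec (tgt e Fin.≟ v)) ⊎-dec ((src e Fin.≟ v) ×-dec (tgt e Fin.≟ u))

    selected? : ∀ (h : Fin m → Bool) u v → Dec (∃ λ e → Joins e u v × h e ≡ true)
    selected? h u v = any? (λ e → joins? e u v ×-dec (h e ≟ true))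

    -- By `simple` no other member of the family joins u and v, so the adjacency is decided by e
    -- alone.
    selected-joins : ∀ h {e u v} → Joins e u v → does (selected? h u v) ≡ h e
    selected-joins h {e} {u} {v} j with h e in he
    ... | true  = dec-true (selected? h u v) (e , j , he)
    ... | false = dec-false (selected? h u v) λ { (e′ , j′ , he′) →
                    contradiction (trans (sym he) (trans (cong h (simple j j′)) he′)) λ () }

    selected-none : ∀ h {u v} → ¬ (∃ λ e → Joins e u v) → does (selected? h u v) ≡ false
    selected-none h {u} {v} none = dec-false (selected? h u v) λ { (e , j , _) → none (e , j) }

    subgraph : (Fin m → Bool) → GraphOn n
    subgraph h = record
      { adj    = λ u v → does (selected? h u v)
      ; sym    = λ u v → symmetric u v
      ; irrefl = λ v → selected-none h λ { (e , inj₁ (refl , eq)) → loopless e (sym eq)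
                                         ; (e , inj₂ (refl , eq)) → loopless e (sym eq) }
      }
      where
      symmetric : ∀ u v → does (selected? h u v) ≡ does (selected? h v u)
      symmetric u v with any? (λ e → joins? e u v)
      ... | yes (e , j) = trans (selected-joins h j) (sym (selected-joins h (joins-sym j)))
      ... | no  none    = trans (selected-none h none)
                                (sym (selected-none h λ { (e , j) → none (e , joins-sym j) }))

    EdgesAre : (Fin n → Fin n → Bool) → List (Fin m) → Set
    EdgesAre E es = ∀ u v → (E u v ≡ true → ∃ λ e → e ∈ es × Joins e u v)
                          × (∀ {e} → e ∈ es → Joins e u v → E u v ≡ true)

    edgesAre-symDiff : ∀ h h′ es → (∀ e → (h e xor h′ e ≡ true → e ∈ es) × (e ∈ es → h e xor h′ e ≡ true)) →
                       EdgesAre (λ u v → adj (subgraph h) u v xor adj (subgraph h′) u v) es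
    edgesAre-symDiff h h′ es spec u v = to , from
      where
      value : ∀ {e} → Joins e u v → adj (subgraph h) u v xor adj (subgraph h′) u v ≡ h e xor h′ e
      value j = cong₂ _xor_ (selected-joins h j) (selected-joins h′ j)
      to : _ → ∃ λ e → e ∈ es × Joins e u v
      to eq with any? (λ e → joins? e u v)
      ... | yes (e , j) = e , proj₁ (spec e) (trans (sym (value j)) eq) , j
      ... | no  none with () ← trans (sym (cong₂ _xor_ (selected-none h none) (selected-none h′ none))) eq
      from : ∀ {e} → e ∈ es → Joins e u v → _
      from {e} e∈ j = trans (value j) (proj₂ (spec e) e∈)

    edgesAre-cong : ∀ {E E′ es} → (∀ u v → E u v ≡ E′ u v) → EdgesAre E es → EdgesAre E′ es
    edgesAre-cong E≗E′ spec u v =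
      (λ eq → proj₁ (spec u v) (trans (E≗E′ u v) eq)) ,
      (λ e∈ j → trans (sym (E≗E′ u v)) (proj₂ (spec u v) e∈ j))

    -- The averaging argument uses the shape of H only through this property.
    Copies : ∀ {V} → Graph V → ℕ → Set
    Copies H t = ∀ {E es} → Unique es → length es ≡ t → EdgesAre E es → IsCopyOf H E

    star-copies : ∀ c → (∀ e → src e ≡ c) → ∀ t → Copies (Star t) t
    star-copies c src≡c .(length es) {E} {es} uniq refl spec = φ , φ-injective , λ u v → to u v , from u v
      where
      φ : Fin (suc (length es)) → Fin n
      φ zero    = c
      φ (suc i) = tgt (lookup es i)

      φ-injective : ∀ {a b} → φ a ≡ φ b → a ≡ b
      φ-injective {zero}  {zero}  eq = refl
      φ-injective {zero}  {suc j} eq = contradiction (trans (src≡c _) eq) (loopless (lookup es j))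
      φ-injective {suc i} {zero}  eq = contradiction (trans (src≡c _) (sym eq)) (loopless (lookup es i))
      φ-injective {suc i} {suc j} eq = cong suc (lookup-injective uniq
        (simple (inj₁ (src≡c _ , eq)) (inj₁ (src≡c _ , refl))))

      to : ∀ u v → E u v ≡ true → ∃ λ a → ∃ λ b → starAdj (length es) a b ≡ true × φ a ≡ u × φ b ≡ v
      to u v eq with proj₁ (spec u v) eq
      ... | e , e∈ , inj₁ (src≡u , tgt≡v) = zero , suc (index e∈) , refl ,
            trans (sym (src≡c e)) src≡u , trans (cong tgt (sym (lookup-index e∈))) tgt≡v
      ... | e , e∈ , inj₂ (src≡v , tgt≡u) = suc (index e∈) , zero , refl ,
            trans (cong tgt (sym (lookup-index e∈))) tgt≡u , trans (sym (src≡c e)) src≡v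

      from : ∀ u v → (∃ λ a → ∃ λ b → starAdj (length es) a b ≡ true × φ a ≡ u × φ b ≡ v) → E u v ≡ true
      from u v (zero  , suc j , _ , refl , refl) = proj₂ (spec u v) (∈-lookup j) (inj₁ (src≡c _ , refl))
      from u v (suc i , zero  , _ , refl , refl) = proj₂ (spec u v) (∈-lookup i) (inj₂ (src≡c _ , refl))

    matching-copies : (∀ {e e′} → src e ≡ src e′ → e ≡ e′) → (∀ {e e′} → tgt e ≡ tgt e′ → e ≡ e′) →
                      (∀ {e e′} → src e ≢ tgt e′) → ∀ t → Copies (Matching t) t
    matching-copies src-inj tgt-inj src≢tgt .(length es) {E} {es} uniq refl spec =
      φ , φ-injective , λ u v → to u v , from u v
      where
      t = length es

      φ : Fin t × Bool → Fin n
      φ (i , false) = src (lookup es i)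
      φ (i , true)  = tgt (lookup es i)

      φ-injective : ∀ {a b} → φ a ≡ φ b → a ≡ b
      φ-injective {i , false} {j , false} eq = cong (_, false) (lookup-injective uniq (src-inj eq))
      φ-injective {i , false} {j , true}  eq = contradiction eq src≢tgt
      φ-injective {i , true}  {j , false} eq = contradiction (sym eq) src≢tgt
      φ-injective {i , true}  {j , true}  eq = cong (_, true) (lookup-injective uniq (tgt-inj eq))

      ≡ᵇ-refl : ∀ j → (j ≡ᵇ j) ≡ true
      ≡ᵇ-refl j = Equivalence.to T-≡ (≡⇒≡ᵇ j j refl)

      to : ∀ u v → E u v ≡ true → ∃ λ a → ∃ λ b → matchAdj t a b ≡ true × φ a ≡ u × φ b ≡ v
      to u v eq with proj₁ (spec u v) eq
      ... | e , e∈ , inj₁ (src≡u , tgt≡v) = (index e∈ , false) , (index e∈ , true) ,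
            cong (_∧ true) (≡ᵇ-refl (toℕ (index e∈))) ,
            trans (cong src (sym (lookup-index e∈))) src≡u , trans (cong tgt (sym (lookup-index e∈))) tgt≡v
      ... | e , e∈ , inj₂ (src≡v , tgt≡u) = (index e∈ , true) , (index e∈ , false) ,
            cong (_∧ true) (≡ᵇ-refl (toℕ (index e∈))) ,
            trans (cong tgt (sym (lookup-index e∈))) tgt≡u , trans (cong src (sym (lookup-index e∈))) src≡v

      from : ∀ u v → (∃ λ a → ∃ λ b → matchAdj t a b ≡ true × φ a ≡ u × φ b ≡ v) → E u v ≡ true
      from u v ((i , b) , (j , c) , eq , refl , refl) with toℕ i ≡ᵇ toℕ j in i≡ᵇj
      from u v ((i , b) , (j , c) , ()  , refl , refl) | false
      ... | true with toℕ-injective (≡ᵇ⇒≡ (toℕ i) (toℕ j) (Equivalence.from T-≡ i≡ᵇj))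
      from u v ((i , false) , (i , true)  , eq , refl , refl) | true | refl =
        proj₂ (spec u v) (∈-lookup i) (inj₁ (refl , refl))
      from u v ((i , true)  , (i , false) , eq , refl , refl) | true | refl =
        proj₂ (spec u v) (∈-lookup i) (inj₂ (refl , refl))

-- Averaging: from words to codes of graphs.

module UpperBound where

  open import Data.Nat hiding (_≟_)
  open import Data.Nat.Properties hiding (_≟_)
  open import Data.Nat.Combinatorics using (_C_)
  open import Data.Bool using (Bool; true; false; _xor_)
  open import Data.Bool.Properties using (xor-same; xor-comm; not-involutive)
  open import Data.Fin using (Fin; _≟_; combine)
  open import Data.Fin.Properties using (any?; combine-injective; combine-injectiveˡ)
  open import Data.Fin.Subset using (∣_∣) renaming (_∈_ to _∈ˢ_)
  open import Data.List using (List; []; _∷_; _++_; length; map; filter; allFin; cartesianProduct)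
  open import Data.List.Properties using (length-map; length-++; length-tabulate)
  open import Data.List.Membership.Propositional using (_∈_; lose)
  open import Data.List.Membership.Propositional.Properties
  open import Data.List.Relation.Unary.Any using (here)
  import Data.List.Relation.Unary.AllPairs as AllPairs
  import Data.List.Relation.Unary.AllPairs.Properties as AllPairs
  open import Data.List.Relation.Unary.Unique.Propositional using (Unique)
  open import Data.List.Relation.Unary.Unique.Propositional.Properties using (map⁺; ++⁺; filter⁺; cartesianProduct⁺; allFin⁺)
  open import Data.Product using (∃; _×_; _,_; proj₁; proj₂)
  open import Data.Sum using (inj₁; inj₂)
  open import Data.Vec using (lookup)
  open import Relation.Nullary using (¬_; Dec; does; yes; no; contradiction)
  open import Relation.Nullary.Decidable using (dec-true; dec-false)
  open import Relation.Binary.PropositionalEquality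
  open ListCounting
  open SubsetLists
  open ForbiddenDistance
  open ListUniqueness
  open GraphCodes
  open Copies

  module _ {s ℓ : ℕ} where

    slot : Word s ℓ → Fin ℓ → Fin (ℓ * s)
    slot x i = combine i (lookup x i)

    chosen? : ∀ (x : Word s ℓ) e → Dec (∃ λ i → e ≡ slot x i)
    chosen? x e = any? (λ i → e ≟ slot x i)

    chosen : Word s ℓ → Fin (ℓ * s) → Bool
    chosen x e = does (chosen? x e)

    -- A coordinate where the words differ contributes two edges, the choice of x and that of y; so
    -- distance k corresponds to 2k edges.
    slots : Word s ℓ → Word s ℓ → List (Fin (ℓ * s))
    slots x y = map (slot x) (elements (diff x y)) ++ map (slot y) (elements (diff x y))

    slot-injective : ∀ x {i j} → slot x i ≡ slot x j → i ≡ j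
    slot-injective x {i} {j} = combine-injectiveˡ i (lookup x i) j (lookup x j)

    slot-clash : ∀ x y {i j} → i ∈ˢ diff x y → slot x i ≢ slot y j
    slot-clash x y {i} {j} i∈ eq with combine-injective i (lookup x i) j (lookup y j) eq
    ... | refl , x≡y = ∈-diff⁻ x y i∈ x≡y

    length-slots : ∀ x y → length (slots x y) ≡ 2 * ∣ diff x y ∣
    length-slots x y = begin
      length (slots x y)
        ≡⟨ length-++ (map (slot x) (elements (diff x y))) ⟩
      length (map (slot x) (elements (diff x y))) + length (map (slot y) (elements (diff x y)))
        ≡⟨ cong₂ _+_ (len x) (len y) ⟩
      ∣ diff x y ∣ + ∣ diff x y ∣
        ≡⟨ cong (∣ diff x y ∣ +_) (sym (+-identityʳ _)) ⟩
      2 * ∣ diff x y ∣ ∎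
      where
      open ≡-Reasoning
      len : ∀ z → length (map (slot z) (elements (diff x y))) ≡ ∣ diff x y ∣
      len z = trans (length-map (slot z) (elements (diff x y))) (length-elements (diff x y))

    slots-unique : ∀ x y → Unique (slots x y)
    slots-unique x y = ++⁺ (map⁺ (slot-injective x) (elements-unique (diff x y)))
                           (map⁺ (slot-injective y) (elements-unique (diff x y))) disjoint
      where
      disjoint : ∀ {e} → ¬ (e ∈ map (slot x) (elements (diff x y)) × e ∈ map (slot y) (elements (diff x y)))
      disjoint (e∈x , e∈y) with ∈-map⁻ (slot x) e∈x | ∈-map⁻ (slot y) e∈y
      ... | i , i∈ , refl | j , _ , eq = slot-clash x y (∈-elements⁻ (diff x y) i∈) eq

    slots-spec : ∀ x y e → (chosen x e xor chosen y e ≡ true → e ∈ slots x y)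
                         × (e ∈ slots x y → chosen x e xor chosen y e ≡ true)
    slots-spec x y e = to , from
      where
      to : chosen x e xor chosen y e ≡ true → e ∈ slots x y
      to eq with chosen? x e | chosen? y e
      to () | yes _ | yes _
      to () | no  _ | no  _
      ... | yes (i , refl) | no ¬y = ∈-++⁺ˡ (∈-map⁺ (slot x) (∈-elements⁺
              (∈-diff⁺ x y λ x≡y → ¬y (i , cong (combine i) x≡y))))
      ... | no ¬x | yes (i , refl) = ∈-++⁺ʳ _ (∈-map⁺ (slot y) (∈-elements⁺
              (∈-diff⁺ x y λ x≡y → ¬x (i , cong (combine i) (sym x≡y)))))
      from : e ∈ slots x y → chosen x e xor chosen y e ≡ true
      from e∈ with ∈-++⁻ (map (slot x) (elements (diff x y))) e∈
      ... | inj₁ e∈x with ∈-map⁻ (slot x) e∈x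
      ...   | i , i∈ , refl = cong₂ _xor_ (dec-true (chosen? x (slot x i)) (i , refl))
              (dec-false (chosen? y (slot x i)) λ { (j , eq) → slot-clash x y (∈-elements⁻ (diff x y) i∈) eq })
      from e∈ | inj₂ e∈y with ∈-map⁻ (slot y) e∈y
      ...   | i , i∈ , refl = cong₂ _xor_
              (dec-false (chosen? x (slot y i)) λ { (j , eq) →
                slot-clash y x (diff-sym-⊆ x y (∈-elements⁻ (diff x y) i∈)) eq })
              (dec-true (chosen? y (slot y i)) (i , refl))

  -- Makes the base graph drop out of the difference of two of its flips.
  xor-cancelˡ : ∀ a b c → (a xor b) xor (a xor c) ≡ b xor c
  xor-cancelˡ false b     c = refl
  xor-cancelˡ true  false c = not-involutive c
  xor-cancelˡ true  true  c = refl

  module _ {V} {H : Graph V} {n s ℓ k} (fam : EdgeFamily n (ℓ * s)) (copies : Copies fam H (2 * k)) where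

    flip : Word s ℓ → Code n → Code n
    flip x = toggle (subgraph fam (chosen x))

    encodeᴳ : GraphOn n → Code n
    encodeᴳ G = encode (adj G)

    adjᶜ-encodeᴳ : ∀ G u v → adjᶜ (encodeᴳ G) u v ≡ adj G u v
    adjᶜ-encodeᴳ G = adjᶜ-encode (adj G) (Graph.sym G) (irrefl G)

    flips-differ-by-slots : ∀ c x y {G G′} → encodeᴳ G ≡ flip x c → encodeᴳ G′ ≡ flip y c →
                            EdgesAre fam (symDiff G G′) (slots x y)
    flips-differ-by-slots c x y {G} {G′} Gx G′y =
      edgesAre-cong fam (λ u v → sym (begin
        adj G u v xor adj G′ u v                              ≡⟨ cong₂ _xor_ (value G x Gx u v) (value G′ y G′y u v) ⟩
        (adjᶜ c u v xor at x u v) xor (adjᶜ c u v xor at y u v) ≡⟨ xor-cancelˡ (adjᶜ c u v) _ _ ⟩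
        at x u v xor at y u v                                 ∎))
        (edgesAre-symDiff fam (chosen x) (chosen y) (slots x y) (slots-spec x y))
      where
      open ≡-Reasoning
      at : Word s ℓ → Fin n → Fin n → Bool
      at x = adj (subgraph fam (chosen x))
      value : ∀ G x → encodeᴳ G ≡ flip x c → ∀ u v → adj G u v ≡ adjᶜ c u v xor at x u v
      value G x eq u v = trans (sym (adjᶜ-encodeᴳ G u v))
        (trans (cong (λ d → adjᶜ d u v) eq) (adjᶜ-toggle (subgraph fam (chosen x)) c u v))

    -- At distance k the two flips of c would differ by exactly 2k edges of the family, hence by a
    -- copy of H.
    flips-in-code : 1 ≤ k → ∀ {F} → IsCode H F → ∀ c {x y} →
                    flip x c ∈ map encodeᴳ F → flip y c ∈ map encodeᴳ F → ∣ diff x y ∣ ≢ k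
    flips-in-code 1≤k {F} code c {x} {y} fx∈ fy∈ size with ∈-map⁻ encodeᴳ fx∈ | ∈-map⁻ encodeᴳ fy∈
    ... | G , G∈ , eq | G′ , G′∈ , eq′ with allPairs-lookup code G∈ G′∈
    ...   | inj₂ (inj₁ (_ , ¬copy)) = ¬copy (copies (slots-unique x y) size₂
              (flips-differ-by-slots c x y {G} {G′} (sym eq) (sym eq′)))
      where
      size₂ : length (slots x y) ≡ 2 * k
      size₂ = trans (length-slots x y) (cong (2 *_) size)
    ...   | inj₂ (inj₂ (_ , ¬copy)) = ¬copy (copies (slots-unique x y) size₂
              (edgesAre-cong fam (λ u v → xor-comm (adj G u v) (adj G′ u v))
                (flips-differ-by-slots c x y {G} {G′} (sym eq) (sym eq′))))
      where
      size₂ : length (slots x y) ≡ 2 * k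
      size₂ = trans (length-slots x y) (cong (2 *_) size)
    -- Both flips could be the same member G, but the difference of G with itself has no edge,
    -- whereas there are 2k > 0 slots.
    ...   | inj₁ refl = absurd (slots x y) (trans (length-slots x y) (cong (2 *_) size))
              (flips-differ-by-slots c x y {G} {G} (sym eq) (sym eq′))
      where
      absurd : ∀ es → length es ≡ 2 * k → EdgesAre fam (symDiff G G) es → _
      absurd [] 0≡2k _ = contradiction 0≡2k (<⇒≢ (*-mono-< {0} {2} {0} {k} (s≤s z≤n) 1≤k))
      absurd (e ∷ es) _ spec with () ← trans (sym (proj₂ (spec _ _) (here refl) (inj₁ (refl , refl)))) (xor-same (adj G _ _))

    encode-code-unique : ∀ {F} → IsCode H F → Unique (map encodeᴳ F)
    encode-code-unique code = AllPairs.map⁺ (AllPairs.map (λ { {G} {G′} ((u , v , ≢) , _) eq →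
      ≢ (trans (sym (adjᶜ-encodeᴳ G u v)) (trans (cong (λ d → adjᶜ d u v) eq) (adjᶜ-encodeᴳ G′ u v))) }) code)

    -- Double counting of the pairs (word x, member f of the code), grouped by the graph flip x f.
    length-code≤ : 1 ≤ k → k + 2 ^ k * k < ℓ → 1 ≤ s → ∀ F → IsCode H F →
                   length F * s ^ k ≤ codeConstant ℓ k * 2 ^ (n C 2)
    -- Multiplying by `s ^ (ℓ ∸ k)` turns the left side into the number of pairs and the right side
    -- into a sum of fibre bounds.
    length-code≤ 1≤k large 1≤s F code = *-cancelʳ-≤ _ _ (s ^ (ℓ ∸ k)) {{m^n≢0 s (ℓ ∸ k) {{>-nonZero 1≤s}}}} (begin
      length F * s ^ k * s ^ (ℓ ∸ k)             ≡⟨ *-assoc (length F) (s ^ k) (s ^ (ℓ ∸ k)) ⟩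
      length F * (s ^ k * s ^ (ℓ ∸ k))           ≡⟨ cong (length F *_) (sym (^-distribˡ-+-* s k (ℓ ∸ k))) ⟩
      length F * s ^ (k + (ℓ ∸ k))               ≡⟨ cong (λ e → length F * s ^ e) (m+[n∸m]≡n k≤ℓ) ⟩
      length F * s ^ ℓ                           ≡⟨ sym length-pairs ⟩
      length pairs                               ≤⟨ length-cover maps? _ (codes n) pairs (λ _ → lose (∈-codes _) refl) small ⟩
      length (codes n) * (codeConstant ℓ k * s ^ (ℓ ∸ k)) ≡⟨ cong (_* (codeConstant ℓ k * s ^ (ℓ ∸ k))) (length-codes n) ⟩
      2 ^ (n C 2) * (codeConstant ℓ k * s ^ (ℓ ∸ k))      ≡⟨ sym (*-assoc (2 ^ (n C 2)) (codeConstant ℓ k) _) ⟩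
      2 ^ (n C 2) * codeConstant ℓ k * s ^ (ℓ ∸ k)        ≡⟨ cong (_* s ^ (ℓ ∸ k)) (*-comm (2 ^ (n C 2)) _) ⟩
      codeConstant ℓ k * 2 ^ (n C 2) * s ^ (ℓ ∸ k)        ∎)
      where
      open ≤-Reasoning
      k≤ℓ : k ≤ ℓ
      k≤ℓ = <⇒≤ (≤-<-trans (m≤m+n k _) large)
      F′ = map encodeᴳ F
      words = vectors (allFin s) ℓ
      pairs = cartesianProduct F′ words
      Maps : Code n → Code n × Word s ℓ → Set
      Maps c (f , x) = flip x f ≡ c
      maps? : ∀ c fx → Dec (Maps c fx)
      maps? c (f , x) = flip x f ≟ᶜ c
      length-pairs : length pairs ≡ length F * s ^ ℓ
      length-pairs = trans (length-cartesianProductWith _,_ F′ words)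
        (cong₂ _*_ (length-map encodeᴳ F) (trans (length-vectors (allFin s) ℓ) (cong (_^ ℓ) (length-tabulate {n = s} (λ i → i)))))
      small : ∀ {c} → c ∈ codes n → length (filter (maps? c) pairs) ≤ codeConstant ℓ k * s ^ (ℓ ∸ k)
      small {c} _ = subst (_≤ codeConstant ℓ k * s ^ (ℓ ∸ k)) (length-map proj₂ fibre)
        (length-forbidden k 1≤k large (map proj₂ fibre) fibre-unique
          (λ {x} {y} x∈ y∈ → flips-in-code 1≤k code c {x} {y} (back x∈) (back y∈)))
        where
        fibre = filter (maps? c) pairs
        member : ∀ {f x} → (f , x) ∈ fibre → f ∈ F′ × flip x c ≡ f
        member {f} {x} fx∈ with ∈-filter⁻ (maps? c) {xs = pairs} fx∈
        ... | fx∈pairs , refl = proj₁ (∈-cartesianProduct⁻ F′ words fx∈pairs) , toggle-involutive (subgraph fam (chosen x)) f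
        -- Flips are involutions, so a word x leading from a member f to c leads from c back to f.
        back : ∀ {x} → x ∈ map proj₂ fibre → flip x c ∈ F′
        back x∈ with ∈-map⁻ proj₂ x∈
        ... | (f , x) , fx∈ , refl with member fx∈
        ...   | f∈ , refl = f∈
        -- Forgetting the graph loses nothing, because `f ≡ flip x c` is determined by x.
        fibre-unique : Unique (map proj₂ fibre)
        fibre-unique = map⁺-∈ proj₂
          (λ { fx∈ gy∈ refl → cong (_, _) (trans (sym (proj₂ (member fx∈))) (proj₂ (member gy∈))) })
          (filter⁺ (maps? c) (cartesianProduct⁺ (encode-code-unique code) (vectors-unique ℓ (allFin⁺ s))))

-- Upper bounds for stars and matchings.

module UpperBounds where

  open import Data.Nat
  open import Data.Nat.Properties hiding (suc-injective)
  open import Data.Nat.DivMod using (_/_; _%_; m≡m%n+[m/n]*n; m%n<n; m/n*n≤m; m≥n⇒m/n>0)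
  open import Data.Nat.Combinatorics using (_C_)
  open import Data.Nat.Tactic.RingSolver using (solve-∀)
  open import Data.Fin using (Fin; zero; suc; inject≤; _↑ˡ_; _↑ʳ_)
  open import Data.Fin.Properties using (inject≤-injective; ↑ˡ-injective; ↑ʳ-injective; splitAt-↑ˡ; splitAt-↑ʳ; suc-injective)
  open import Data.List using (length)
  open import Data.Product using (_,_)
  open import Data.Sum using (inj₁; inj₂)
  open import Relation.Nullary using (contradiction)
  open import Relation.Binary.PropositionalEquality
  open Powers
  open ForbiddenDistance
  open Copies
  open UpperBound

  starFamily : ∀ {n m} → suc m ≤ n → EdgeFamily n m
  starFamily {n} {m} m<n = record
    { src      = λ _ → inject≤ zero m<n
    ; tgt      = leaf
    ; loopless = λ e → centre≢leaf
    ; simple   = λ { (inj₁ (refl , refl)) (inj₁ (_ , eq)) → leaf-injective (sym eq)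
                   ; (inj₁ (refl , refl)) (inj₂ (eq , _)) → contradiction eq centre≢leaf
                   ; (inj₂ (refl , refl)) (inj₁ (eq , _)) → contradiction eq centre≢leaf
                   ; (inj₂ (refl , refl)) (inj₂ (_ , eq)) → leaf-injective (sym eq) }
    }
    where
    leaf : Fin m → Fin n
    leaf e = inject≤ (suc e) m<n
    leaf-injective : ∀ {e e′} → leaf e ≡ leaf e′ → e ≡ e′
    leaf-injective eq = suc-injective (inject≤-injective m<n m<n _ _ eq)
    centre≢leaf : ∀ {e} → inject≤ zero m<n ≢ leaf e
    centre≢leaf eq with () ← inject≤-injective m<n m<n _ _ eq

  module Matched {n m : ℕ} (2m≤n : m + m ≤ n) where

    left right : Fin m → Fin n
    left  e = inject≤ (e ↑ˡ m) 2m≤n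
    right e = inject≤ (m ↑ʳ e) 2m≤n

    left-injective : ∀ {e e′} → left e ≡ left e′ → e ≡ e′
    left-injective eq = ↑ˡ-injective m _ _ (inject≤-injective 2m≤n 2m≤n _ _ eq)

    right-injective : ∀ {e e′} → right e ≡ right e′ → e ≡ e′
    right-injective eq = ↑ʳ-injective m _ _ (inject≤-injective 2m≤n 2m≤n _ _ eq)

    left≢right : ∀ {e e′} → left e ≢ right e′
    left≢right {e} {e′} eq
      with () ← trans (sym (splitAt-↑ˡ m e m))
                  (trans (cong (Data.Fin.splitAt m) (inject≤-injective 2m≤n 2m≤n _ _ eq)) (splitAt-↑ʳ m m e′))

    matchingFamily : EdgeFamily n m
    matchingFamily = record
      { src      = left
      ; tgt      = right
      ; loopless = λ e → left≢right
      ; simple   = λ { (inj₁ (refl , refl)) (inj₁ (eq , _)) → left-injective (sym eq)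
                     ; (inj₁ (refl , refl)) (inj₂ (eq , _)) → contradiction eq left≢right
                     ; (inj₂ (refl , refl)) (inj₁ (eq , _)) → contradiction eq left≢right
                     ; (inj₂ (refl , refl)) (inj₂ (eq , _)) → left-injective (sym eq) }
      }

  -- The least ℓ for which the greedy choice of an independent set is guaranteed to work.
  dimension : ℕ → ℕ
  dimension k = suc (k + 2 ^ k * k)

  -- The first factor is the price of replacing s by n, from `n ≤ 4 * ℓ * s`.
  upperConstant : ℕ → ℕ
  upperConstant k = (4 * dimension k) ^ k * codeConstant (dimension k) k

  module _ {k n : ℕ} (1≤k : 1 ≤ k) (large : 2 * dimension k ≤ n) where

    private
      ℓ = dimension k
      -- The factor 2 provides the `2 * ℓ * s` ends of a matching; this is also room for a star with
      -- ℓ s leaves.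
      s = n / (2 * ℓ)

      1≤s : 1 ≤ s
      1≤s = m≥n⇒m/n>0 large

      2ℓs≤n : ℓ * s + ℓ * s ≤ n
      2ℓs≤n = ≤-trans (≤-reflexive (regroup ℓ s)) (m/n*n≤m n (2 * ℓ))
        where
        regroup : ∀ ℓ s → ℓ * s + ℓ * s ≡ s * (2 * ℓ)
        regroup = solve-∀

      ℓs<n : suc (ℓ * s) ≤ n
      ℓs<n = ≤-trans (+-monoˡ-≤ (ℓ * s) (*-mono-≤ {1} {ℓ} {1} {s} (s≤s z≤n) 1≤s)) 2ℓs≤n

      -- Rounding gives n < 2ℓ(s + 1), and s ≥ 1 absorbs the remainder.
      n≤4ℓs : n ≤ 4 * ℓ * s
      n≤4ℓs = begin
        n                         ≡⟨ m≡m%n+[m/n]*n n (2 * ℓ) ⟩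
        n % (2 * ℓ) + s * (2 * ℓ) ≤⟨ +-monoˡ-≤ (s * (2 * ℓ)) (<⇒≤ (m%n<n n (2 * ℓ))) ⟩
        2 * ℓ + s * (2 * ℓ)       ≤⟨ +-monoˡ-≤ (s * (2 * ℓ)) (m≤n*m (2 * ℓ) s {{>-nonZero 1≤s}}) ⟩
        s * (2 * ℓ) + s * (2 * ℓ) ≡⟨ regroup ℓ s ⟩
        4 * ℓ * s                 ∎
        where
        open ≤-Reasoning
        regroup : ∀ ℓ s → s * (2 * ℓ) + s * (2 * ℓ) ≡ 4 * ℓ * s
        regroup = solve-∀

    upper-bound : ∀ {V} {H : Graph V} (fam : EdgeFamily n (ℓ * s)) → Copies fam H (2 * k) →
                  ∀ F → IsCode H F → length F * n ^ k ≤ upperConstant k * 2 ^ (n C 2)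
    upper-bound {H = H} fam copies F code = begin
      length F * n ^ k                          ≤⟨ *-monoʳ-≤ (length F) (^-monoˡ-≤ k n≤4ℓs) ⟩
      length F * (4 * ℓ * s) ^ k                ≡⟨ cong (length F *_) ([m*n]^k≡m^k*n^k (4 * ℓ) s k) ⟩
      length F * ((4 * ℓ) ^ k * s ^ k)          ≡⟨ swap (length F) ((4 * ℓ) ^ k) (s ^ k) ⟩
      (4 * ℓ) ^ k * (length F * s ^ k)
        ≤⟨ *-monoʳ-≤ ((4 * ℓ) ^ k) (length-code≤ {H = H} {k = k} fam copies 1≤k ≤-refl 1≤s F code) ⟩
      (4 * ℓ) ^ k * (codeConstant ℓ k * 2 ^ (n C 2)) ≡⟨ sym (*-assoc ((4 * ℓ) ^ k) (codeConstant ℓ k) _) ⟩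
      upperConstant k * 2 ^ (n C 2)             ∎
      where
      open ≤-Reasoning
      swap : ∀ a b c → a * (b * c) ≡ b * (a * c)
      swap = solve-∀

    star-upper : ∀ F → IsCode (Star (2 * k)) F → length F * n ^ k ≤ upperConstant k * 2 ^ (n C 2)
    star-upper = upper-bound {H = Star (2 * k)} (starFamily ℓs<n) (star-copies (starFamily ℓs<n) _ (λ _ → refl) (2 * k))

    matching-upper : ∀ F → IsCode (Matching (2 * k)) F → length F * n ^ k ≤ upperConstant k * 2 ^ (n C 2)
    matching-upper = upper-bound {H = Matching (2 * k)} matchingFamily
      (matching-copies matchingFamily left-injective right-injective left≢right (2 * k))
      where open Matched {m = ℓ * s} 2ℓs≤n

-- Roots of integer polynomials modulo a prime.

module PolynomialsModPrime where

  open import Data.Nat as ℕ using (ℕ; zero; suc)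
  import Data.Nat.Properties as ℕ
  import Data.Nat.Divisibility as ℕ
  open import Data.Nat.Primality using (Prime; euclidsLemma; ¬prime[1])
  open import Data.Nat.ListAction using (product)
  open import Data.Integer using (ℤ; +_; 0ℤ; 1ℤ; _+_; _*_; -_; _-_) renaming (∣_∣ to abs)
  open import Data.Integer.Properties
  open import Data.Integer.Divisibility.Signed
  open import Data.Integer.Tactic.RingSolver using (solve-∀)
  open import Data.List using (List; []; _∷_; length; map)
  open import Data.List.Membership.Propositional using (_∈_)
  open import Data.List.Relation.Unary.All as All using (All; []; _∷_)
  open import Data.List.Relation.Unary.Any using (here; there)
  open import Data.List.Relation.Unary.AllPairs using (AllPairs; []; _∷_)
  open import Data.Product using (∃; _×_; _,_)
  open import Data.Sum using (_⊎_; inj₁; inj₂)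
  open import Relation.Nullary using (¬_; contradiction)
  open import Relation.Binary.Definitions using (tri<; tri≈; tri>)
  open import Relation.Binary.PropositionalEquality

  -- Polynomial functions in Horner form with d coefficients; keeping them as functions reduces
  -- their identities to pointwise ring identities.
  DegreeBelow : ℕ → (ℤ → ℤ) → Set
  DegreeBelow zero    f = ∀ x → f x ≡ 0ℤ
  DegreeBelow (suc d) f = ∃ λ c → ∃ λ g → DegreeBelow d g × (∀ x → f x ≡ c + x * g x)

  deg-cong : ∀ d {f g} → (∀ x → g x ≡ f x) → DegreeBelow d f → DegreeBelow d g
  deg-cong zero    g≗f f≡0                = λ x → trans (g≗f x) (f≡0 x)
  deg-cong (suc d) g≗f (c , h , deg , eq) = c , h , deg , λ x → trans (g≗f x) (eq x)

  deg-+ : ∀ d {f g} → DegreeBelow d f → DegreeBelow d g → DegreeBelow d (λ x → f x + g x)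
  deg-+ zero    f≡0 g≡0 = λ x → cong₂ _+_ (f≡0 x) (g≡0 x)
  deg-+ (suc d) (c , f′ , degf , eqf) (e , g′ , degg , eqg) =
    c + e , (λ x → f′ x + g′ x) , deg-+ d degf degg , λ x → trans (cong₂ _+_ (eqf x) (eqg x)) (regroup c e x (f′ x) (g′ x))
    where
    regroup : ∀ c e x f g → (c + x * f) + (e + x * g) ≡ (c + e) + x * (f + g)
    regroup = solve-∀

  deg-* : ∀ d a {f} → DegreeBelow d f → DegreeBelow d (λ x → a * f x)
  deg-* zero    a f≡0 = λ x → trans (cong (a *_) (f≡0 x)) (*-zeroʳ a)
  deg-* (suc d) a (c , f′ , degf , eqf) =
    a * c , (λ x → a * f′ x) , deg-* d a degf , λ x → trans (cong (a *_) (eqf x)) (regroup a c x (f′ x))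
    where
    regroup : ∀ a c x f → a * (c + x * f) ≡ a * c + x * (a * f)
    regroup = solve-∀

  deg-suc : ∀ d {f} → DegreeBelow d f → DegreeBelow (suc d) f
  deg-suc zero    f≡0 = 0ℤ , (λ _ → 0ℤ) , (λ _ → refl) , λ x → trans (f≡0 x) (sym (trans (+-identityˡ _) (*-zeroʳ x)))
  deg-suc (suc d) (c , f′ , degf , eqf) = c , f′ , deg-suc d degf , eqf

  deg-x* : ∀ d {f} → DegreeBelow d f → DegreeBelow (suc d) (λ x → x * f x)
  deg-x* d {f} degf = 0ℤ , f , degf , λ x → sym (+-identityˡ (x * f x))

  -- Division by x - r along the Horner form: if f = c + x h and h = (x - r) h′ + h(r), the quotient
  -- of f is h + r h′.
  factor : ∀ d {f} r → DegreeBelow (suc d) f → ∃ λ g → DegreeBelow d g × (∀ x → f x ≡ (x - r) * g x + f r)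
  factor zero {f} r (c , h , h≡0 , eq) = (λ _ → 0ℤ) , (λ _ → refl) , λ x →
    trans (const x) (trans (sym (const r)) (sym (trans (cong (_+ f r) (*-zeroʳ (x - r))) (+-identityˡ (f r)))))
    where
    const : ∀ x → f x ≡ c
    const x = trans (eq x) (trans (cong (λ u → c + x * u) (h≡0 x)) (trans (cong (λ u → c + u) (*-zeroʳ x)) (+-identityʳ c)))
  factor (suc d) {f} r (c , h , degh , eq) with factor d r degh
  ... | h′ , degh′ , eqh = (λ x → h x + r * h′ x) , deg-+ (suc d) degh (deg-suc d (deg-* d r degh′)) , λ x → begin
      f x                                             ≡⟨ eq x ⟩
      c + x * h x                                     ≡⟨ split c x r (h x) ⟩
      (x - r) * h x + (c + r * h x)                   ≡⟨ cong (λ u → (x - r) * h x + (c + r * u)) (eqh x) ⟩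
      (x - r) * h x + (c + r * ((x - r) * h′ x + h r)) ≡⟨ merge c x r (h x) (h′ x) (h r) ⟩
      (x - r) * (h x + r * h′ x) + (c + r * h r)      ≡⟨ cong (λ u → (x - r) * (h x + r * h′ x) + u) (sym (eq r)) ⟩
      (x - r) * (h x + r * h′ x) + f r                ∎
    where
    open ≡-Reasoning
    split : ∀ c x r y → c + x * y ≡ (x - r) * y + (c + r * y)
    split = solve-∀
    merge : ∀ c x r y z w → (x - r) * y + (c + r * ((x - r) * z + w)) ≡ (x - r) * (y + r * z) + (c + r * w)
    merge = solve-∀

  prime∣*⇒∣⊎∣ : ∀ {p} → Prime p → ∀ i j → + p ∣ i * j → + p ∣ i ⊎ + p ∣ j
  prime∣*⇒∣⊎∣ {p} pp i j p∣ with euclidsLemma (abs i) (abs j) pp (subst (p ℕ.∣_) (abs-* i j) (∣⇒∣ᵤ p∣))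
  ... | inj₁ p∣i = inj₁ (∣ᵤ⇒∣ p∣i)
  ... | inj₂ p∣j = inj₂ (∣ᵤ⇒∣ p∣j)

  -- Lagrange's theorem modulo p. After the root r is split off, another root r′ gives p ∣ (r′ - r)
  -- g(r′) with p not dividing r′ - r, so r′ is a root of the quotient g.
  vanish : ∀ {p} → Prime p → ∀ {f} rs → DegreeBelow (length rs) f →
           AllPairs (λ r r′ → ¬ + p ∣ r′ - r) rs → All (λ r → + p ∣ f r) rs → ∀ x → + p ∣ f x
  vanish pp [] f≡0 [] [] x = subst (_ ∣_) (sym (f≡0 x)) (divides 0ℤ refl)
  vanish {p} pp {f} (r ∷ rs) deg (r≢ ∷ distinct) (p∣fr ∷ roots) x with factor (length rs) r deg
  ... | g , degg , eq = subst (+ p ∣_) (sym (eq x)) (∣m∣n⇒∣m+n (∣n⇒∣m*n (x - r) (vanish pp rs degg distinct roots′ x)) p∣fr)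
    where
    roots′ : All (λ r′ → + p ∣ g r′) rs
    roots′ = All.tabulate λ {r′} r′∈ → root (All.lookup r≢ r′∈) (All.lookup roots r′∈)
      where
      root : ∀ {r′} → ¬ + p ∣ r′ - r → + p ∣ f r′ → + p ∣ g r′
      root {r′} p∤ p∣fr′ with prime∣*⇒∣⊎∣ pp (r′ - r) (g r′) (∣m+n∣n⇒∣m (subst (+ p ∣_) (eq r′) p∣fr′) p∣fr)
      ... | inj₁ p∣r′-r = contradiction p∣r′-r p∤
      ... | inj₂ p∣gr′  = p∣gr′

  shiftedProduct : List ℕ → ℤ → ℤ
  shiftedProduct []       x = 1ℤ
  shiftedProduct (a ∷ as) x = (x + + a) * shiftedProduct as x

  shiftedProduct-pos : ∀ as j → shiftedProduct as (+ j) ≡ + product (map (j ℕ.+_) as)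
  shiftedProduct-pos []       j = refl
  shiftedProduct-pos (a ∷ as) j = trans (cong₂ _*_ (sym (pos-+ j a)) (shiftedProduct-pos as j)) (sym (pos-* (j ℕ.+ a) _))

  power : ℕ → ℤ → ℤ
  power zero    x = 1ℤ
  power (suc d) x = x * power d x

  deg-power : ∀ d → DegreeBelow (suc d) (power d)
  deg-power zero    = 1ℤ , (λ _ → 0ℤ) , (λ _ → refl) , λ x → sym (trans (cong (λ u → 1ℤ + u) (*-zeroʳ x)) (+-identityʳ 1ℤ))
  deg-power (suc d) = deg-x* (suc d) (deg-power d)

  shiftedProduct-monic : ∀ as → ∃ λ q → DegreeBelow (length as) q ×
                         (∀ x → shiftedProduct as x ≡ power (length as) x + q x)
  shiftedProduct-monic [] = (λ _ → 0ℤ) , (λ _ → refl) , λ x → sym (+-identityʳ 1ℤ)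
  shiftedProduct-monic (a ∷ as) with shiftedProduct-monic as
  ... | q , degq , eq = (λ x → x * q x + + a * (power d x + q x)) ,
      deg-+ (suc d) (deg-x* d degq) (deg-* (suc d) (+ a) (deg-+ (suc d) (deg-power d) (deg-suc d degq))) ,
      λ x → trans (cong ((x + + a) *_) (eq x)) (regroup x (+ a) (power d x) (q x))
    where
    d = length as
    regroup : ∀ x a y z → (x + a) * (y + z) ≡ x * y + (x * z + a * (y + z))
    regroup = solve-∀

  -- Both products are monic of the same degree, so the leading powers cancel.
  deg-difference : ∀ as bs → length as ≡ length bs →
                   DegreeBelow (length as) (λ x → shiftedProduct as x - shiftedProduct bs x)
  deg-difference as bs len with shiftedProduct-monic as | shiftedProduct-monic bs
  ... | q , degq , eq | r , degr , eq′ = deg-cong (length as)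
      (λ x → trans (cong₂ _-_ (eq x) (trans (eq′ x) (cong (λ d → power d x + r x) (sym len)))) (cancel (power (length as) x) (q x) (r x)))
      (deg-+ (length as) degq (deg-* (length as) (- 1ℤ) (subst (λ d → DegreeBelow d r) (sym len) degr)))
    where
    cancel : ∀ y q r → (y + q) - (y + r) ≡ q + - 1ℤ * r
    cancel = solve-∀

  range : ℕ → List ℤ
  range zero    = []
  range (suc d) = + d ∷ range d

  length-range : ∀ d → length (range d) ≡ d
  length-range zero    = refl
  length-range (suc d) = cong suc (length-range d)

  ∈-range⁻ : ∀ d {r} → r ∈ range d → ∃ λ j → j ℕ.< d × r ≡ + j
  ∈-range⁻ (suc d) (here refl) = d , ℕ.≤-refl , refl
  ∈-range⁻ (suc d) (there r∈) with ∈-range⁻ d r∈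
  ... | j , j<d , eq = j , ℕ.m≤n⇒m≤1+n j<d , eq

  ∤-difference : ∀ {p m n} → m ℕ.< n → n ℕ.< p → ¬ + p ∣ + m - + n
  ∤-difference {p} {m} {n} m<n n<p p∣ = ℕ.n≮n p (begin-strict
    p           ≤⟨ ℕ.∣⇒≤ {{ℕ.>-nonZero (ℕ.m<n⇒0<n∸m m<n)}} (subst (p ℕ.∣_) ∣m-n∣≡ (∣⇒∣ᵤ p∣)) ⟩
    n ℕ.∸ m     ≤⟨ ℕ.m∸n≤m n m ⟩
    n           <⟨ n<p ⟩
    p           ∎)
    where
    open ℕ.≤-Reasoning
    ∣m-n∣≡ : abs (+ m - + n) ≡ n ℕ.∸ m
    ∣m-n∣≡ = trans (cong abs (trans (m-n≡m⊖n m n) (⊖-≤ (ℕ.<⇒≤ m<n)))) (∣-i∣≡∣i∣ (+ (n ℕ.∸ m)))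

  range-distinct : ∀ {p} d → d ℕ.≤ p → AllPairs (λ r r′ → ¬ + p ∣ r′ - r) (range d)
  range-distinct zero    _   = []
  range-distinct (suc d) d<p = All.tabulate separated ∷ range-distinct d (ℕ.<⇒≤ d<p)
    where
    separated : ∀ {r} → r ∈ range d → ¬ _ ∣ r - + d
    separated r∈ with ∈-range⁻ d r∈
    ... | j , j<d , refl = ∤-difference j<d d<p

  shiftedProduct-root : ∀ {as a} → a ∈ as → shiftedProduct as (- + a) ≡ 0ℤ
  shiftedProduct-root {a ∷ as} (here refl) = cong (_* shiftedProduct as (- + a)) (+-inverseˡ (+ a))
  shiftedProduct-root {b ∷ as} {a} (there a∈) =
    trans (cong ((- + a + + b) *_) (shiftedProduct-root a∈)) (*-zeroʳ (- + a + + b))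

  prime∣shiftedProduct : ∀ {p} → Prime p → ∀ bs x → + p ∣ shiftedProduct bs x → ∃ λ b → b ∈ bs × + p ∣ x + + b
  prime∣shiftedProduct pp [] x p∣1 = contradiction (subst Prime (ℕ.∣1⇒≡1 (∣⇒∣ᵤ p∣1)) pp) ¬prime[1]
  prime∣shiftedProduct pp (b ∷ bs) x p∣ with prime∣*⇒∣⊎∣ pp (x + + b) (shiftedProduct bs x) p∣
  ... | inj₁ p∣x+b = b , here refl , p∣x+b
  ... | inj₂ p∣bs with prime∣shiftedProduct pp bs x p∣bs
  ...   | c , c∈ , p∣x+c = c , there c∈ , p∣x+c

  -- The difference of the two monic polynomials has degree below d = length as and d roots
  -- modulo p, so it vanishes modulo p at - a.
  products-agree⇒common : ∀ {p} → Prime p → ∀ as bs → length as ≡ length bs → length as ℕ.≤ p →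
    (∀ j → j ℕ.< length as → + p ∣ + product (map (j ℕ.+_) as) - + product (map (j ℕ.+_) bs)) →
    All (ℕ._< p) as → All (ℕ._< p) bs →
    ∀ {a} → a ∈ as → a ∈ bs
  products-agree⇒common {p} pp as bs len d≤p agree as<p bs<p {a} a∈ = locate (prime∣shiftedProduct pp bs (- + a) p∣bs)
    where
    p∣diff : + p ∣ shiftedProduct as (- + a) - shiftedProduct bs (- + a)
    p∣diff = vanish pp (range (length as))
      (subst (λ d → DegreeBelow d (λ x → shiftedProduct as x - shiftedProduct bs x)) (sym (length-range (length as))) (deg-difference as bs len))
      (range-distinct (length as) d≤p) (All.tabulate roots) (- + a)
      where
      roots : ∀ {r} → r ∈ range (length as) → + p ∣ shiftedProduct as r - shiftedProduct bs r
      roots r∈ with ∈-range⁻ (length as) r∈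
      ... | j , j<d , refl = subst (+ p ∣_)
            (sym (cong₂ _-_ (shiftedProduct-pos as j) (shiftedProduct-pos bs j))) (agree j j<d)
    p∣bs : + p ∣ shiftedProduct bs (- + a)
    p∣bs = subst (+ p ∣_) (neg-involutive _) (∣m⇒∣-m (subst (+ p ∣_)
      (trans (cong (_- shiftedProduct bs (- + a)) (shiftedProduct-root a∈)) (+-identityˡ _)) p∣diff))
    -- Both a and b lie below p, so p can divide their difference only if they coincide.
    locate : (∃ λ b → b ∈ bs × + p ∣ - + a + + b) → a ∈ bs
    locate (b , b∈ , p∣b-a) with ℕ.<-cmp a b
    ... | tri≈ _ refl _ = b∈
    ... | tri> _ _ b<a  = contradiction (subst (+ p ∣_) (+-comm (- + a) (+ b)) p∣b-a) (∤-difference b<a (All.lookup as<p a∈))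
    ... | tri< a<b _ _  = contradiction
          (subst (+ p ∣_) (trans (neg-distrib-+ (- + a) (+ b)) (cong (_- + b) (neg-involutive (+ a)))) (∣m⇒∣-m p∣b-a))
          (∤-difference a<b (All.lookup bs<p b∈))

-- Graph invariants that exclude forbidden differences.

module Syndromes where

  open import Data.Nat as ℕ using (ℕ; zero; suc; _+_; _*_; _^_; _≤_; _<_; NonZero; s≤s; z≤n)
  import Data.Nat.Properties as ℕ
  import Data.Nat.Divisibility as ℕ
  open import Data.Nat.DivMod using (_/_; _%_; m≡m%n+[m/n]*n)
  open import Data.Nat.ListAction using (product)
  open import Data.Nat.Primality using (Prime; euclidsLemma; ¬prime[1]; prime⇒nonZero)
  open import Data.Nat.Tactic.RingSolver using (solve-∀)
  import Data.Integer.Tactic.RingSolver as ℤ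
  open import Data.Integer as ℤ using (+_)
  open import Data.Integer.Properties using (pos-+; pos-*)
  open import Data.Integer.Divisibility.Signed
  open import Data.Bool using (Bool; true; false; _xor_; _∧_; not; T)
  open import Data.Bool.Properties using (T?)
  open import Data.List using (List; []; _∷_; length; map; filterᵇ)
  open import Data.List.Properties using (length-map)
  open import Data.List.Membership.Propositional using (_∈_)
  open import Data.List.Membership.Propositional.Properties using (∈-filter⁻; ∈-filter⁺; ∈-map⁺; ∈-map⁻)
  open import Data.List.Relation.Unary.All as All using ([]; _∷_)
  import Data.List.Relation.Unary.All.Properties as All
  open import Data.List.Relation.Unary.Any using (here; there)
  open import Data.Product using (∃; _×_; _,_; proj₁; proj₂)
  open import Data.Sum using (inj₁; inj₂; [_,_]′)
  open import Data.Empty using (⊥)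
  open import Function using (_∘_)
  open import Relation.Binary.Definitions using (tri<; tri≈; tri>)
  open import Relation.Nullary using (¬_; contradiction)
  open import Relation.Binary.PropositionalEquality
  open PolynomialsModPrime

  module _ {E : Set} where

    infixl 5 _∖_
    _∖_ : (E → Bool) → (E → Bool) → E → Bool
    (G ∖ G′) e = G e ∧ not (G′ e)

    -- Both sides count the edges of G ∪ G′.
    exchange-length : ∀ G G′ es → length (filterᵇ G es) + length (filterᵇ (G′ ∖ G) es) ≡
                                  length (filterᵇ G′ es) + length (filterᵇ (G ∖ G′) es)
    exchange-length G G′ [] = refl
    exchange-length G G′ (e ∷ es) with G e | G′ e
    ... | true  | true  = cong suc (exchange-length G G′ es)
    ... | true  | false = trans (cong suc (exchange-length G G′ es)) (sym (ℕ.+-suc _ _))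
    ... | false | true  = trans (ℕ.+-suc _ _) (cong suc (exchange-length G G′ es))
    ... | false | false = exchange-length G G′ es

    selectedProduct : (E → ℕ) → (E → Bool) → List E → ℕ
    selectedProduct φ G es = product (map φ (filterᵇ G es))

    -- Both sides multiply over G ∪ G′. This turns congruent products over the whole graphs into
    -- congruent products over the two halves of their difference.
    exchange-product : ∀ φ G G′ es →
      selectedProduct φ G es * selectedProduct φ (G′ ∖ G) es ≡ selectedProduct φ G′ es * selectedProduct φ (G ∖ G′) es
    exchange-product φ G G′ [] = refl
    exchange-product φ G G′ (e ∷ es) = step (selectedProduct φ G es) (selectedProduct φ (G′ ∖ G) es)
      (selectedProduct φ G′ es) (selectedProduct φ (G ∖ G′) es) refl refl refl refl (exchange-product φ G G′ es)
      where
      swap : ∀ a b c → a * (b * c) ≡ b * (a * c)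
      swap = solve-∀
      step : ∀ x y z w → x ≡ selectedProduct φ G es → y ≡ selectedProduct φ (G′ ∖ G) es →
        z ≡ selectedProduct φ G′ es → w ≡ selectedProduct φ (G ∖ G′) es → x * y ≡ z * w →
        selectedProduct φ G (e ∷ es) * selectedProduct φ (G′ ∖ G) (e ∷ es) ≡
        selectedProduct φ G′ (e ∷ es) * selectedProduct φ (G ∖ G′) (e ∷ es)
      step x y z w refl refl refl refl ih with G e | G′ e
      ... | true  | true  = trans (ℕ.*-assoc (φ e) x y) (trans (cong (φ e *_) ih) (sym (ℕ.*-assoc (φ e) z w)))
      ... | true  | false = trans (ℕ.*-assoc (φ e) x y) (trans (cong (φ e *_) ih) (swap (φ e) z w))
      ... | false | true  = trans (swap x (φ e) y) (trans (cong (φ e *_) ih) (sym (ℕ.*-assoc (φ e) z w)))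
      ... | false | false = ih

    length-xor : ∀ G G′ es → length (filterᵇ (G ∖ G′) es) + length (filterᵇ (G′ ∖ G) es) ≡
                             length (filterᵇ (λ e → G e xor G′ e) es)
    length-xor G G′ [] = refl
    length-xor G G′ (e ∷ es) with G e | G′ e
    ... | true  | true  = length-xor G G′ es
    ... | true  | false = cong suc (length-xor G G′ es)
    ... | false | true  = trans (ℕ.+-suc _ _) (cong suc (length-xor G G′ es))
    ... | false | false = length-xor G G′ es

    product-factor : ∀ (φ μ : E → ℕ) C j es → (∀ {e} → e ∈ es → φ e ≡ C * (j + μ e)) →
                     product (map φ es) ≡ C ^ length es * product (map (j ℕ.+_) (map μ es))
    product-factor φ μ C j []       _  = refl
    product-factor φ μ C j (e ∷ es) eq =
      trans (cong₂ _*_ (eq (here refl)) (product-factor φ μ C j es (λ e∈ → eq (there e∈))))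
            (regroup C (j + μ e) (C ^ length es) _)
      where
      regroup : ∀ c x d y → c * x * (d * y) ≡ c * d * (x * y)
      regroup = solve-∀

    prime∤product : ∀ {p} → Prime p → ∀ (φ : E → ℕ) es → (∀ {e} → e ∈ es → ¬ p ℕ.∣ φ e) →
                    ¬ p ℕ.∣ product (map φ es)
    prime∤product pp φ []       _ p∣1 = ¬prime[1] (subst Prime (ℕ.∣1⇒≡1 p∣1) pp)
    prime∤product pp φ (e ∷ es) ∤ p∣ with euclidsLemma (φ e) _ pp p∣
    ... | inj₁ p∣φe = ∤ (here refl) p∣φe
    ... | inj₂ p∣es = prime∤product pp φ es (λ e∈ → ∤ (there e∈)) p∣es

  head∈ : ∀ {A : Set} {xs : List A} → 1 ≤ length xs → ∃ λ x → x ∈ xs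
  head∈ {xs = x ∷ xs} _ = x , here refl

  prime∤^ : ∀ {p} → Prime p → ∀ c h → ¬ p ℕ.∣ c → ¬ p ℕ.∣ c ^ h
  prime∤^ pp c zero    _   p∣1 = ¬prime[1] (subst Prime (ℕ.∣1⇒≡1 p∣1) pp)
  prime∤^ pp c (suc h) p∤c p∣ with euclidsLemma c (c ^ h) pp p∣
  ... | inj₁ p∣c  = p∤c p∣c
  ... | inj₂ p∣c^ = prime∤^ pp c h p∤c p∣c^

  %≡⇒∣ : ∀ {q} .{{_ : NonZero q}} a b → a % q ≡ b % q → + q ∣ + a ℤ.- + b
  %≡⇒∣ {q} a b eq = divides (+ (a / q) ℤ.- + (b / q)) (trans
    (cong₂ ℤ._-_ (expand a) (trans (expand b) (cong (λ r → + r ℤ.+ + (b / q) ℤ.* + q) (sym eq))))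
    (cancel (+ (a % q)) (+ (a / q)) (+ (b / q)) (+ q)))
    where
    expand : ∀ m → + m ≡ + (m % q) ℤ.+ + (m / q) ℤ.* + q
    expand m = trans (cong +_ (m≡m%n+[m/n]*n m q)) (trans (pos-+ (m % q) _) (cong (λ u → + (m % q) ℤ.+ u) (pos-* (m / q) q)))
    cancel : ∀ r x y q → (r ℤ.+ x ℤ.* q) ℤ.- (r ℤ.+ y ℤ.* q) ≡ (x ℤ.- y) ℤ.* q
    cancel = ℤ.solve-∀

  +-exchange : ∀ a a′ {b c} → a + b ≡ a′ + c → + a ℤ.- + a′ ≡ + c ℤ.- + b
  +-exchange a a′ {b} {c} sum = trans (add (+ a) (+ a′) (+ b)) (trans
    (cong (λ u → u ℤ.- + a′ ℤ.- + b) (trans (sym (pos-+ a b)) (trans (cong +_ sum) (pos-+ a′ c))))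
    (drop (+ a′) (+ b) (+ c)))
    where
    add : ∀ x y b → x ℤ.- y ≡ (x ℤ.+ b) ℤ.- y ℤ.- b
    add = ℤ.solve-∀
    drop : ∀ y b c → (y ℤ.+ c) ℤ.- y ℤ.- b ≡ c ℤ.- b
    drop = ℤ.solve-∀

  -- The sum gives a - a′ = c - b, so q divides the difference of two numbers below q.
  mod-cancel : ∀ {q} .{{_ : NonZero q}} a a′ {b c} → a % q ≡ a′ % q → a + b ≡ a′ + c → b < q → c < q → b ≡ c
  mod-cancel {q} a a′ {b} {c} eq sum b<q c<q with ℕ.<-cmp b c
  ... | tri≈ _ b≡c _ = b≡c
  ... | tri< b<c _ _ = contradiction (subst (+ q ∣_) (+-exchange a′ a (sym sum)) (%≡⇒∣ a′ a (sym eq))) (∤-difference b<c c<q)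
  ... | tri> _ _ c<b = contradiction (subst (+ q ∣_) (+-exchange a a′ sum) (%≡⇒∣ a a′ eq)) (∤-difference c<b b<q)

  -- Since (u - u′) x = u x - u y = u (x - y), the prime divides u or x - y.
  cancel-unit : ∀ {p} → Prime p → ∀ u u′ x y → ¬ p ℕ.∣ u → + p ∣ + u ℤ.- + u′ → u * y ≡ u′ * x → + p ∣ + x ℤ.- + y
  cancel-unit {p} pp u u′ x y p∤u p∣ eq =
    [ (λ p∣u → contradiction (∣⇒∣ᵤ p∣u) p∤u) , (λ p∣x-y → p∣x-y) ]′
    (prime∣*⇒∣⊎∣ pp (+ u) (+ x ℤ.- + y) (subst (+ p ∣_) identity (∣m⇒∣m*n (+ x) p∣)))
    where
    expand : ∀ u v x → (u ℤ.- v) ℤ.* x ≡ u ℤ.* x ℤ.- v ℤ.* x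
    expand = ℤ.solve-∀
    collect : ∀ u x y → u ℤ.* x ℤ.- u ℤ.* y ≡ u ℤ.* (x ℤ.- y)
    collect = ℤ.solve-∀
    identity : (+ u ℤ.- + u′) ℤ.* + x ≡ + u ℤ.* (+ x ℤ.- + y)
    identity = trans (expand (+ u) (+ u′) (+ x)) (trans
      (cong (λ v → + u ℤ.* + x ℤ.- v) (trans (sym (pos-* u′ x)) (trans (cong +_ (sym eq)) (pos-* u y))))
      (collect (+ u) (+ x) (+ y)))

  -- On a forbidden difference P the value of an edge splits into a factor shared by all of P and a
  -- factor identifying the edge. The shared one may depend on P; being a unit modulo p for j < k,
  -- it can be cancelled.
  record Labelling {E : Set} (p k : ℕ) (φ : ℕ → E → ℕ) (P : List E) : Set where
    field
      scale     : ℕ → ℕ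
      label     : E → ℕ
      scale∤   : ∀ {j} → j < k → ¬ p ℕ.∣ scale j
      splits    : ∀ j {e} → e ∈ P → φ j e ≡ scale j * (j + label e)
      label<p   : ∀ e → label e < p
      injective : ∀ {e e′} → e ∈ P → e′ ∈ P → label e ≡ label e′ → e ≡ e′

  module _ {E : Set} {p k : ℕ} (pp : Prime p) (k≤p : k ≤ p) (φ : ℕ → E → ℕ) (es : List E)
           (φ∤ : ∀ {j} → j < k → ∀ {e} → e ∈ es → ¬ p ℕ.∣ φ j e) where

    private
      instance
        p≢0 : NonZero p
        p≢0 = prime⇒nonZero pp

    edgeCount : (E → Bool) → ℕ
    edgeCount G = length (filterᵇ G es)

    syndrome : ℕ → (E → Bool) → ℕ
    syndrome j G = selectedProduct (φ j) G es

    -- The two halves of the difference have equally many labels, h ≤ k, and equal products of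
    -- the values j + label at h points j, so they share a label.
    syndromes-separate : ∀ G G′ → edgeCount G % suc (2 * k) ≡ edgeCount G′ % suc (2 * k) →
      (∀ {j} → j < k → syndrome j G % p ≡ syndrome j G′ % p) →
      let P = filterᵇ (λ e → G e xor G′ e) es in
      1 ≤ length P → length P ≤ 2 * k → Labelling p k φ P → ⊥
    syndromes-separate G G′ count≡ syndrome≡ 1≤P P≤2k lab = meet (head∈ 1≤A)
      where
      open Labelling lab
      P = filterᵇ (λ e → G e xor G′ e) es
      A = filterᵇ (G ∖ G′) es
      B = filterᵇ (G′ ∖ G) es

      A+B≡P : length A + length B ≡ length P
      A+B≡P = length-xor G G′ es

      A≡B : length A ≡ length B
      A≡B = sym (mod-cancel (edgeCount G) (edgeCount G′) count≡ (exchange-length G G′ es)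
        (s≤s (ℕ.≤-trans (ℕ.m≤n+m (length B) (length A)) (ℕ.≤-trans (ℕ.≤-reflexive A+B≡P) P≤2k)))
        (s≤s (ℕ.≤-trans (ℕ.m≤m+n (length A) (length B)) (ℕ.≤-trans (ℕ.≤-reflexive A+B≡P) P≤2k))))

      A≤k : length A ≤ k
      A≤k = ℕ.*-cancelˡ-≤ 2 (ℕ.≤-trans (ℕ.≤-reflexive (trans (cong (length A ℕ.+_) (trans (ℕ.+-identityʳ _) A≡B)) A+B≡P)) P≤2k)

      1≤A : 1 ≤ length A
      1≤A with length A | length B | A≡B | A+B≡P
      ... | zero  | .zero | refl | 0≡P = subst (1 ≤_) (sym 0≡P) 1≤P
      ... | suc _ | _     | _    | _   = s≤s z≤n

      A⇒ : ∀ {e} → e ∈ A → e ∈ P × T (G e)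
      A⇒ {e} e∈ with ∈-filter⁻ (T? ∘ (G ∖ G′)) {xs = es} e∈
      ... | e∈es , GG′ = ∈-filter⁺ (T? ∘ λ e → G e xor G′ e) e∈es (weaken (G e) (G′ e) GG′) , left (G e) (G′ e) GG′
        where
        weaken : ∀ a b → T (a ∧ not b) → T (a xor b)
        weaken true false _ = _
        left : ∀ a b → T (a ∧ not b) → T a
        left true false _ = _

      B⇒ : ∀ {e} → e ∈ B → e ∈ P × ¬ T (G e)
      B⇒ {e} e∈ with ∈-filter⁻ (T? ∘ (G′ ∖ G)) {xs = es} e∈
      ... | e∈es , G′G = ∈-filter⁺ (T? ∘ λ e → G e xor G′ e) e∈es (weaken (G e) (G′ e) G′G) , right (G e) (G′ e) G′G
        where
        weaken : ∀ a b → T (b ∧ not a) → T (a xor b)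
        weaken false true _ = _
        right : ∀ a b → T (b ∧ not a) → ¬ T a
        right false true _ ()

      agree : ∀ j → j < k → + p ∣ + product (map (j ℕ.+_) (map label A)) ℤ.- + product (map (j ℕ.+_) (map label B))
      -- The cancelled unit combines the syndrome of the whole graph with the shared factors; as
      -- both halves have equal length, they carry the same power of `scale j`.
      agree j j<k = cancel-unit pp (syndrome j G * scale j ^ length A) (syndrome j G′ * scale j ^ length A)
          (product (map (j ℕ.+_) (map label A))) (product (map (j ℕ.+_) (map label B)))
          p∤unit (subst (+ p ∣_) (distribute (syndrome j G) (syndrome j G′) (scale j ^ length A)) (∣m⇒∣m*n (+ (scale j ^ length A)) (%≡⇒∣ (syndrome j G) (syndrome j G′) (syndrome≡ j<k)))) (begin
        syndrome j G * scale j ^ length A * product (map (j ℕ.+_) (map label B))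
          ≡⟨ ℕ.*-assoc (syndrome j G) _ _ ⟩
        syndrome j G * (scale j ^ length A * product (map (j ℕ.+_) (map label B)))
          ≡⟨ cong (λ h → syndrome j G * (scale j ^ h * product (map (j ℕ.+_) (map label B)))) A≡B ⟩
        syndrome j G * (scale j ^ length B * product (map (j ℕ.+_) (map label B)))
          ≡⟨ cong (syndrome j G *_) (sym (product-factor (φ j) label (scale j) j B (λ e∈ → splits j (proj₁ (B⇒ e∈))))) ⟩
        syndrome j G * product (map (φ j) B)
          ≡⟨ exchange-product (φ j) G G′ es ⟩
        syndrome j G′ * product (map (φ j) A)
          ≡⟨ cong (syndrome j G′ *_) (product-factor (φ j) label (scale j) j A (λ e∈ → splits j (proj₁ (A⇒ e∈)))) ⟩
        syndrome j G′ * (scale j ^ length A * product (map (j ℕ.+_) (map label A)))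
          ≡⟨ sym (ℕ.*-assoc (syndrome j G′) _ _) ⟩
        syndrome j G′ * scale j ^ length A * product (map (j ℕ.+_) (map label A)) ∎)
        where
        open ≡-Reasoning
        p∤unit : ¬ p ℕ.∣ syndrome j G * scale j ^ length A
        p∤unit p∣ with euclidsLemma (syndrome j G) _ pp p∣
        ... | inj₁ p∣S = prime∤product pp (φ j) (filterᵇ G es) (λ e∈ → φ∤ j<k (proj₁ (∈-filter⁻ (T? ∘ G) e∈))) p∣S
        ... | inj₂ p∣C = prime∤^ pp (scale j) (length A) (scale∤ j<k) p∣C
        expand : ∀ x y z → (x ℤ.- y) ℤ.* z ≡ x ℤ.* z ℤ.- y ℤ.* z
        expand = ℤ.solve-∀
        distribute : ∀ x y z → (+ x ℤ.- + y) ℤ.* + z ≡ + (x * z) ℤ.- + (y * z)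
        distribute x y z = trans (expand (+ x) (+ y) (+ z)) (cong₂ ℤ._-_ (sym (pos-* x z)) (sym (pos-* y z)))

      common : ∀ {a} → a ∈ map label A → a ∈ map label B
      common = products-agree⇒common pp (map label A) (map label B)
        (trans (length-map label A) (trans A≡B (sym (length-map label B))))
        (subst (_≤ p) (sym (length-map label A)) (ℕ.≤-trans A≤k k≤p))
        (λ j j<A → agree j (ℕ.<-≤-trans (subst (j <_) (length-map label A) j<A) A≤k))
        (All.map⁺ (All.tabulate λ {e} _ → label<p e)) (All.map⁺ (All.tabulate λ {e} _ → label<p e))

      meet : (∃ λ e → e ∈ A) → ⊥
      meet (e , e∈A) = clash (∈-map⁻ label (common (∈-map⁺ label e∈A)))
        where
        clash : (∃ λ e′ → e′ ∈ B × label e ≡ label e′) → ⊥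
        clash (e′ , e′∈B , eq) =
          proj₂ (B⇒ e′∈B) (subst (T ∘ G) (injective (proj₁ (A⇒ e∈A)) (proj₁ (B⇒ e′∈B)) eq) (proj₂ (A⇒ e∈A)))

-- Codes by pigeonhole on the syndromes.

module LowerBound where

  open import Data.Nat hiding (_≟_; _<?_; <-cmp)
  open import Data.Nat.Properties hiding (_≟_; _<?_; <-cmp)
  open import Data.Nat.Divisibility using (_∣_; ∣⇒≤; ∣1⇒≡1)
  open import Data.Nat.DivMod using (_%_; _mod_; m%n<n)
  open import Data.Nat.Combinatorics using (_C_)
  open import Data.Nat.Primality using (Prime; euclidsLemma; ¬prime[1]; prime⇒nonZero)
  open import Data.Bool using (Bool; true; false; _∧_)
  open import Data.Bool.Properties using (T-≡; T?)
  open import Data.Fin as Fin using (Fin; toℕ; fromℕ<; _≟_; _<?_)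
  open import Data.Fin.Properties using (toℕ-fromℕ<; toℕ-injective; toℕ<n; <-cmp)
  open import Data.List using (List; []; _∷_; length; map; filter; filterᵇ; allFin; upTo; cartesianProduct)
  open import Data.List.Properties using (length-map; length-upTo; length-tabulate)
  open import Data.List.Extrema.Nat using (argmax; f[xs]≤f[argmax])
  open import Data.List.Membership.Propositional using (_∈_; lose)
  open import Data.List.Membership.Propositional.Properties
  open import Data.List.Relation.Unary.All as All using (All; []; _∷_)
  import Data.List.Relation.Unary.All.Properties as All
  import Data.List.Relation.Unary.AllPairs.Properties as AllPairs
  open import Data.List.Relation.Unary.Unique.Propositional using (Unique)
  open import Data.List.Relation.Unary.Unique.Propositional.Properties using (filter⁺; cartesianProduct⁺; allFin⁺)
  open import Data.Product using (Σ; ∃; _×_; _,_; proj₁; proj₂)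
  open import Data.Sum using (_⊎_; inj₁; inj₂; [_,_]′)
  open import Function using (_∘_)
  open import Function.Bundles using (Equivalence)
  open import Relation.Binary.Definitions using (tri<; tri≈; tri>)
  open import Relation.Nullary using (¬_; Dec; yes; no; contradiction)
  open import Relation.Binary.PropositionalEquality
  open ListCounting
  open ListUniqueness
  open GraphCodes
  open Syndromes

  -- The largest fibre of f contains at least the average share of xs.
  popular-value : ∀ {A : Set} {q} (f : A → Fin q) xs → ∃ λ ys →
    length xs ≤ q * length ys × (∀ {x} → x ∈ ys → x ∈ xs) × (Unique xs → Unique ys) ×
    (∀ {x y} → x ∈ ys → y ∈ ys → f x ≡ f y)
  popular-value f [] = [] , z≤n , (λ x∈ → x∈) , (λ u → u) , λ ()
  popular-value {q = q} f xs@(x ∷ _) = fibre v ,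
      subst (λ m → length xs ≤ m * length (fibre v)) (length-tabulate {n = q} (λ i → i))
        (length-cover at? (length (fibre v)) (allFin q) xs (λ {y} _ → lose (∈-allFin (f y)) refl)
          (All.lookup (f[xs]≤f[argmax] {f = length ∘ fibre} (f x) (allFin q)))) ,
      (λ y∈ → proj₁ (∈-filter⁻ (at? v) y∈)) , filter⁺ (at? v) ,
      λ y∈ z∈ → trans (proj₂ (∈-filter⁻ (at? v) {xs = xs} y∈)) (sym (proj₂ (∈-filter⁻ (at? v) {xs = xs} z∈)))
    where
    at? : ∀ v y → Dec (f y ≡ v)
    at? v y = f y ≟ v
    fibre : Fin q → List _
    fibre v = filter (at? v) xs
    -- `argmax` needs a default. The element x supplies one, which is why the empty list is treated
    -- apart, where `Fin q` may be empty.
    v = argmax (length ∘ fibre) (f x) (allFin q)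

  popular-values : ∀ {A : Set} {q} (fs : List (A → Fin q)) xs → ∃ λ ys →
    length xs ≤ q ^ length fs * length ys × (∀ {x} → x ∈ ys → x ∈ xs) × (Unique xs → Unique ys) ×
    (∀ {x y} → x ∈ ys → y ∈ ys → All (λ f → f x ≡ f y) fs)
  popular-values [] xs = xs , ≤-reflexive (sym (*-identityˡ _)) , (λ x∈ → x∈) , (λ u → u) , λ _ _ → []
  popular-values {q = q} (f ∷ fs) xs with popular-value f xs
  ... | ys , xs≤ys , ys⊆xs , uniq , same with popular-values fs ys
  ...   | zs , ys≤zs , zs⊆ys , uniq′ , same′ = zs ,
      (begin
        length xs                             ≤⟨ xs≤ys ⟩
        q * length ys                         ≤⟨ *-monoʳ-≤ q ys≤zs ⟩
        q * (q ^ length fs * length zs)       ≡⟨ sym (*-assoc q (q ^ length fs) (length zs)) ⟩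
        q ^ suc (length fs) * length zs       ∎) ,
      (λ x∈ → ys⊆xs (zs⊆ys x∈)) , (λ u → uniq′ (uniq u)) ,
      λ x∈ y∈ → same (zs⊆ys x∈) (zs⊆ys y∈) ∷ same′ x∈ y∈
    where open ≤-Reasoning

  pairs : ∀ n → List (Fin n × Fin n)
  pairs n = filter (λ (u , v) → u <? v) (cartesianProduct (allFin n) (allFin n))

  pairs-unique : ∀ n → Unique (pairs n)
  pairs-unique n = filter⁺ _ (cartesianProduct⁺ (allFin⁺ n) (allFin⁺ n))

  edges : ∀ {n} → (Fin n → Fin n → Bool) → List (Fin n × Fin n)
  edges {n} E = filterᵇ (λ (u , v) → E u v) (pairs n)

  ∈-edges⁻ : ∀ {n} E {u v : Fin n} → (u , v) ∈ edges E → u Fin.< v × E u v ≡ true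
  ∈-edges⁻ {n} E uv∈ with ∈-filter⁻ (T? ∘ λ (u , v) → E u v) {xs = pairs n} uv∈
  ... | uv∈pairs , Tuv = proj₂ (∈-filter⁻ (λ (u , v) → u <? v) {xs = cartesianProduct (allFin n) (allFin n)} uv∈pairs) ,
                         Equivalence.to T-≡ Tuv

  ∈-edges⁺ : ∀ {n} E {u v : Fin n} → u Fin.< v → E u v ≡ true → (u , v) ∈ edges E
  ∈-edges⁺ E {u} {v} u<v Euv = ∈-filter⁺ (T? ∘ λ (u , v) → E u v)
    (∈-filter⁺ (λ (u , v) → u <? v) (∈-cartesianProduct⁺ (∈-allFin u) (∈-allFin v)) u<v)
    (Equivalence.from T-≡ Euv)

  edges-unique : ∀ {n} (E : Fin n → Fin n → Bool) → Unique (edges E)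
  edges-unique {n} E = filter⁺ (T? ∘ λ (u , v) → E u v) (pairs-unique n)

  mod-injective : ∀ {q} .{{_ : NonZero q}} a b → a mod q ≡ b mod q → a % q ≡ b % q
  mod-injective {q} a b eq = trans (sym (toℕ-fromℕ< (m%n<n a q))) (trans (cong toℕ eq) (toℕ-fromℕ< (m%n<n b q)))

  module _ {V} {H : Graph V} {n p k : ℕ} (pp : Prime p) (k≤p : k ≤ p) (φ : ℕ → Fin n × Fin n → ℕ)
    (φ∤ : ∀ {j} → j < k → ∀ {e} → e ∈ pairs n → ¬ p ∣ φ j e)
    (copy-labelling : ∀ {E} → IsCopyOf H E →
       1 ≤ length (edges E) × length (edges E) ≤ 2 * k × Labelling p k φ (edges E)) where

    -- One pigeonhole step for the edge count costs 2k + 1, and each of the k syndromes costs p.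
    code-from-syndromes : Σ (List (GraphOn n)) λ F → IsCode H F × 2 ^ (n C 2) ≤ suc (2 * k) * p ^ k * length F
    code-from-syndromes = extract (popular-value (λ c → edgeCount pp k≤p φ (pairs n) φ∤ (edge c) mod suc (2 * k)) (codes n))
      where
      instance
        p≢0 : NonZero p
        p≢0 = prime⇒nonZero pp

      edge : Code n → Fin n × Fin n → Bool
      edge c (u , v) = adjᶜ c u v

      count : Code n → ℕ
      count c = edgeCount pp k≤p φ (pairs n) φ∤ (edge c)

      synd : ℕ → Code n → ℕ
      synd j c = syndrome pp k≤p φ (pairs n) φ∤ j (edge c)

      synds : List (Code n → Fin p)
      synds = map (λ j c → synd j c mod p) (upTo k)

      extract : (∃ λ ys → length (codes n) ≤ suc (2 * k) * length ys × (∀ {c} → c ∈ ys → c ∈ codes n) ×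
                 (Unique (codes n) → Unique ys) × (∀ {c d} → c ∈ ys → d ∈ ys → count c mod suc (2 * k) ≡ count d mod suc (2 * k))) → _
      extract (ys , codes≤ys , _ , uniq , counts) with popular-values synds ys
      ... | zs , ys≤zs , zs⊆ys , uniq′ , syndromes = map decode zs ,
          AllPairs.map⁺ (allPairs-map-∈ separated (uniq′ (uniq (codes-unique n)))) ,
          (begin
            2 ^ (n C 2)                                 ≡⟨ sym (length-codes n) ⟩
            length (codes n)                            ≤⟨ codes≤ys ⟩
            suc (2 * k) * length ys                     ≤⟨ *-monoʳ-≤ (suc (2 * k)) ys≤zs ⟩
            suc (2 * k) * (p ^ length synds * length zs) ≡⟨ sym (*-assoc (suc (2 * k)) (p ^ length synds) (length zs)) ⟩
            suc (2 * k) * p ^ length synds * length zs  ≡⟨ cong₂ (λ e l → suc (2 * k) * p ^ e * l)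
                                                             (trans (length-map _ (upTo k)) (length-upTo k)) (sym (length-map decode zs)) ⟩
            suc (2 * k) * p ^ k * length (map decode zs) ∎)
        where
        open ≤-Reasoning
        separated : ∀ {c d} → c ∈ zs → d ∈ zs → c ≢ d →
                    Distinct (decode c) (decode d) × ¬ IsCopyOf H (symDiff (decode c) (decode d))
        separated {c} {d} c∈ d∈ c≢d = decode-distinct c≢d , λ copy →
          let 1≤ , ≤2k , lab = copy-labelling copy in
          syndromes-separate pp k≤p φ (pairs n) φ∤ (edge c) (edge d)
            (mod-injective (count c) (count d) (counts (zs⊆ys c∈) (zs⊆ys d∈)))
            (λ {j} j<k → mod-injective (synd j c) (synd j d)
              (All.lookup (All.map⁻ (syndromes c∈ d∈)) (∈-upTo⁺ j<k)))
            1≤ ≤2k lab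

  -- A common presentation of star and matching copies. Repetitions among the listed edges do no
  -- harm, since only the bounds 1 and 2k on their number are required.
  record Edges {n} (E : Fin n → Fin n → Bool) (t : ℕ) : Set where
    field
      end₁ end₂ : Fin t → Fin n
      is-edge   : ∀ i → E (end₁ i) (end₂ i) ≡ true × E (end₂ i) (end₁ i) ≡ true
      loopless  : ∀ i → end₁ i ≢ end₂ i
      complete  : ∀ u v → E u v ≡ true → ∃ λ i → (end₁ i ≡ u × end₂ i ≡ v) ⊎ (end₁ i ≡ v × end₂ i ≡ u)

  module _ {n t} {E : Fin n → Fin n → Bool} (es : Edges E t) where
    open Edges es

    ordered : Fin n → Fin n → Fin n × Fin n
    ordered u v with u <? v
    ... | yes _ = u , v
    ... | no  _ = v , u

    ordered-< : ∀ {u v} → u Fin.< v → ordered u v ≡ (u , v)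
    ordered-< {u} {v} u<v with u <? v
    ... | yes _  = refl
    ... | no u≮v = contradiction u<v u≮v

    ordered-> : ∀ {u v} → u Fin.< v → ordered v u ≡ (u , v)
    ordered-> {u} {v} u<v with v <? u
    ... | yes v<u = contradiction v<u (<⇒≯ u<v)
    ... | no  _   = refl

    length-edges≤ : length (edges E) ≤ t
    length-edges≤ = ≤-trans
      (unique-⊆⇒length≤ {ys = map (λ i → ordered (end₁ i) (end₂ i)) (allFin t)} (edges-unique E) listed)
      (≤-reflexive (trans (length-map _ (allFin t)) (length-tabulate {n = t} (λ i → i))))
      where
      listed : ∀ {e} → e ∈ edges E → e ∈ map (λ i → ordered (end₁ i) (end₂ i)) (allFin t)
      listed {u , v} e∈ with ∈-edges⁻ E e∈
      ... | u<v , Euv with complete u v Euv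
      ...   | i , inj₁ (refl , refl) = subst (_∈ map (λ i → ordered (end₁ i) (end₂ i)) (allFin t)) (ordered-< u<v) (∈-map⁺ _ (∈-allFin i))
      ...   | i , inj₂ (refl , refl) = subst (_∈ map (λ i → ordered (end₁ i) (end₂ i)) (allFin t)) (ordered-> u<v) (∈-map⁺ _ (∈-allFin i))

    length-edges≥1 : 1 ≤ t → 1 ≤ length (edges E)
    length-edges≥1 1≤t = nonempty some-edge
      where
      i = fromℕ< 1≤t
      some-edge : ∃ λ e → e ∈ edges E
      some-edge with <-cmp (end₁ i) (end₂ i)
      ... | tri< lt _ _ = _ , ∈-edges⁺ E lt (proj₁ (is-edge i))
      ... | tri≈ _ eq _ = contradiction eq (loopless i)
      ... | tri> _ _ gt = _ , ∈-edges⁺ E gt (proj₂ (is-edge i))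
      nonempty : ∀ {A : Set} {xs : List A} → (∃ λ x → x ∈ xs) → 1 ≤ length xs
      nonempty {xs = _ ∷ _} _ = s≤s z≤n

  prime∤small : ∀ {p m} → 0 < m → m < p → ¬ p ∣ m
  prime∤small 0<m m<p p∣m = contradiction m<p (≤⇒≯ (∣⇒≤ {{>-nonZero 0<m}} p∣m))

  module _ {n p k : ℕ} (pp : Prime p) (n+k≤p : n + k ≤ p) (1≤k : 1 ≤ k) where

    private
      k≤p : k ≤ p
      k≤p = ≤-trans (m≤n+m k n) n+k≤p

      1≤2k : 1 ≤ 2 * k
      1≤2k = ≤-trans 1≤k (m≤n*m k 2)

      -- Numbering from 1 keeps `j + vertex u` nonzero even at j = 0; with j < k it also stays below
      -- n + k ≤ p.
      vertex : Fin n → ℕ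
      vertex u = suc (toℕ u)

      vertex<p : ∀ u → vertex u < p
      vertex<p u = begin-strict
        suc (toℕ u) ≤⟨ toℕ<n u ⟩
        n           <⟨ m<m+n n 1≤k ⟩
        n + k       ≤⟨ n+k≤p ⟩
        p           ∎
        where open ≤-Reasoning

      shifted∤ : ∀ {j} → j < k → ∀ u → ¬ p ∣ j + vertex u
      shifted∤ {j} j<k u = prime∤small (≤-trans (s≤s z≤n) (m≤n+m (vertex u) j)) (begin-strict
        j + suc (toℕ u) <⟨ +-mono-<-≤ j<k (toℕ<n u) ⟩
        k + n           ≡⟨ +-comm k n ⟩
        n + k           ≤⟨ n+k≤p ⟩
        p               ∎)
        where open ≤-Reasoning

      vertex-injective : ∀ {u v} → vertex u ≡ vertex v → u ≡ v
      vertex-injective eq = toℕ-injective (suc-injective eq)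

    star-code : Σ (List (GraphOn n)) λ F →
                IsCode (Star (2 * k)) F × 2 ^ (n C 2) ≤ suc (2 * k) * p ^ k * length F
    star-code = code-from-syndromes {H = Star (2 * k)} pp k≤p φ φ∤ labelling
      where
      -- Symmetric in the two ends, because the value must be defined before the centre of a
      -- possible star difference is known.
      φ : ℕ → Fin n × Fin n → ℕ
      φ j (u , v) = (j + vertex u) * (j + vertex v)

      φ∤ : ∀ {j} → j < k → ∀ {e} → e ∈ pairs n → ¬ p ∣ φ j e
      φ∤ {j} j<k {u , v} _ p∣ = [ shifted∤ j<k u , shifted∤ j<k v ]′ (euclidsLemma _ _ pp p∣)

      labelling : ∀ {E} → IsCopyOf (Star (2 * k)) E →
                  1 ≤ length (edges E) × length (edges E) ≤ 2 * k × Labelling p k φ (edges E)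
      labelling {E} (ψ , ψ-injective , spec) = length-edges≥1 star 1≤2k , length-edges≤ star , record
        { scale     = λ j → j + vertex c
        ; label     = λ e → vertex (other e)
        ; scale∤    = λ j<k → shifted∤ j<k c
        ; splits    = λ j e∈ → splits j (centred e∈)
        ; label<p   = λ e → vertex<p (other e)
        ; injective = λ e∈ e′∈ eq → injective (centred e∈) (centred e′∈) (vertex-injective eq)
        }
        where
        c : Fin n
        c = ψ Fin.zero

        star : Edges E (2 * k)
        star = record
          { end₁     = λ _ → c
          ; end₂     = λ i → ψ (Fin.suc i)
          ; is-edge  = λ i → proj₂ (spec _ _) (Fin.zero , Fin.suc i , refl , refl , refl) ,
                             proj₂ (spec _ _) (Fin.suc i , Fin.zero , refl , refl , refl)
          ; loopless = λ i eq → contradiction (ψ-injective eq) λ ()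
          ; complete = λ u v Euv → ends (proj₁ (spec u v) Euv)
          }
          where
          ends : ∀ {u v} → (∃ λ a → ∃ λ b → starAdj (2 * k) a b ≡ true × ψ a ≡ u × ψ b ≡ v) →
                 ∃ λ i → (c ≡ u × ψ (Fin.suc i) ≡ v) ⊎ (c ≡ v × ψ (Fin.suc i) ≡ u)
          ends (Fin.zero  , Fin.suc i , _ , eq , eq′) = i , inj₁ (eq , eq′)
          ends (Fin.suc i , Fin.zero  , _ , eq , eq′) = i , inj₂ (eq′ , eq)

        other : Fin n × Fin n → Fin n
        other (u , v) with u ≟ c
        ... | yes _ = v
        ... | no  _ = u

        Centred : Fin n × Fin n → Set
        Centred (u , v) = u Fin.< v × (u ≡ c ⊎ v ≡ c)

        centred : ∀ {e} → e ∈ edges E → Centred e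
        centred {u , v} e∈ with ∈-edges⁻ E e∈
        ... | u<v , Euv with Edges.complete star u v Euv
        ...   | _ , inj₁ (c≡u , _) = u<v , inj₁ (sym c≡u)
        ...   | _ , inj₂ (c≡v , _) = u<v , inj₂ (sym c≡v)

        splits : ∀ j {e} → Centred e → φ j e ≡ (j + vertex c) * (j + vertex (other e))
        splits j {u , v} (u<v , uv∋c) with u ≟ c | uv∋c
        ... | yes refl | _         = refl
        ... | no  u≢c  | inj₁ u≡c  = contradiction u≡c u≢c
        ... | no  _    | inj₂ refl = *-comm (j + vertex u) (j + vertex c)

        -- Pairs are increasing, so one outer end cannot lie above the centre in one pair and below
        -- it in the other.
        injective : ∀ {e e′} → Centred e → Centred e′ → other e ≡ other e′ → e ≡ e′
        injective {u , v} {u′ , v′} (u<v , uv∋c) (u′<v′ , u′v′∋c) eq with u ≟ c | uv∋c | u′ ≟ c | u′v′∋c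
        ... | no u≢c   | inj₁ u≡c  | _         | _          = contradiction u≡c u≢c
        ... | _        | _         | no u′≢c   | inj₁ u′≡c  = contradiction u′≡c u′≢c
        ... | yes refl | _         | yes refl  | _          = cong (_ ,_) eq
        ... | yes refl | _         | no _      | inj₂ refl  = contradiction u<v (<⇒≯ (subst (Fin._< _) (sym eq) u′<v′))
        ... | no _     | inj₂ refl | yes refl  | _          = contradiction u<v (<⇒≯ (subst (_ Fin.<_) (sym eq) u′<v′))
        ... | no _     | inj₂ refl | no _      | inj₂ refl  = cong (_, _) eq

    matching-code : Σ (List (GraphOn n)) λ F →
                    IsCode (Matching (2 * k)) F × 2 ^ (n C 2) ≤ suc (2 * k) * p ^ k * length F
    matching-code = code-from-syndromes {H = Matching (2 * k)} pp k≤p φ φ∤ labelling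
      where
      -- One end suffices, as an edge of a matching is determined by either of its ends.
      φ : ℕ → Fin n × Fin n → ℕ
      φ j (u , v) = j + vertex u

      φ∤ : ∀ {j} → j < k → ∀ {e} → e ∈ pairs n → ¬ p ∣ φ j e
      φ∤ j<k {u , v} _ = shifted∤ j<k u

      labelling : ∀ {E} → IsCopyOf (Matching (2 * k)) E →
                  1 ≤ length (edges E) × length (edges E) ≤ 2 * k × Labelling p k φ (edges E)
      labelling {E} (ψ , ψ-injective , spec) = length-edges≥1 matching 1≤2k , length-edges≤ matching , record
        { scale     = λ _ → 1
        ; label     = λ (u , v) → vertex u
        ; scale∤    = λ _ p∣1 → ¬prime[1] (subst Prime (∣1⇒≡1 p∣1) pp)
        ; splits    = λ j _ → sym (*-identityˡ _)
        ; label<p   = λ (u , v) → vertex<p u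
        ; injective = λ e∈ e′∈ eq → injective e∈ e′∈ (vertex-injective eq)
        }
        where
        ≡ᵇ-refl : ∀ i → (i ≡ᵇ i) ≡ true
        ≡ᵇ-refl i = Equivalence.to T-≡ (≡⇒≡ᵇ i i refl)

        matching : Edges E (2 * k)
        matching = record
          { end₁     = λ i → ψ (i , false)
          ; end₂     = λ i → ψ (i , true)
          ; is-edge  = λ i →
              proj₂ (spec _ _) ((i , false) , (i , true) , cong (_∧ true) (≡ᵇ-refl (toℕ i)) , refl , refl) ,
              proj₂ (spec _ _) ((i , true) , (i , false) , cong (_∧ true) (≡ᵇ-refl (toℕ i)) , refl , refl)
          ; loopless = λ i eq → contradiction (cong proj₂ (ψ-injective eq)) λ ()
          ; complete = λ u v Euv → ends (proj₁ (spec u v) Euv)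
          }
          where
          ends : ∀ {u v} → (∃ λ a → ∃ λ b → matchAdj (2 * k) a b ≡ true × ψ a ≡ u × ψ b ≡ v) →
                 ∃ λ i → (ψ (i , false) ≡ u × ψ (i , true) ≡ v) ⊎ (ψ (i , false) ≡ v × ψ (i , true) ≡ u)
          ends ((i , b) , (j , b′) , adjacent , eq , eq′) with toℕ i ≡ᵇ toℕ j in i≡ᵇj
          ends ((i , b) , (j , b′) , () , eq , eq′) | false
          ... | true with toℕ-injective (≡ᵇ⇒≡ (toℕ i) (toℕ j) (Equivalence.from T-≡ i≡ᵇj))
          ends ((i , false) , (i , true)  , _ , eq , eq′) | true | refl = i , inj₁ (eq , eq′)
          ends ((i , true)  , (i , false) , _ , eq , eq′) | true | refl = i , inj₂ (eq′ , eq)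

        -- Two edges of the copy that share a vertex come from the same index, since ψ is injective;
        -- the mixed cases would identify a `false` end with a `true` end.
        injective : ∀ {e e′} → e ∈ edges E → e′ ∈ edges E → proj₁ e ≡ proj₁ e′ → e ≡ e′
        injective {u , v} {.u , v′} e∈ e′∈ refl
          with Edges.complete matching u v (proj₂ (∈-edges⁻ E e∈))
             | Edges.complete matching u v′ (proj₂ (∈-edges⁻ E e′∈))
        ... | i , inj₁ (refl , refl) | j , inj₁ (eq , refl) with ψ-injective eq
        ...   | refl = refl
        injective e∈ e′∈ refl
            | i , inj₁ (refl , refl) | j , inj₂ (refl , eq) with () ← ψ-injective eq
        injective e∈ e′∈ refl
            | i , inj₂ (refl , refl) | j , inj₁ (eq , refl) with () ← ψ-injective eq
        injective e∈ e′∈ refl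
            | i , inj₂ (refl , refl) | j , inj₂ (refl , eq) with ψ-injective eq
        ...   | refl = refl

open import Data.Nat using (ℕ; _≤_; _*_)
open import Data.Product using (_×_)

-- A prime p of order n.

module PrimeChoice where

  open import Data.Nat
  open import Data.Nat.Properties
  open import Data.Nat.Primality using (Prime)
  open import Data.Nat.Tactic.RingSolver using (solve-∀)
  open import Data.Product using (∃; _×_; _,_)
  open import Data.Sum using (inj₁; inj₂)
  open import Relation.Nullary using (yes; no; contradiction)
  open import Relation.Binary.PropositionalEquality
  open PrimeGap

  -- The exponent is raised only when the bound reaches 4^g exactly, so 4^g overshoots by a factor
  -- of at most 4.
  square-power-above : ∀ m → ∃ λ g → suc m ≤ 2 ^ g * 2 ^ g × 2 ^ g * 2 ^ g ≤ 4 * suc m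
  square-power-above zero = 0 , ≤-refl , s≤s z≤n
  square-power-above (suc m) with square-power-above m
  ... | g , m<4^g , 4^g≤4m with m≤n⇒m<n∨m≡n m<4^g
  ...   | inj₁ m+1<4^g = g , m+1<4^g , ≤-trans 4^g≤4m (*-monoʳ-≤ 4 (n≤1+n (suc m)))
  ...   | inj₂ m+1≡4^g = suc g ,
          subst (suc (suc m) ≤_) (sym quadruple) (+-mono-≤ {1} {suc m} (s≤s z≤n) (m≤m+n (suc m) (2 * suc m))) ,
          ≤-trans (≤-reflexive quadruple) (*-monoʳ-≤ 4 (n≤1+n (suc m)))
    where
    regroup : ∀ t → 2 * t * (2 * t) ≡ 4 * (t * t)
    regroup = solve-∀
    quadruple : 2 ^ suc g * 2 ^ suc g ≡ 4 * suc m
    quadruple = trans (regroup (2 ^ g)) (cong (4 *_) (sym m+1≡4^g))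

  -- Here t stands for 2^10: the hypotheses force g ≥ 10, the range of `prime-in-gap`.
  prime-above-square : ∀ {t} → (∀ {g} → g < 10 → 2 ^ g < t) → ∀ n k → k ≤ n → 1 ≤ n → t * t ≤ n →
                       ∃ λ p → Prime p × n + k ≤ p × p ≤ 128 * n
  -- The argument `n-1 + n` is 2n - 1, giving 2n ≤ 4^g ≤ 8n. The lower bound covers n + k since k ≤
  -- n, and the gap of ratio 16 yields p ≤ 128 n.
  prime-above-square {t} 2^g<t n@(suc n-1) k k≤n _ large with square-power-above (n-1 + n)
  ... | g , 2n≤4^g , 4^g≤8n with 10 ≤? g
  ...   | no g<10 = contradiction 2n≤4^g (<⇒≱ (begin-strict
          2 ^ g * 2 ^ g     <⟨ *-mono-< (2^g<t (≰⇒> g<10)) (2^g<t (≰⇒> g<10)) ⟩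
          t * t             ≤⟨ large ⟩
          n                 ≤⟨ m≤m+n n n ⟩
          n + n             ∎))
    where open ≤-Reasoning
  ...   | yes 10≤g with prime-in-gap g 10≤g
  ...     | p , pp , 4^g<p , p≤16*4^g = p , pp , ≤-trans (+-monoʳ-≤ n k≤n) (≤-trans 2n≤4^g (<⇒≤ 4^g<p)) , (begin
            p                         ≤⟨ p≤16*4^g ⟩
            16 * (2 ^ g * 2 ^ g)      ≤⟨ *-monoʳ-≤ 16 4^g≤8n ⟩
            16 * (4 * (n + n))        ≡⟨ regroup n ⟩
            128 * n                   ∎)
    where
    open ≤-Reasoning
    regroup : ∀ n → 16 * (4 * (n + n)) ≡ 128 * n
    regroup = solve-∀

  abstract
    primeThreshold : ℕ
    primeThreshold = 2 ^ 10 * 2 ^ 10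

    prime-of-linear-size : ∀ n k → k ≤ n → 1 ≤ n → primeThreshold ≤ n → ∃ λ p → Prime p × n + k ≤ p × p ≤ 128 * n
    prime-of-linear-size = prime-above-square {2 ^ 10} (^-monoʳ-< 2 (s≤s (s≤s z≤n)))

-- Lower bounds for stars and matchings.

module LowerBounds where

  open import Data.Nat
  open import Data.Nat.Properties
  open import Data.Nat.Combinatorics using (_C_)
  open import Data.Nat.Primality using (Prime)
  open import Data.Nat.Tactic.RingSolver using (solve-∀)
  open import Data.List using (List; length)
  open import Data.Product using (Σ; _×_; _,_)
  open import Relation.Binary.PropositionalEquality
  open Powers
  open PrimeChoice
  open LowerBound

  -- 2k + 1 residues of the edge count, and 128^k from p ≤ 128 n.
  lowerConstant : ℕ → ℕ
  lowerConstant k = suc (2 * k) * 128 ^ k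

  rescale : ∀ {p n} k x {y} → p ≤ 128 * n → y ≤ suc (2 * k) * p ^ k * x → y ≤ lowerConstant k * x * n ^ k
  rescale {p} {n} k x {y} p≤128n y≤ = begin
    y                                         ≤⟨ y≤ ⟩
    suc (2 * k) * p ^ k * x                   ≤⟨ *-monoˡ-≤ x (*-monoʳ-≤ (suc (2 * k)) (^-monoˡ-≤ k p≤128n)) ⟩
    suc (2 * k) * (128 * n) ^ k * x           ≡⟨ cong (λ u → suc (2 * k) * u * x) ([m*n]^k≡m^k*n^k 128 n k) ⟩
    suc (2 * k) * (128 ^ k * n ^ k) * x       ≡⟨ regroup (suc (2 * k)) (128 ^ k) (n ^ k) x ⟩
    lowerConstant k * x * n ^ k               ∎
    where
    open ≤-Reasoning
    regroup : ∀ c d z x → c * (d * z) * x ≡ c * d * x * z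
    regroup = solve-∀

  module _ {k n : ℕ} (1≤k : 1 ≤ k) (k≤n : k ≤ n) (large : primeThreshold ≤ n) where

    lower-bound : ∀ {V} {H : Graph V} →
      (∀ {p} → Prime p → n + k ≤ p → Σ (List (GraphOn n)) λ F → IsCode H F × 2 ^ (n C 2) ≤ suc (2 * k) * p ^ k * length F) →
      Σ (List (GraphOn n)) λ F → IsCode H F × 2 ^ (n C 2) ≤ lowerConstant k * length F * n ^ k
    lower-bound code-for = rescaled (prime-of-linear-size n k k≤n (≤-trans 1≤k k≤n) large)
      where
      rescaled : _ → _
      rescaled (p , pp , n+k≤p , p≤) =
        let F , code , bound = code-for pp n+k≤p in F , code , rescale k (length F) p≤ bound

    star-lower : Σ (List (GraphOn n)) λ F →
                 IsCode (Star (2 * k)) F × 2 ^ (n C 2) ≤ lowerConstant k * length F * n ^ k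
    star-lower = lower-bound {H = Star (2 * k)} (λ pp n+k≤p → star-code pp n+k≤p 1≤k)

    matching-lower : Σ (List (GraphOn n)) λ F →
                     IsCode (Matching (2 * k)) F × 2 ^ (n C 2) ≤ lowerConstant k * length F * n ^ k
    matching-lower = lower-bound {H = Matching (2 * k)} (λ pp n+k≤p → matching-code pp n+k≤p 1≤k)

theorem1p2 : ∀ (k : ℕ) → 1 ≤ k →
    ThetaInvPow (Star (2 * k)) k × ThetaInvPow (Matching (2 * k)) k
theorem1p2 k 1≤k =
  (lowerConstant k , upperConstant k , threshold , λ n N≤n →
    star-lower 1≤k (k≤n N≤n) (large N≤n) , star-upper 1≤k (room N≤n)) ,
  (lowerConstant k , upperConstant k , threshold , λ n N≤n →
    matching-lower 1≤k (k≤n N≤n) (large N≤n) , matching-upper 1≤k (room N≤n))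
  where
  open import Data.Nat using (_+_)
  open import Data.Nat.Properties using (≤-trans; m≤m+n; m≤n+m)
  open import Data.Product using (_,_)
  open PrimeChoice
  open UpperBounds
  open LowerBounds

  threshold : ℕ
  -- The sum serves as an upper bound for the three separate requirements on n.
  threshold = k + (primeThreshold + 2 * dimension k)

  k≤n : ∀ {n} → threshold ≤ n → k ≤ n
  k≤n = ≤-trans (m≤m+n k _)

  large : ∀ {n} → threshold ≤ n → primeThreshold ≤ n
  large = ≤-trans (≤-trans (m≤m+n primeThreshold (2 * dimension k)) (m≤n+m _ k))

  room : ∀ {n} → threshold ≤ n → 2 * dimension k ≤ n
  room = ≤-trans (≤-trans (m≤n+m (2 * dimension k) primeThreshold) (m≤n+m _ k))
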